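{- Let $q$ be a prime power and use the setting described in the context. Let $\mathcal{L}_0$ be the set of planes obtained from the lifted Gabidulin code $\mathcal{L}$ by removing all planes $\Gamma_f$ with $f(x)=r(ux^q-u^qx)$ for some $r\in\mathbb{F}_{q^4}^\times$ and $u\in\mathbb{F}_{q^4}\setminus W$ (so that $\#\mathcal{L}_0=q^8-q^7+q^3$). Then $\mathcal{L}_0$ can be augmented by $(q^4-1)(q^3+q+1)$ new planes, each meeting $S$ in a point, with exactly $(q-1)(q^3+q+1)$ of them passing through any given point $P$ of $S$, to a plane subspace code $\mathcal{C}$ of size $\#\mathcal{C}=q^8+q^5+q^4-q-1$. Moreover, $\mathcal{C}$ may be chosen to be invariant under the group $\Sigma$.
   Context: $\mathbb{F}_{q^4}$ is the field with $q^4$ elements, viewed as a $4$-dimensional vector space over $\mathbb{F}_q$. Let $W=\{x\in\mathbb{F}_{q^4}: x+x^q+x^{q^2}+x^{q^3}=0\}$ (the trace-zero subspace, of $\mathbb{F}_q$-dimension $3$), $V=W\times\mathbb{F}_{q^4}$ (a $7$-dimensional $\mathbb{F}_q$-space) and $S=\{0\}\times\mathbb{F}_{q^4}$ (a $4$-dimensional subspace). Points, lines, planes of $V$ are its $\mathbb{F}_q$-subspaces of dimension $1,2,3$. A plane subspace code is a set of planes of $V$ any two distinct members of which intersect in a subspace of dimension at most $1$. For an $\mathbb{F}_q$-linear map $f\colon W\to\mathbb{F}_{q^4}$ let $\Gamma_f=\{(x,f(x)):x\in W\}$. The Gabidulin code is $\mathcal{G}=\{f\colon W\to\mathbb{F}_{q^4},\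 x\mapsto a_0x+a_1x^q : a_0,a_1\in\mathbb{F}_{q^4}\}$ and the lifted Gabidulin code is $\mathcal{L}=\{\Gamma_f: f\in\mathcal{G}\}$ (a set of $q^8$ planes). $\Sigma$ is the group of $\mathbb{F}_q$-linear maps $V\to V$, $(x,y)\mapsto(x,ry)$ with $r\in\mathbb{F}_{q^4}^\times$; a set of planes is $\Sigma$-invariant if it is mapped to itself by every element of $\Sigma$. -}

module Defs where

open import Level using (0ℓ)
open import Data.Nat using (ℕ; zero; suc; _≤_)
import Data.Nat as ℕ
open import Data.Bool using (Bool; true; false; _∧_; _∨_; not)
open import Data.Fin using (Fin)
open import Data.Product using (Σ; ∃; _×_; _,_; proj₁; proj₂)
open import Data.List using (List; length; filterᵇ; map; cartesianProduct; _++_)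
open import Data.Bool.ListAction using (all; any)
open import Data.List.Membership.Propositional using (_∈_)
open import Data.List.Relation.Unary.Any using (Any)
open import Data.List.Relation.Unary.All using (All)
open import Data.List.Relation.Unary.AllPairs using (AllPairs)
open import Data.List.Relation.Unary.Unique.Propositional using (Unique)
open import Relation.Nullary using (¬_)
open import Relation.Nullary.Decidable using (⌊_⌋)
open import Relation.Binary.Definitions using (DecidableEquality)
open import Relation.Binary.PropositionalEquality using (_≡_; _≢_)
open import Algebra.Structures using (IsCommutativeRing)

record FiniteField : Set₁ where
  infixl 6 _+_
  infixl 7 _*_
  field
    Carrier  : Set
    _+_ _*_  : Carrier → Carrier → Carrier
    -_       : Carrier → Carrier
    0# 1#    : Carrier
    isCommutativeRing : IsCommutativeRing _≡_ _+_ _*_ -_ 0# 1#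
    0≢1      : 0# ≢ 1#
    inverse  : ∀ x → x ≢ 0# → Σ Carrier (λ y → x * y ≡ 1#)
    _≟_      : DecidableEquality Carrier
    elems    : List Carrier
    complete : ∀ x → x ∈ elems
    unique   : Unique elems

card : FiniteField → ℕ
card K = length (FiniteField.elems K)

-- The setting of the paper, for a prime power q and the field K = F_{q^4}
-- (the hypothesis card K ≡ q ^ 4 is imposed in the theorem statement).

module Setting (q : ℕ) (K : FiniteField) where
  open FiniteField K public

  infix 4 _==_
  _==_ : Carrier → Carrier → Bool
  x == y = ⌊ x ≟ y ⌋

  pow : Carrier → ℕ → Carrier
  pow x zero    = 1#
  pow x (suc n) = x * pow x n

  IsFq : Carrier → Set
  IsFq a = pow a q ≡ a

  Tr : Carrier → Carrier
  Tr x = x + pow x q + pow x (q ℕ.^ 2) + pow x (q ℕ.^ 3)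

  inW : Carrier → Bool
  inW x = Tr x == 0#

  -- Ambient vectors: pairs (x , y) ∈ F_{q^4} × F_{q^4};
  -- V = W × F_{q^4} is the set of pairs with x ∈ W.
  Vec2 : Set
  Vec2 = Carrier × Carrier

  0v : Vec2
  0v = 0# , 0#

  _⊕_ : Vec2 → Vec2 → Vec2
  (x , y) ⊕ (x' , y') = (x + x') , (y + y')

  _·_ : Carrier → Vec2 → Vec2
  a · (x , y) = (a * x) , (a * y)

  allVecs : List Vec2
  allVecs = cartesianProduct elems elems

  Subset : Set
  Subset = Vec2 → Bool

  _∋_ : Subset → Vec2 → Set
  U ∋ v = U v ≡ true

  record IsSubspace (U : Subset) : Set where
    field
      inV     : ∀ x y → U ∋ (x , y) → Tr x ≡ 0#
      zero∈   : U ∋ 0v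
      +-closed : ∀ v w → U ∋ v → U ∋ w → U ∋ (v ⊕ w)
      ·-closed : ∀ a v → IsFq a → U ∋ v → U ∋ (a · v)

  lincomb : ∀ {d} → (Fin d → Carrier) → (Fin d → Vec2) → Vec2
  lincomb {zero}  c b = 0v
  lincomb {suc d} c b = (c Fin.zero · b Fin.zero) ⊕ lincomb (λ i → c (Fin.suc i)) (λ i → b (Fin.suc i))
    where import Data.Fin as Fin

  HasDim : Subset → ℕ → Set
  HasDim U d =
    Σ (Fin d → Vec2) λ b →
      (∀ i → U ∋ b i) ×
      (∀ (c : Fin d → Carrier) → (∀ i → IsFq (c i)) → lincomb c b ≡ 0v → ∀ i → c i ≡ 0#) ×
      (∀ v → U ∋ v → Σ (Fin d → Carrier) λ c → (∀ i → IsFq (c i)) × lincomb c b ≡ v)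

  DimAtMost : Subset → ℕ → Set
  DimAtMost U k = Σ ℕ λ d → d ≤ k × HasDim U d

  IsPoint IsPlane : Subset → Set
  IsPoint U = IsSubspace U × HasDim U 1
  IsPlane U = IsSubspace U × HasDim U 3

  _∩_ : Subset → Subset → Subset
  (U ∩ U') v = U v ∧ U' v

  _⊆ᵇ_ : Subset → Subset → Bool
  U ⊆ᵇ U' = all (λ v → not (U v) ∨ U' v) allVecs

  _⊆_ : Subset → Subset → Set
  U ⊆ U' = ∀ v → U ∋ v → U' ∋ v

  S : Subset
  S (x , y) = x == 0#

  Γ : Carrier → Carrier → Subset
  Γ a0 a1 (x , y) = inW x ∧ (y == a0 * x + a1 * pow x q)

  L : List Subset
  L = map (λ c → Γ (proj₁ c) (proj₂ c)) (cartesianProduct elems elems)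

  -- (a0 , a1) represents f(x) = r (u x^q - u^q x) with r ≠ 0, u ∉ W,
  -- i.e. a0 = - r u^q and a1 = r u
  removed : Carrier × Carrier → Bool
  removed (a0 , a1) =
    any (λ r → any (λ u →
      not (r == 0#) ∧ not (inW u) ∧ (a0 == - (r * pow u q)) ∧ (a1 == r * u)) elems) elems

  L₀ : List Subset
  L₀ = map (λ c → Γ (proj₁ c) (proj₂ c))
           (filterᵇ (λ c → not (removed c)) (cartesianProduct elems elems))

  -- a plane subspace code: a list of planes, any two members (at distinct
  -- positions) meeting in a subspace of dimension ≤ 1 (this forces the
  -- members to be pairwise distinct as subspaces)
  IsPlaneCode : List Subset → Set
  IsPlaneCode C = All IsPlane C × AllPairs (λ U U' → DimAtMost (U ∩ U') 1) C

  countThrough : Subset → List Subset → ℕ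
  countThrough P N = length (filterᵇ (λ U → P ⊆ᵇ U) N)

  -- σ_r(U) = { (x , r y) : (x , y) ∈ U } equals U'
  ImageEq : Carrier → Subset → Subset → Set
  ImageEq r U U' = ∀ x y → U' (x , r * y) ≡ U (x , y)

  SigmaInvariant : List Subset → Set
  SigmaInvariant C = ∀ r → r ≢ 0# → All (λ U → Any (λ U' → ImageEq r U U') C) C

  Conclusion : Set
  Conclusion =
    Σ (List Subset) λ N →
         length N ≡ (q ℕ.^ 4 ℕ.∸ 1) ℕ.* (q ℕ.^ 3 ℕ.+ q ℕ.+ 1)
         × All (λ U → IsPlane U × HasDim (U ∩ S) 1) N
         × (∀ P → IsPoint P → P ⊆ S → countThrough P N ≡ (q ℕ.∸ 1) ℕ.* (q ℕ.^ 3 ℕ.+ q ℕ.+ 1))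
         × IsPlaneCode (L₀ ++ N)
         × length (L₀ ++ N) ≡ q ℕ.^ 8 ℕ.+ q ℕ.^ 5 ℕ.+ q ℕ.^ 4 ℕ.∸ q ℕ.∸ 1
         × SigmaInvariant (L₀ ++ N)

{-# OPTIONS --safe #-}

-- Write δ(u,x) = u x^q - u^q x.  A two-dimensional Z = ⟨a, b⟩ ⊆ W and an element u ∉ W give the three-dimensional space
-- {(x, r δ(u,x) + t r δ(a,b)) : x ∈ Z, t ∈ F_q}.  Since δ is bilinear and alternating, each of its lines off S is
-- the graph over Z of r δ(u + z, ·) for some z ∈ Z; as a map of the Gabidulin code is determined by its restriction
-- to Z, such a line lies on a removed plane and on no plane of L₀.  The flag (Z, ⟨Z, u⟩) is encoded by e ∉ F_q with
-- ⟨Z, u⟩ = e^⊥, and the equations of the plane become Tr x = Tr (e x) = 0, φ(s y) = slope(e) x^q, where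
-- φ(y) = y - y^q, slope(e) = e^{q³} / (κ Δ Δ^q), Δ = e^{q³} - e^{q²} and κ^q = -κ.
--
-- The decisive fact is that slope(e) = α + β e^q with α, β ∈ F_q, where β = 0 forces e^{q²+1} ∈ F_q.  Two new planes
-- can only share a line if their slopes are F_q-proportional, hence only if the two values of e are proportional
-- or both lie on the quadric e^{q²+1} ∈ F_q.  So all q³ + q classes modulo F_q^× off the quadric may be used
-- together with a single class on it.

module Submission where

open import Defs
open import Algebra.Bundles using (CommutativeRing)
import Algebra.Properties.CommutativeSemiring.Binomial as Binomial
import Algebra.Properties.CommutativeSemiring.Exp as CommutativeExp
import Algebra.Properties.Monoid.Sum as Sum
import Algebra.Properties.Ring as RingProperties
import Algebra.Properties.Semiring.Exp as Exp
import Algebra.Properties.Semiring.Mult as Mult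
import Algebra.Solver.Ring
open import Algebra.Solver.Ring.AlmostCommutativeRing using (fromCommutativeRing; _-Raw-AlmostCommutative⟶_)
open import Algebra.Structures using (IsCommutativeMonoid; module IsCommutativeRing)
open import Data.Bool as Bool using (Bool; true; false; _∧_; _∨_; not; T; T?)
open import Data.Bool.ListAction using (any)
import Data.Bool.Properties as Bool
open import Data.Empty using (⊥-elim)
open import Data.Fin as Fin using (Fin; toℕ; inject₁; fromℕ)
import Data.Fin.Properties as Fin
open import Data.Integer as ℤ using (ℤ; -[1+_]; _⊖_; +0; +[1+_])
import Data.Integer.Properties as ℤ
open import Data.List using (List; []; _∷_; length; filter; filterᵇ; map; foldr; _++_; cartesianProduct; deduplicate)
open import Data.List.Membership.Propositional using (_∈_; find; lose)
open import Data.List.Membership.Propositional.Properties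
open import Data.List.Membership.Propositional.Properties.WithK using (unique∧set⇒bag)
open import Data.List.Properties using (length-map; length-++; filter-notAll)
open import Data.List.Relation.Binary.BagAndSetEquality using (∼bag⇒↭)
open import Data.List.Relation.Binary.Permutation.Propositional using (↭⇒↭ₛ)
import Data.List.Relation.Binary.Permutation.Setoid.Properties as Permutation
open import Data.List.Relation.Unary.All as All using (All; []; _∷_)
import Data.List.Relation.Unary.All.Properties as All
open import Data.List.Relation.Unary.AllPairs as AllPairs using (AllPairs; []; _∷_)
import Data.List.Relation.Unary.AllPairs.Properties as AllPairs
open import Data.List.Relation.Unary.Any using (Any; here; there; any?)
import Data.List.Relation.Unary.Any.Properties as Any
open import Data.List.Relation.Unary.Unique.Propositional using (Unique)
import Data.List.Relation.Unary.Unique.Propositional.Properties as Unique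
open import Data.Maybe using (Maybe; just; nothing)
open import Data.Nat as ℕ using (ℕ; zero; suc; _≤_; _<_; _!; _∸_; z≤n; s≤s; z<s)
open import Data.Nat.Combinatorics using (_C_; nCn≡1; nCk≡n!/k![n-k]!; k![n∸k]!∣n!)
open import Data.Nat.Divisibility using (_∣_; _∤_; ∣⇒≤; m∣m*n; divides; ∣1⇒≡1)
open import Data.Nat.DivMod using (m/n*n≡m)
open import Data.Nat.Primality using (Prime; euclidsLemma; ¬prime[1]; prime⇒nonTrivial)
import Data.Nat.Properties as ℕ
open import Data.Nat.Solver using (module +-*-Solver)
open import Data.Product using (Σ; _×_; _,_; proj₁; proj₂)
open import Data.Product.Properties using (≡-dec; ,-injective)
open import Data.Sum using (_⊎_; inj₁; inj₂)
open import Data.Unit using (⊤; tt)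
open import Data.Vec using (Vec; []; _∷_; replicate)
open import Function using (_∘_)
open import Function.Bundles using (Equivalence; mk⇔)
open import Relation.Binary.Definitions using (DecidableEquality)
open import Relation.Binary.PropositionalEquality
open import Relation.Nullary using (¬_; Dec; yes; no; does)
open import Relation.Nullary.Decidable using (¬?; _×-dec_; decidable-stable)
open import Relation.Unary using (Decidable)
open ≡-Reasoning

-- Origin of the slope: put `D = a b^q - a^q b` and `s = 1 / (r D)`. Then `s` times the term
-- `t r δ(a,b)` is the element `t` of F_q, which `φ` kills. For `x` in `Z` the row
-- `(x, x^q, x^{q²})` is a combination of the rows of `a` and `b`; by this relation the numerator of
-- `φ(δ(u,x) / D)` over `D D^q` collapses to `x^q` times the Moore determinant of `u, a, b`. As
-- `Z = {1,e}^⊥` and `⟨Z,u⟩ = e^⊥`, complementary minors make `D` a multiple of `Δ` and the Moore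
-- determinant a multiple of `e^{q³}`. Their signs alternate under Frobenius, so both factors change
-- sign under `x ↦ x^q` and are F_q-multiples of `κ`. A remaining factor in F_q^× is absorbed into
-- `s`.
--
-- Each chosen `e` is combined with all `q⁴ - 1` values of `s`. Scaling `y` only moves `s`, which
-- yields invariance under Σ, and the plane meets `S` in `s⁻¹ F_q`, so each `e` contributes `q - 1`
-- planes through every point of `S`.

private module ℕS = +-*-Solver

private variable
  A B : Set

-- Counting with duplicate-free lists

record Enumerates (P : A → Set) (xs : List A) : Set where
  field
    nodup    : Unique xs
    sound    : ∀ {x} → x ∈ xs → P x
    complete : ∀ {x} → P x → x ∈ xs

open Enumerates public

length-⊆ : ∀ {xs ys : List A} → Unique xs → (∀ {x} → x ∈ xs → x ∈ ys) → length xs ≤ length ys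
length-⊆ {xs = []} _ _ = z≤n
length-⊆ {xs = x ∷ xs} (x∉ ∷ u) sub with ∈-∃++ (sub (here refl))
... | as , bs , refl =
  ℕ.≤-trans (s≤s (length-⊆ u avoid))
    (ℕ.≤-reflexive (trans (cong suc (length-++ as)) (trans (sym (ℕ.+-suc (length as) _)) (sym (length-++ as)))))
  where
  avoid : ∀ {y} → y ∈ xs → y ∈ as ++ bs
  avoid y∈ with ∈-++⁻ as (sub (there y∈))
  ... | inj₁ p = ∈-++⁺ˡ p
  ... | inj₂ (here refl) = ⊥-elim (All.lookup x∉ y∈ refl)
  ... | inj₂ (there p) = ∈-++⁺ʳ as p

map-Unique : ∀ {xs : List A} (f : A → B) → Unique xs →
  (∀ {x y} → x ∈ xs → y ∈ xs → f x ≡ f y → x ≡ y) → Unique (map f xs)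
map-Unique {xs = []} f _ _ = []
map-Unique {xs = x ∷ xs} f (x∉ ∷ u) inj =
  All.tabulate (λ m e → let z , z∈ , eq = ∈-map⁻ f m in
    All.lookup x∉ z∈ (inj (here refl) (there z∈) (trans e eq)))
  ∷ map-Unique f u (λ p q → inj (there p) (there q))

module _ {P : A → Set} {Q : B → Set} {xs ys} (ex : Enumerates P xs) (ey : Enumerates Q ys) where

  enum-≤ : (f : A → B) → (∀ {x} → P x → Q (f x)) →
    (∀ {x y} → P x → P y → f x ≡ f y → x ≡ y) → length xs ≤ length ys
  enum-≤ f into inj = ℕ.≤-trans (ℕ.≤-reflexive (sym (length-map f xs)))
    (length-⊆ (map-Unique f (nodup ex) (λ p q → inj (sound ex p) (sound ex q)))
      (λ m → let z , z∈ , eq = ∈-map⁻ f m in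
        subst (_∈ ys) (sym eq) (complete ey (into (sound ex z∈)))))

module _ {P : A → Set} {Q : B → Set} {xs ys} (ex : Enumerates P xs) (ey : Enumerates Q ys) where

  -- Two injections in opposite directions, which spares a check that `f` and `g` are mutually
  -- inverse.
  enum-≡ : (f : A → B) (g : B → A) → (∀ {x} → P x → Q (f x)) → (∀ {y} → Q y → P (g y)) →
    (∀ {x y} → P x → P y → f x ≡ f y → x ≡ y) → (∀ {x y} → Q x → Q y → g x ≡ g y → x ≡ y) →
    length xs ≡ length ys
  enum-≡ f g f-into g-into f-inj g-inj =
    ℕ.≤-antisym (enum-≤ ex ey f f-into f-inj) (enum-≤ ey ex g g-into g-inj)

  enum-× : Enumerates (λ c → P (proj₁ c) × Q (proj₂ c)) (cartesianProduct xs ys)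
  enum-× .nodup = Unique.cartesianProduct⁺ (nodup ex) (nodup ey)
  enum-× .sound m = let p , q = ∈-cartesianProduct⁻ xs ys m in sound ex p , sound ey q
  enum-× .complete (p , q) = ∈-cartesianProduct⁺ (complete ex p) (complete ey q)

enum-image : ∀ {P : A → Set} {Q : B → Set} {xs} (f : A → B) → Enumerates P xs →
  (∀ {x} → P x → Q (f x)) → (∀ {x y} → P x → P y → f x ≡ f y → x ≡ y) →
  (∀ {y} → Q y → Σ A λ x → P x × f x ≡ y) → Enumerates Q (map f xs)
enum-image f ex into inj onto .nodup = map-Unique f (nodup ex) (λ p r → inj (sound ex p) (sound ex r))
enum-image {Q = Q} f ex into inj onto .sound m = let z , z∈ , e = ∈-map⁻ f m in subst Q (sym e) (into (sound ex z∈))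
enum-image {xs = xs} f ex into inj onto .complete Qy =
  let x , Px , e = onto Qy in subst (_∈ map f xs) e (∈-map⁺ f (complete ex Px))

enum-unique : ∀ {P : A → Set} {xs ys} → Enumerates P xs → Enumerates P ys → length xs ≡ length ys
enum-unique ex ey = ℕ.≤-antisym (length-⊆ (nodup ex) (λ m → complete ey (sound ex m)))
                              (length-⊆ (nodup ey) (λ m → complete ex (sound ey m)))

enum-∈ : ∀ {xs : List A} → Unique xs → Enumerates (_∈ xs) xs
enum-∈ u .nodup = u
enum-∈ u .sound m = m
enum-∈ u .complete m = m

enum-cong : ∀ {P Q : A → Set} {xs} → (∀ {x} → P x → Q x) → (∀ {x} → Q x → P x) → Enumerates P xs → Enumerates Q xs
enum-cong to from ex .nodup = nodup ex
enum-cong to from ex .sound m = to (sound ex m)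
enum-cong to from ex .complete q = complete ex (from q)

Unique⇒AllPairs : ∀ {R : A → A → Set} {xs} → Unique xs →
  (∀ {x y} → x ∈ xs → y ∈ xs → x ≢ y → R x y) → AllPairs R xs
Unique⇒AllPairs [] f = []
Unique⇒AllPairs (x∉ ∷ u) f =
  All.tabulate (λ m → f (here refl) (there m) (All.lookup x∉ m)) ∷ Unique⇒AllPairs u (λ p r → f (there p) (there r))

AllPairs-lookup : ∀ {R : A → A → Set} {xs} → AllPairs R xs →
  ∀ {x y} → x ∈ xs → y ∈ xs → x ≡ y ⊎ (R x y ⊎ R y x)
AllPairs-lookup (px ∷ ps) (here refl) (here refl) = inj₁ refl
AllPairs-lookup (px ∷ ps) (here refl) (there m) = inj₂ (inj₁ (All.lookup px m))
AllPairs-lookup (px ∷ ps) (there m) (here refl) = inj₂ (inj₂ (All.lookup px m))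
AllPairs-lookup (px ∷ ps) (there m) (there m′) = AllPairs-lookup ps m m′

length-filter-split : ∀ {P Q : A → Set} (P? : Decidable P) (Q? : Decidable Q) →
  (∀ {x} → P x → ¬ Q x) → (∀ {x} → ¬ P x → Q x) →
  ∀ xs → length xs ≡ length (filter P? xs) ℕ.+ length (filter Q? xs)
length-filter-split P? Q? exclusive exhaustive [] = refl
length-filter-split P? Q? exclusive exhaustive (x ∷ xs) with P? x | Q? x
... | yes p | yes r = ⊥-elim (exclusive p r)
... | yes _ | no _ = cong suc (length-filter-split P? Q? exclusive exhaustive xs)
... | no _ | yes _ = trans (cong suc (length-filter-split P? Q? exclusive exhaustive xs)) (sym (ℕ.+-suc _ _))
... | no np | no nr = ⊥-elim (nr (exhaustive np))

-- Peels off the fibre over one value at a time. Together with root bounds on fibres it bounds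
-- images from below, the source of every lower bound in the counts of subsets of the field.
length-fibres : (_≟_ : DecidableEquality B) (f : A → B) (k : ℕ) →
  (∀ y {zs} → Unique zs → (∀ {z} → z ∈ zs → f z ≡ y) → length zs ≤ k) →
  ∀ ys {xs} → Unique xs → (∀ {x} → x ∈ xs → f x ∈ ys) → length xs ≤ length ys ℕ.* k
length-fibres _≟_ f k bound [] {[]} u into = z≤n
length-fibres _≟_ f k bound [] {x ∷ xs} u into with () ← into (here refl)
length-fibres _≟_ f k bound (y ∷ ys) {xs} u into =
  ℕ.≤-trans (ℕ.≤-reflexive (length-filter-split on-y? (λ x → ¬? (on-y? x)) (λ p np → np p) (λ np → np) xs))
    (ℕ.+-mono-≤ (bound y (Unique.filter⁺ on-y? u) (λ m → proj₂ (∈-filter⁻ on-y? {xs = xs} m)))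
              (length-fibres _≟_ f k bound ys (Unique.filter⁺ (λ x → ¬? (on-y? x)) u) rest))
  where
  on-y? : Decidable (λ x → f x ≡ y)
  on-y? x = f x ≟ y
  rest : ∀ {x} → x ∈ filter (λ x → ¬? (on-y? x)) xs → f x ∈ ys
  rest m with ∈-filter⁻ (λ x → ¬? (on-y? x)) {xs = xs} m
  ... | x∈ , ne with into x∈
  ... | here eq = ⊥-elim (ne eq)
  ... | there p = p

length-cartesianProduct : (xs : List A) (ys : List B) →
  length (cartesianProduct xs ys) ≡ length xs ℕ.* length ys
length-cartesianProduct [] ys = refl
length-cartesianProduct (x ∷ xs) ys = trans (length-++ (map (x ,_) ys))
  (cong₂ ℕ._+_ (length-map (x ,_) ys) (length-cartesianProduct xs ys))

length-filter-map : ∀ {P : B → Set} (P? : Decidable P) (f : A → B) xs →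
  length (filter P? (map f xs)) ≡ length (filter (λ x → P? (f x)) xs)
length-filter-map P? f [] = refl
length-filter-map P? f (x ∷ xs) with does (P? (f x))
... | false = length-filter-map P? f xs
... | true = cong suc (length-filter-map P? f xs)

filter-enumerates : ∀ {P Q : A → Set} {xs} (Q? : Decidable Q) → Enumerates P xs →
  Enumerates (λ x → P x × Q x) (filter Q? xs)
filter-enumerates Q? e .nodup = Unique.filter⁺ Q? (nodup e)
filter-enumerates {xs = xs} Q? e .sound m = let p , q = ∈-filter⁻ Q? {xs = xs} m in sound e p , q
filter-enumerates Q? e .complete (p , q) = ∈-filter⁺ Q? (complete e p) q

-- Decidability over a finite list turns a counting contradiction into a witness; existence is
-- mostly obtained this way.
∃-in : ∀ {P : A → Set} (P? : Decidable P) xs → ¬ (∀ {x} → x ∈ xs → ¬ P x) → Σ A λ x → x ∈ xs × P x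
∃-in P? xs ne with any? P? xs
... | yes a = find a
... | no na = ⊥-elim (ne (λ x∈ px → na (lose x∈ px)))

deduplicate-AllPairs : ∀ {R : A → A → Set} (R? : ∀ x y → Dec (R x y)) xs →
  AllPairs (λ x y → ¬ R x y) (deduplicate R? xs)
deduplicate-AllPairs R? [] = []
deduplicate-AllPairs R? (x ∷ xs) =
  All.all-filter (λ y → ¬? (R? x y)) (deduplicate R? xs) ∷ AllPairs.filter⁺ (λ y → ¬? (R? x y)) (deduplicate-AllPairs R? xs)

module FieldTheory (K : FiniteField) where

  open FiniteField K

  commutativeRing : CommutativeRing _ _
  commutativeRing = record { isCommutativeRing = isCommutativeRing }

  open CommutativeRing commutativeRing public using
    ( ring; semiring; commutativeSemiring; +-assoc; +-comm; *-assoc; *-comm; +-identityˡ; +-identityʳ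
    ; *-identityˡ; *-identityʳ; -‿inverseˡ; -‿inverseʳ; zeroˡ; zeroʳ; distribˡ; +-monoid)
  open RingProperties ring public using (-‿distribˡ-*; -‿distribʳ-*; -0#≈0#; -‿involutive; -‿+-comm)
  open Exp semiring public using (_^_; ^-assocʳ)
  open CommutativeExp commutativeSemiring public using (^-distrib-*)
  open Mult semiring public using (×-homo-+; ×1-homo-*; ×-assoc-*) renaming (_×_ to infixr 8 _×ₙ_)

  -- A ring solver with integer coefficients

  fromℤ : ℤ → Carrier
  fromℤ (ℤ.+ n) = n ×ₙ 1#
  fromℤ -[1+ n ] = - (suc n ×ₙ 1#)

  private
    fromℤ-neg : ∀ i → fromℤ (ℤ.- i) ≡ - fromℤ i
    fromℤ-neg +0 = sym -0#≈0#
    fromℤ-neg +[1+ n ] = refl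
    fromℤ-neg -[1+ n ] = sym (-‿involutive _)

    shift : ∀ x a b → (x + a) + - (x + b) ≡ a + - b
    shift x a b = begin
      (x + a) + - (x + b)     ≡⟨ cong₂ _+_ (+-comm x a) (sym (-‿+-comm x b)) ⟩
      (a + x) + (- x + - b)   ≡⟨ +-assoc a x _ ⟩
      a + (x + (- x + - b))   ≡⟨ cong (a +_) (sym (+-assoc x _ _)) ⟩
      a + ((x + - x) + - b)   ≡⟨ cong (λ z → a + (z + - b)) (-‿inverseʳ x) ⟩
      a + (0# + - b)          ≡⟨ cong (a +_) (+-identityˡ _) ⟩
      a + - b                 ∎

    fromℤ-⊖ : ∀ m n → fromℤ (m ⊖ n) ≡ m ×ₙ 1# + - (n ×ₙ 1#)
    fromℤ-⊖ m zero = sym (trans (cong (m ×ₙ 1# +_) -0#≈0#) (+-identityʳ _))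
    fromℤ-⊖ zero (suc n) = sym (+-identityˡ _)
    fromℤ-⊖ (suc m) (suc n) = begin
      fromℤ (suc m ⊖ suc n)           ≡⟨ cong fromℤ (ℤ.[1+m]⊖[1+n]≡m⊖n m n) ⟩
      fromℤ (m ⊖ n)                   ≡⟨ fromℤ-⊖ m n ⟩
      m ×ₙ 1# + - (n ×ₙ 1#)             ≡⟨ sym (shift 1# _ _) ⟩
      suc m ×ₙ 1# + - (suc n ×ₙ 1#)     ∎

    fromℤ-+ : ∀ i j → fromℤ (i ℤ.+ j) ≡ fromℤ i + fromℤ j
    fromℤ-+ (ℤ.+ m) (ℤ.+ n) = ×-homo-+ 1# m n
    fromℤ-+ (ℤ.+ m) -[1+ n ] = fromℤ-⊖ m (suc n)
    fromℤ-+ -[1+ m ] (ℤ.+ n) = trans (fromℤ-⊖ n (suc m)) (+-comm _ _)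
    fromℤ-+ -[1+ m ] -[1+ n ] = begin
      fromℤ (ℤ.- (ℤ.+ suc m) ℤ.+ ℤ.- (ℤ.+ suc n)) ≡⟨ cong fromℤ (sym (ℤ.neg-distrib-+ (ℤ.+ suc m) (ℤ.+ suc n))) ⟩
      - ((suc m ℕ.+ suc n) ×ₙ 1#)              ≡⟨ cong -_ (×-homo-+ 1# (suc m) (suc n)) ⟩
      - (suc m ×ₙ 1# + suc n ×ₙ 1#)             ≡⟨ sym (-‿+-comm _ _) ⟩
      - (suc m ×ₙ 1#) + - (suc n ×ₙ 1#)         ∎

    fromℤ-*⁺ : ∀ m j → fromℤ (ℤ.+ m ℤ.* j) ≡ fromℤ (ℤ.+ m) * fromℤ j
    fromℤ-*⁺ m (ℤ.+ n) = trans (cong fromℤ (sym (ℤ.pos-* m n))) (×1-homo-* m n)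
    fromℤ-*⁺ m -[1+ n ] = begin
      fromℤ (ℤ.+ m ℤ.* ℤ.- (ℤ.+ suc n))   ≡⟨ cong fromℤ (sym (ℤ.neg-distribʳ-* (ℤ.+ m) (ℤ.+ suc n))) ⟩
      fromℤ (ℤ.- (ℤ.+ m ℤ.* ℤ.+ suc n))   ≡⟨ fromℤ-neg (ℤ.+ m ℤ.* ℤ.+ suc n) ⟩
      - fromℤ (ℤ.+ m ℤ.* ℤ.+ suc n)       ≡⟨ cong -_ (fromℤ-*⁺ m (ℤ.+ suc n)) ⟩
      - (m ×ₙ 1# * (suc n ×ₙ 1#))       ≡⟨ -‿distribʳ-* _ _ ⟩
      m ×ₙ 1# * - (suc n ×ₙ 1#)         ∎

    fromℤ-* : ∀ i j → fromℤ (i ℤ.* j) ≡ fromℤ i * fromℤ j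
    fromℤ-* (ℤ.+ m) j = fromℤ-*⁺ m j
    fromℤ-* -[1+ m ] j = begin
      fromℤ (ℤ.- (ℤ.+ suc m) ℤ.* j)     ≡⟨ cong fromℤ (sym (ℤ.neg-distribˡ-* (ℤ.+ suc m) j)) ⟩
      fromℤ (ℤ.- (ℤ.+ suc m ℤ.* j))     ≡⟨ fromℤ-neg (ℤ.+ suc m ℤ.* j) ⟩
      - fromℤ (ℤ.+ suc m ℤ.* j)         ≡⟨ cong -_ (fromℤ-*⁺ (suc m) j) ⟩
      - (suc m ×ₙ 1# * fromℤ j)        ≡⟨ -‿distribˡ-* _ _ ⟩
      - (suc m ×ₙ 1#) * fromℤ j        ∎

    fromℤ-homomorphism : ℤ.+-*-rawRing -Raw-AlmostCommutative⟶ fromCommutativeRing commutativeRing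
    fromℤ-homomorphism = record
      { ⟦_⟧ = fromℤ ; +-homo = fromℤ-+ ; *-homo = fromℤ-* ; -‿homo = fromℤ-neg
      ; 0-homo = refl ; 1-homo = +-identityʳ 1# }

    coefficient≟ : ∀ i j → Maybe (fromℤ i ≡ fromℤ j)
    coefficient≟ i j with i ℤ.≟ j
    ... | yes eq = just (cong fromℤ eq)
    ... | no _ = nothing

  open Algebra.Solver.Ring ℤ.+-*-rawRing (fromCommutativeRing commutativeRing) fromℤ-homomorphism coefficient≟ public
    using (solve; _:=_; _:+_; _:*_; :-_; _:-_; con)

  infixl 6 _-_
  _-_ : Carrier → Carrier → Carrier
  x - y = x + - y

  pow≡^ : ∀ q x n → Setting.pow q K x n ≡ x ^ n
  pow≡^ q x zero = refl
  pow≡^ q x (suc n) = cong (x *_) (pow≡^ q x n)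

  -- Finite fields

  1≢0 : 1# ≢ 0#
  1≢0 e = 0≢1 (sym e)

  infix 9 _⁻¹
  _⁻¹ : Carrier → Carrier
  x ⁻¹ with x ≟ 0#
  -- The default at zero makes the inverse total; the cancellation laws ask for a nonzero argument.
  ... | yes _ = 0#
  ... | no x≢0 = proj₁ (inverse x x≢0)

  *-inverseʳ : ∀ {x} → x ≢ 0# → x * x ⁻¹ ≡ 1#
  *-inverseʳ {x} x≢0 with x ≟ 0#
  ... | yes x≡0 = ⊥-elim (x≢0 x≡0)
  ... | no x≢0′ = proj₂ (inverse x x≢0′)

  *-inverseˡ : ∀ {x} → x ≢ 0# → x ⁻¹ * x ≡ 1#
  *-inverseˡ x≢0 = trans (*-comm _ _) (*-inverseʳ x≢0)

  ⁻¹-cancelˡ : ∀ {x} y → x ≢ 0# → x ⁻¹ * (x * y) ≡ y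
  ⁻¹-cancelˡ {x} y x≢0 = trans (sym (*-assoc _ _ _)) (trans (cong (_* y) (*-inverseˡ x≢0)) (*-identityˡ y))

  ⁻¹-cancelʳ : ∀ {x} y → x ≢ 0# → x * (x ⁻¹ * y) ≡ y
  ⁻¹-cancelʳ {x} y x≢0 = trans (sym (*-assoc _ _ _)) (trans (cong (_* y) (*-inverseʳ x≢0)) (*-identityˡ y))

  x*y≡0⇒y≡0 : ∀ {x y} → x ≢ 0# → x * y ≡ 0# → y ≡ 0#
  x*y≡0⇒y≡0 {x} {y} x≢0 e = begin
    y               ≡⟨ sym (⁻¹-cancelˡ y x≢0) ⟩
    x ⁻¹ * (x * y)  ≡⟨ cong (x ⁻¹ *_) e ⟩
    x ⁻¹ * 0#       ≡⟨ zeroʳ _ ⟩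
    0#              ∎

  *-≢0 : ∀ {x y} → x ≢ 0# → y ≢ 0# → x * y ≢ 0#
  *-≢0 x≢0 y≢0 e = y≢0 (x*y≡0⇒y≡0 x≢0 e)

  ⁻¹-≢0 : ∀ {x} → x ≢ 0# → x ⁻¹ ≢ 0#
  ⁻¹-≢0 {x} x≢0 e = 1≢0 (trans (sym (*-inverseʳ x≢0)) (trans (cong (x *_) e) (zeroʳ x)))

  ^-≢0 : ∀ {x} n → x ≢ 0# → x ^ n ≢ 0#
  ^-≢0 zero x≢0 = 1≢0
  ^-≢0 (suc n) x≢0 = *-≢0 x≢0 (^-≢0 n x≢0)

  *-cancelˡ : ∀ {x y z} → x ≢ 0# → x * y ≡ x * z → y ≡ z
  *-cancelˡ {x} {y} {z} x≢0 e = trans (sym (⁻¹-cancelˡ y x≢0)) (trans (cong (x ⁻¹ *_) e) (⁻¹-cancelˡ z x≢0))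

  x-y≡0⇒x≡y : ∀ {x y} → x - y ≡ 0# → x ≡ y
  x-y≡0⇒x≡y {x} {y} e = begin
    x             ≡⟨ solve 2 (λ x y → x := (x :- y) :+ y) refl x y ⟩
    (x - y) + y   ≡⟨ cong (_+ y) e ⟩
    0# + y        ≡⟨ +-identityˡ y ⟩
    y             ∎

  x≡y⇒x-y≡0 : ∀ {x y} → x ≡ y → x - y ≡ 0#
  x≡y⇒x-y≡0 {x} refl = -‿inverseʳ x

  +-cancelʳ : ∀ {x y z} → x + z ≡ y + z → x ≡ y
  +-cancelʳ {x} {y} {z} e = x-y≡0⇒x≡y (trans (solve 3 (λ x y z → x :- y := (x :+ z) :- (y :+ z)) refl x y z) (x≡y⇒x-y≡0 e))

  elems-enumerate : Enumerates (λ _ → ⊤) elems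
  elems-enumerate .nodup = unique
  elems-enumerate .sound _ = tt
  elems-enumerate .complete _ = FiniteField.complete K _

  units : List Carrier
  units = filter (λ x → ¬? (x ≟ 0#)) elems

  filter-elems : ∀ {P : Carrier → Set} (P? : Decidable P) → Enumerates P (filter P? elems)
  filter-elems P? .nodup = Unique.filter⁺ P? unique
  filter-elems P? .sound m = proj₂ (∈-filter⁻ P? {xs = elems} m)
  filter-elems P? .complete p = ∈-filter⁺ P? (FiniteField.complete K _) p

  units-enumerate : Enumerates (_≢ 0#) units
  units-enumerate = filter-elems (λ x → ¬? (x ≟ 0#))

  length-nonzero : ∀ {P xs} → Enumerates P xs → P 0# → length xs ≡ suc (length (filter (λ x → ¬? (x ≟ 0#)) xs))
  length-nonzero {P} {xs} ex P0 = enum-unique ex record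
    { nodup = All.tabulate (λ m e → sound nonzero m .proj₂ (sym e)) ∷ nodup nonzero
    ; sound = λ { (here refl) → P0 ; (there m) → sound nonzero m .proj₁ }
    ; complete = λ {x} Px → split Px (x ≟ 0#) }
    where
    nonzero : Enumerates (λ x → P x × x ≢ 0#) (filter (λ x → ¬? (x ≟ 0#)) xs)
    nonzero = filter-enumerates (λ x → ¬? (x ≟ 0#)) ex
    split : ∀ {x} → P x → Dec (x ≡ 0#) → x ∈ 0# ∷ filter (λ x → ¬? (x ≟ 0#)) xs
    split _ (yes e) = here e
    split Px (no ne) = there (Enumerates.complete nonzero (Px , ne))

  card-units : card K ≡ suc (length units)
  card-units = length-nonzero elems-enumerate tt

  -- Duplicate-free lists with the same members are permutations of each other, and a commutative
  -- fold ignores order. Used for translations of the field and scalings of its units.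
  foldr-same : ∀ {_∙_ ε} → IsCommutativeMonoid _≡_ _∙_ ε → ∀ {P xs ys} → Enumerates P xs → Enumerates P ys →
    foldr {A = Carrier} _∙_ ε xs ≡ foldr _∙_ ε ys
  foldr-same M ex ey = Permutation.foldr-commMonoid (setoid Carrier) M
    (↭⇒↭ₛ (∼bag⇒↭ (unique∧set⇒bag (nodup ex) (nodup ey)
      (mk⇔ (λ p → Enumerates.complete ey (sound ex p)) (λ p → Enumerates.complete ex (sound ey p))))))

  open IsCommutativeRing isCommutativeRing using (+-isCommutativeMonoid; *-isCommutativeMonoid)

  sum-shift : ∀ xs → foldr _+_ 0# (map (_+ 1#) xs) ≡ foldr _+_ 0# xs + length xs ×ₙ 1#
  sum-shift [] = sym (+-identityˡ _)
  sum-shift (x ∷ xs) = trans (cong (x + 1# +_) (sum-shift xs))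
    (solve 4 (λ x o s n → (x :+ o) :+ (s :+ n) := (x :+ s) :+ (o :+ n)) refl x 1# _ _)

  -- Translation by 1 permutes the field, so it fixes the sum of all elements, yet it adds 1 once
  -- for every element.
  card×1≡0 : card K ×ₙ 1# ≡ 0#
  card×1≡0 = +-cancelʳ {z = foldr _+_ 0# elems} (begin
    card K ×ₙ 1# + foldr _+_ 0# elems   ≡⟨ +-comm _ _ ⟩
    foldr _+_ 0# elems + card K ×ₙ 1#   ≡⟨ sym (sum-shift elems) ⟩
    foldr _+_ 0# (map (_+ 1#) elems)    ≡⟨ foldr-same +-isCommutativeMonoid
       (enum-image (_+ 1#) elems-enumerate (λ _ → tt) (λ _ _ → +-cancelʳ)
         (λ {x} _ → x - 1# , tt , solve 2 (λ x y → (x :- y) :+ y := x) refl x 1#))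
       elems-enumerate ⟩
    foldr _+_ 0# elems                  ≡⟨ sym (+-identityˡ _) ⟩
    0# + foldr _+_ 0# elems             ∎)

  product-scale : ∀ a xs → foldr _*_ 1# (map (a *_) xs) ≡ a ^ length xs * foldr _*_ 1# xs
  product-scale a [] = sym (*-identityˡ _)
  product-scale a (x ∷ xs) = trans (cong (a * x *_) (product-scale a xs))
    (solve 4 (λ a x s n → (a :* x) :* (n :* s) := (a :* n) :* (x :* s)) refl a x _ _)

  product-≢0 : ∀ {xs} → (∀ {x} → x ∈ xs → x ≢ 0#) → foldr _*_ 1# xs ≢ 0#
  product-≢0 {[]} _ = 1≢0
  product-≢0 {x ∷ xs} ne = *-≢0 (ne (here refl)) (product-≢0 (λ m → ne (there m)))

  -- Multiplication by `x` permutes the units, so their product, which is nonzero, absorbs the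
  -- factor `x ^ length units`.
  x^|units|≡1 : ∀ {x} → x ≢ 0# → x ^ length units ≡ 1#
  x^|units|≡1 {x} x≢0 = *-cancelˡ (product-≢0 (sound units-enumerate)) (begin
    foldr _*_ 1# units * x ^ length units   ≡⟨ *-comm _ _ ⟩
    x ^ length units * foldr _*_ 1# units   ≡⟨ sym (product-scale x units) ⟩
    foldr _*_ 1# (map (x *_) units)         ≡⟨ foldr-same *-isCommutativeMonoid
        (enum-image (x *_) units-enumerate (*-≢0 x≢0) (λ _ _ → *-cancelˡ x≢0)
          (λ {y} y≢0 → x ⁻¹ * y , *-≢0 (⁻¹-≢0 x≢0) y≢0 , ⁻¹-cancelʳ y x≢0))
        units-enumerate ⟩
    foldr _*_ 1# units                      ≡⟨ sym (*-identityʳ _) ⟩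
    foldr _*_ 1# units * 1#                 ∎)

  x^card≡x : ∀ x → x ^ card K ≡ x
  x^card≡x x rewrite card-units with x ≟ 0#
  ... | yes refl = zeroˡ _
  ... | no x≢0 = trans (cong (x *_) (x^|units|≡1 x≢0)) (*-identityʳ x)

  -- Characteristic and additivity of prime-power Frobenius maps

  ×1-homo-^ : ∀ m n → (m ℕ.^ n) ×ₙ 1# ≡ (m ×ₙ 1#) ^ n
  ×1-homo-^ m zero = +-identityʳ 1#
  ×1-homo-^ m (suc n) = trans (×1-homo-* m (m ℕ.^ n)) (cong (m ×ₙ 1# *_) (×1-homo-^ m n))

  module _ {p} (p-prime : Prime p) where

    prime∤! : ∀ n → n < p → p ∤ n !
    prime∤! zero _ p∣1 = ¬prime[1] (subst Prime (∣1⇒≡1 p∣1) p-prime)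
    prime∤! (suc n) n<p p∣ with euclidsLemma (suc n) (n !) p-prime p∣
    ... | inj₁ d = ℕ.<⇒≱ n<p (∣⇒≤ d)
    ... | inj₂ d = prime∤! n (ℕ.<-trans (ℕ.n<1+n n) n<p) d

    -- `p` divides `p !`, the product of `p C k` with the factorials of `k` and `p ∸ k`; both
    -- numbers are below `p`, so `p` divides neither factorial.
    prime∣C : ∀ k → 0 < k → k < p → p ∣ p C k
    prime∣C k 0<k k<p with euclidsLemma (p C k) (k ! ℕ.* (p ∸ k) !) p-prime
      (subst (p ∣_) (sym C*k![p-k]!) (p∣p! p refl 0<k k<p))
      where
      instance _ = (k ℕ.!* (p ∸ k) !≢0)
      C*k![p-k]! : (p C k) ℕ.* (k ! ℕ.* (p ∸ k) !) ≡ p !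
      C*k![p-k]! = trans (cong (ℕ._* (k ! ℕ.* (p ∸ k) !)) (nCk≡n!/k![n-k]! (ℕ.<⇒≤ k<p))) (m/n*n≡m (k![n∸k]!∣n! (ℕ.<⇒≤ k<p)))
      p∣p! : ∀ n → n ≡ p → 0 < k → k < p → p ∣ p !
      p∣p! zero refl _ ()
      p∣p! (suc n) refl _ _ = m∣m*n (n !)
    ... | inj₁ d = d
    ... | inj₂ d with euclidsLemma (k !) ((p ∸ k) !) p-prime d
    ... | inj₁ d′ = ⊥-elim (prime∤! k k<p d′)
    ... | inj₂ d′ = ⊥-elim (prime∤! (p ∸ k) (ℕ.∸-monoʳ-< {o = 0} 0<k (ℕ.<⇒≤ k<p)) d′)

  -- In the binomial expansion only the two extreme terms survive: every interior coefficient is a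
  -- multiple of `p` and hence zero in the field.
  ^-char-+ : ∀ {p} → Prime p → p ×ₙ 1# ≡ 0# → ∀ x y → (x + y) ^ p ≡ x ^ p + y ^ p
  ^-char-+ {zero} p-prime _ x y with () ← p-prime
  ^-char-+ {suc n} p-prime p≡0 x y = begin
    (x + y) ^ suc n                                   ≡⟨ theorem (suc n) x y ⟩
    t Fin.zero + sum (λ i → t (Fin.suc i))            ≡⟨ cong (t Fin.zero +_) (sum-init-last (λ i → t (Fin.suc i))) ⟩
    t Fin.zero + (sum (λ i → t (Fin.suc (inject₁ i))) + t (fromℕ (suc n)))
      ≡⟨ cong (λ z → t Fin.zero + (z + t (fromℕ (suc n)))) (trans (sum-cong-≗ middle) (sum-replicate-zero n)) ⟩
    t Fin.zero + (0# + t (fromℕ (suc n)))             ≡⟨ cong₂ (λ a b → a + (0# + b)) first last ⟩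
    y ^ suc n + (0# + x ^ suc n)                      ≡⟨ solve 2 (λ a b → a :+ (con (ℤ.+ 0) :+ b) := b :+ a) refl _ _ ⟩
    x ^ suc n + y ^ suc n                             ∎
    where
    open Binomial commutativeSemiring using (theorem; binomialTerm; binomial)
    open Sum +-monoid using (sum; sum-init-last; sum-cong-≗; sum-replicate-zero)
    t : Fin (suc (suc n)) → Carrier
    t = binomialTerm x y (suc n)
    p∣⇒×≡0 : ∀ m z → suc n ∣ m → m ×ₙ z ≡ 0#
    p∣⇒×≡0 m z (divides d e) = begin
      m ×ₙ z                       ≡⟨ cong (m ×ₙ_) (sym (*-identityˡ z)) ⟩
      m ×ₙ (1# * z)                ≡⟨ sym (×-assoc-* m 1# z) ⟩
      (m ×ₙ 1#) * z                ≡⟨ cong (λ m → (m ×ₙ 1#) * z) e ⟩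
      ((d ℕ.* suc n) ×ₙ 1#) * z    ≡⟨ cong (_* z) (×1-homo-* d (suc n)) ⟩
      (d ×ₙ 1#) * (suc n ×ₙ 1#) * z ≡⟨ cong (λ w → (d ×ₙ 1#) * w * z) p≡0 ⟩
      (d ×ₙ 1#) * 0# * z           ≡⟨ trans (cong (_* z) (zeroʳ _)) (zeroˡ z) ⟩
      0#                           ∎
    middle : ∀ i → t (Fin.suc (inject₁ i)) ≡ 0#
    middle i = p∣⇒×≡0 _ _ (prime∣C p-prime (suc (toℕ (inject₁ i))) z<s
      (ℕ.s<s (subst (_< n) (sym (Fin.toℕ-inject₁ i)) (Fin.toℕ<n i))))
    first : t Fin.zero ≡ y ^ suc n
    first = trans (+-identityʳ _) (*-identityˡ _)
    last : t (fromℕ (suc n)) ≡ x ^ suc n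
    last = begin
      t (fromℕ (suc n)) ≡⟨ cong (λ k → (suc n C k) ×ₙ (x ^ k * y ^ (suc n ∸ k))) (Fin.toℕ-fromℕ (suc n)) ⟩
      (suc n C suc n) ×ₙ (x ^ suc n * y ^ (n ∸ n)) ≡⟨ cong₂ (λ a b → a ×ₙ (x ^ suc n * y ^ b)) (nCn≡1 (suc n)) (ℕ.n∸n≡0 n) ⟩
      x ^ suc n * 1# + 0# ≡⟨ trans (+-identityʳ _) (*-identityʳ _) ⟩
      x ^ suc n ∎

  module _ {p m} (p-prime : Prime p) (card≡ : card K ≡ p ℕ.^ m) where

    -- Otherwise `(p ×ₙ 1#) ^ m` would be nonzero, although it equals `card K ×ₙ 1#`.
    characteristic : p ×ₙ 1# ≡ 0#
    characteristic with (p ×ₙ 1#) ≟ 0#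
    ... | yes e = e
    ... | no ne = ⊥-elim (^-≢0 m ne (trans (sym (×1-homo-^ p m)) (trans (cong (_×ₙ 1#) (sym card≡)) card×1≡0)))

    ^-primePower-+ : ∀ k x y → (x + y) ^ (p ℕ.^ k) ≡ x ^ (p ℕ.^ k) + y ^ (p ℕ.^ k)
    ^-primePower-+ zero x y = trans (*-identityʳ _) (sym (cong₂ _+_ (*-identityʳ x) (*-identityʳ y)))
    ^-primePower-+ (suc k) x y = begin
      (x + y) ^ (p ℕ.* p ℕ.^ k)                       ≡⟨ sym (^-assocʳ (x + y) p (p ℕ.^ k)) ⟩
      ((x + y) ^ p) ^ (p ℕ.^ k)                       ≡⟨ cong (_^ (p ℕ.^ k)) (^-char-+ p-prime characteristic x y) ⟩
      (x ^ p + y ^ p) ^ (p ℕ.^ k)                     ≡⟨ ^-primePower-+ k (x ^ p) (y ^ p) ⟩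
      (x ^ p) ^ (p ℕ.^ k) + (y ^ p) ^ (p ℕ.^ k)       ≡⟨ cong₂ _+_ (^-assocʳ x p _) (^-assocʳ y p _) ⟩
      x ^ (p ℕ.* p ℕ.^ k) + y ^ (p ℕ.* p ℕ.^ k)       ∎

  -- Monic polynomials and the bound on their number of roots

  -- The coefficients below the leading term 1, from the constant term upwards.
  evalMonic : ∀ {n} → Vec Carrier n → Carrier → Carrier
  evalMonic [] x = 1#
  evalMonic (c ∷ cs) x = c + x * evalMonic cs x

  IsMonic : ℕ → (Carrier → Carrier) → Set
  IsMonic n f = Σ (Vec Carrier n) λ cs → ∀ x → f x ≡ evalMonic cs x

  private
    addScaled : ∀ {n} → Carrier → Vec Carrier (suc n) → Vec Carrier n → Vec Carrier (suc n)
    addScaled a (c ∷ []) [] = (c + a) ∷ []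
    addScaled a (c ∷ cs@(_ ∷ _)) (d ∷ ds) = (c + a * d) ∷ addScaled a cs ds

    evalMonic-addScaled : ∀ {n} a (cs : Vec Carrier (suc n)) ds x →
      evalMonic (addScaled a cs ds) x ≡ evalMonic cs x + a * evalMonic ds x
    evalMonic-addScaled a (c ∷ []) [] x = trans
      (solve 4 (λ c a x o → (c :+ a) :+ x :* o := (c :+ x :* o) :+ a) refl c a x 1#)
      (cong (c + x * 1# +_) (sym (*-identityʳ a)))
    evalMonic-addScaled a (c ∷ cs@(_ ∷ _)) (d ∷ ds) x = begin
      (c + a * d) + x * evalMonic (addScaled a cs ds) x
        ≡⟨ cong (λ z → (c + a * d) + x * z) (evalMonic-addScaled a cs ds x) ⟩
      (c + a * d) + x * (evalMonic cs x + a * evalMonic ds x)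
        ≡⟨ solve 6 (λ c a d x u v → (c :+ a :* d) :+ x :* (u :+ a :* v) := (c :+ x :* u) :+ a :* (d :+ x :* v)) refl c a d x _ _ ⟩
      (c + x * evalMonic cs x) + a * (d + x * evalMonic ds x) ∎

  -- For `f(x) = c + x g(x)` one has `f(x) - f(a) = (x - a) g(x) + a (g(x) -
  -- g(a))`. By induction the last difference is `x - a` times a polynomial of degree below that of
  -- `g`, so the quotient stays monic.
  difference-quotient : ∀ {n} (cs : Vec Carrier (suc n)) a → Σ (Vec Carrier n) λ ds →
    ∀ x → evalMonic cs x - evalMonic cs a ≡ (x - a) * evalMonic ds x
  difference-quotient (c ∷ []) a = [] , λ x →
    solve 4 (λ c a x o → (c :+ x :* o) :- (c :+ a :* o) := (x :- a) :* o) refl c a x 1#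
  difference-quotient (c ∷ cs@(_ ∷ _)) a = let ds , eq = difference-quotient cs a in addScaled a cs ds , λ x → begin
    (c + x * evalMonic cs x) - (c + a * evalMonic cs a)
      ≡⟨ solve 5 (λ c x a u v → (c :+ x :* u) :- (c :+ a :* v) := (x :- a) :* u :+ a :* (u :- v)) refl c x a _ _ ⟩
    (x - a) * evalMonic cs x + a * (evalMonic cs x - evalMonic cs a)
      ≡⟨ cong (λ z → (x - a) * evalMonic cs x + a * z) (eq x) ⟩
    (x - a) * evalMonic cs x + a * ((x - a) * evalMonic ds x)
      ≡⟨ solve 4 (λ d u a v → d :* u :+ a :* (d :* v) := d :* (u :+ a :* v)) refl (x - a) _ a _ ⟩
    (x - a) * (evalMonic cs x + a * evalMonic ds x)
      ≡⟨ cong ((x - a) *_) (sym (evalMonic-addScaled a cs ds x)) ⟩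
    (x - a) * evalMonic (addScaled a cs ds) x ∎

  roots-evalMonic : ∀ {n} (cs : Vec Carrier n) {xs} → Unique xs → (∀ {x} → x ∈ xs → evalMonic cs x ≡ 0#) → length xs ≤ n
  roots-evalMonic cs {[]} _ _ = z≤n
  roots-evalMonic [] {x ∷ xs} _ root = ⊥-elim (1≢0 (root (here refl)))
  roots-evalMonic cs@(_ ∷ _) {a ∷ xs} (a∉ ∷ u) root = let ds , eq = difference-quotient cs a in
    s≤s (roots-evalMonic ds u λ {x} x∈ → x*y≡0⇒y≡0
      (λ e → All.lookup a∉ x∈ (sym (x-y≡0⇒x≡y e)))
      (trans (sym (eq x)) (x≡y⇒x-y≡0 (trans (root (there x∈)) (sym (root (here refl)))))))

  roots-monic : ∀ {n f} → IsMonic n f → ∀ {xs} → Unique xs → (∀ {x} → x ∈ xs → f x ≡ 0#) → length xs ≤ n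
  roots-monic (cs , eq) u root = roots-evalMonic cs u (λ {x} m → trans (sym (eq x)) (root m))

  monic-^ : ∀ n → IsMonic n (_^ n)
  monic-^ n = replicate n 0# , lemma n
    where
    lemma : ∀ n x → x ^ n ≡ evalMonic (replicate n 0#) x
    lemma zero x = refl
    lemma (suc n) x = trans (cong (x *_) (lemma n x)) (sym (+-identityˡ _))

  private
    addAt : ∀ {m n} → m < n → Carrier → Vec Carrier n → Vec Carrier n
    addAt {zero} (s≤s _) a (c ∷ cs) = (c + a) ∷ cs
    addAt {suc m} (s≤s m<n) a (c ∷ cs) = c ∷ addAt m<n a cs

    evalMonic-addAt : ∀ {m n} (m<n : m < n) a cs x → evalMonic (addAt m<n a cs) x ≡ evalMonic cs x + a * x ^ m
    evalMonic-addAt {zero} (s≤s _) a (c ∷ cs) x = trans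
      (solve 3 (λ c a u → (c :+ a) :+ u := (c :+ u) :+ a) refl c a _)
      (cong (c + x * evalMonic cs x +_) (sym (*-identityʳ a)))
    evalMonic-addAt {suc m} (s≤s m<n) a (c ∷ cs) x = trans
      (cong (λ z → c + x * z) (evalMonic-addAt m<n a cs x))
      (solve 5 (λ c x u a v → c :+ x :* (u :+ a :* v) := (c :+ x :* u) :+ a :* (x :* v)) refl c x _ a _)

  -- The bound `m < n` protects the leading coefficient; sparse q-polynomials are assembled by
  -- repeated use.
  monic-+ : ∀ {m n f} a → m < n → IsMonic n f → IsMonic n (λ x → f x + a * x ^ m)
  monic-+ {m} a m<n (cs , eq) = addAt m<n a cs , λ x → trans (cong (_+ a * x ^ m) (eq x)) (sym (evalMonic-addAt m<n a cs x))

-- Additivity of `x ↦ x^q` is a parameter, so that the geometry speaks of `q` alone; the prime below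
-- `q` is only involved when the parameter is supplied.
module Construction (q : ℕ) (2≤q : 2 ≤ q) (K : FiniteField) (card≡ : card K ≡ q ℕ.^ 4)
  (pow-+ : ∀ x y → Setting.pow q K (FiniteField._+_ K x y) q ≡ FiniteField._+_ K (Setting.pow q K x q) (Setting.pow q K y q)) where

  open Setting q K
  open FieldTheory K

  -- The Frobenius map x ↦ x^q and the trace

  F : Carrier → Carrier
  F x = pow x q

  F-+ : ∀ x y → F (x + y) ≡ F x + F y
  F-+ = pow-+

  F-* : ∀ x y → F (x * y) ≡ F x * F y
  F-* x y = trans (pow≡^ q _ q) (trans (^-distrib-* x y q) (sym (cong₂ _*_ (pow≡^ q x q) (pow≡^ q y q))))

  F-0 : F 0# ≡ 0#
  F-0 = +-cancelʳ (trans (sym (F-+ 0# 0#)) (trans (cong F (+-identityˡ 0#)) (sym (+-identityˡ _))))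

  F-1 : F 1# ≡ 1#
  F-1 = trans (pow≡^ q 1# q) (1^ q)
    where
    1^ : ∀ n → 1# ^ n ≡ 1#
    1^ ℕ.zero = refl
    1^ (suc n) = trans (*-identityˡ _) (1^ n)

  F-neg : ∀ x → F (- x) ≡ - F x
  F-neg x = +-cancelʳ (trans (sym (F-+ (- x) x)) (trans (cong F (-‿inverseˡ x)) (trans F-0 (sym (-‿inverseˡ (F x))))))

  F-minus : ∀ x y → F (x - y) ≡ F x - F y
  F-minus x y = trans (F-+ x (- y)) (cong (F x +_) (F-neg y))

  F-≢0 : ∀ {x} → x ≢ 0# → F x ≢ 0#
  F-≢0 {x} x≢0 e = ^-≢0 q x≢0 (trans (sym (pow≡^ q x q)) e)

  F-injective : ∀ {x y} → F x ≡ F y → x ≡ y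
  F-injective {x} {y} e with (x - y) ≟ 0#
  ... | yes p = x-y≡0⇒x≡y p
  ... | no ne = ⊥-elim (F-≢0 ne (trans (F-minus x y) (x≡y⇒x-y≡0 e)))

  F-⁻¹ : ∀ {x} → x ≢ 0# → F (x ⁻¹) ≡ (F x) ⁻¹
  F-⁻¹ {x} x≢0 = *-cancelˡ (F-≢0 x≢0) (trans (sym (F-* x (x ⁻¹)))
    (trans (cong F (*-inverseʳ x≢0)) (trans F-1 (sym (*-inverseʳ (F-≢0 x≢0))))))

  F^2 : ∀ x → x ^ (q ℕ.^ 2) ≡ F (F x)
  F^2 x = sym (begin
    F (F x)           ≡⟨ trans (pow≡^ q (F x) q) (cong (_^ q) (pow≡^ q x q)) ⟩
    (x ^ q) ^ q       ≡⟨ ^-assocʳ x q q ⟩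
    x ^ (q ℕ.* q)     ≡⟨ cong (λ n → x ^ (q ℕ.* n)) (sym (ℕ.*-identityʳ q)) ⟩
    x ^ (q ℕ.^ 2)     ∎)

  F^3 : ∀ x → x ^ (q ℕ.^ 3) ≡ F (F (F x))
  F^3 x = sym (begin
    F (F (F x))             ≡⟨ sym (F^2 (F x)) ⟩
    F x ^ (q ℕ.^ 2)         ≡⟨ cong (_^ (q ℕ.^ 2)) (pow≡^ q x q) ⟩
    (x ^ q) ^ (q ℕ.^ 2)     ≡⟨ ^-assocʳ x q (q ℕ.^ 2) ⟩
    x ^ (q ℕ.^ 3)           ∎)

  F^4 : ∀ x → F (F (F (F x))) ≡ x
  F^4 x = begin
    F (F (F (F x)))           ≡⟨ sym (F^3 (F x)) ⟩
    F x ^ (q ℕ.^ 3)           ≡⟨ cong (_^ (q ℕ.^ 3)) (pow≡^ q x q) ⟩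
    (x ^ q) ^ (q ℕ.^ 3)       ≡⟨ ^-assocʳ x q (q ℕ.^ 3) ⟩
    x ^ (q ℕ.^ 4)             ≡⟨ cong (x ^_) (sym card≡) ⟩
    x ^ card K                ≡⟨ x^card≡x x ⟩
    x                         ∎

  Tr≡ : ∀ x → Tr x ≡ x + F x + F (F x) + F (F (F x))
  Tr≡ x = cong₂ (λ a b → x + F x + a + b) (trans (pow≡^ q x (q ℕ.^ 2)) (F^2 x)) (trans (pow≡^ q x (q ℕ.^ 3)) (F^3 x))

  IsFq? : Decidable IsFq
  IsFq? a = F a ≟ a

  Fq-0 : IsFq 0#
  Fq-0 = F-0

  Fq-1 : IsFq 1#
  Fq-1 = F-1

  Fq-+ : ∀ {a b} → IsFq a → IsFq b → IsFq (a + b)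
  Fq-+ a∈ b∈ = trans (F-+ _ _) (cong₂ _+_ a∈ b∈)

  Fq-* : ∀ {a b} → IsFq a → IsFq b → IsFq (a * b)
  Fq-* a∈ b∈ = trans (F-* _ _) (cong₂ _*_ a∈ b∈)

  Fq-neg : ∀ {a} → IsFq a → IsFq (- a)
  Fq-neg a∈ = trans (F-neg _) (cong -_ a∈)

  Fq-minus : ∀ {a b} → IsFq a → IsFq b → IsFq (a - b)
  Fq-minus a∈ b∈ = Fq-+ a∈ (Fq-neg b∈)

  Fq-⁻¹ : ∀ {a} → a ≢ 0# → IsFq a → IsFq (a ⁻¹)
  Fq-⁻¹ a≢0 a∈ = trans (F-⁻¹ a≢0) (cong _⁻¹ a∈)

  Tr-+ : ∀ x y → Tr (x + y) ≡ Tr x + Tr y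
  Tr-+ x y = begin
    Tr (x + y)  ≡⟨ Tr≡ (x + y) ⟩
    (x + y) + F (x + y) + F (F (x + y)) + F (F (F (x + y)))
      ≡⟨ cong₂ (λ a b → (x + y) + F (x + y) + a + F b) FF FF ⟩
    (x + y) + F (x + y) + (F (F x) + F (F y)) + F (F (F x) + F (F y))
      ≡⟨ cong₂ (λ a b → (x + y) + a + (F (F x) + F (F y)) + b) (F-+ x y) (F-+ _ _) ⟩
    (x + y) + (F x + F y) + (F (F x) + F (F y)) + (F (F (F x)) + F (F (F y)))
      ≡⟨ solve 8 (λ x y a b c d e f → (x :+ y) :+ (a :+ b) :+ (c :+ d) :+ (e :+ f) := (x :+ a :+ c :+ e) :+ (y :+ b :+ d :+ f)) refl x y _ _ _ _ _ _ ⟩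
    (x + F x + F (F x) + F (F (F x))) + (y + F y + F (F y) + F (F (F y)))
      ≡⟨ sym (cong₂ _+_ (Tr≡ x) (Tr≡ y)) ⟩
    Tr x + Tr y ∎
    where
    FF : F (F (x + y)) ≡ F (F x) + F (F y)
    FF = trans (cong F (F-+ x y)) (F-+ _ _)

  Tr-* : ∀ {c} → IsFq c → ∀ x → Tr (c * x) ≡ c * Tr x
  Tr-* {c} c∈ x = begin
    Tr (c * x)  ≡⟨ Tr≡ (c * x) ⟩
    c * x + F (c * x) + F (F (c * x)) + F (F (F (c * x)))
      ≡⟨ cong₂ (λ a b → c * x + a + b + F b) (lin x) (trans (cong F (lin x)) (lin (F x))) ⟩
    c * x + c * F x + c * F (F x) + F (c * F (F x))
      ≡⟨ cong (c * x + c * F x + c * F (F x) +_) (lin _) ⟩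
    c * x + c * F x + c * F (F x) + c * F (F (F x))
      ≡⟨ solve 5 (λ c x a b d → c :* x :+ c :* a :+ c :* b :+ c :* d := c :* (x :+ a :+ b :+ d)) refl c x _ _ _ ⟩
    c * (x + F x + F (F x) + F (F (F x)))  ≡⟨ cong (c *_) (sym (Tr≡ x)) ⟩
    c * Tr x  ∎
    where
    lin : ∀ z → F (c * z) ≡ c * F z
    lin z = trans (F-* c z) (cong (_* F z) c∈)

  Tr-F : ∀ x → Tr (F x) ≡ Tr x
  Tr-F x = begin
    Tr (F x)                                    ≡⟨ Tr≡ (F x) ⟩
    F x + F (F x) + F (F (F x)) + F (F (F (F x)))   ≡⟨ cong (F x + F (F x) + F (F (F x)) +_) (F^4 x) ⟩
    F x + F (F x) + F (F (F x)) + x             ≡⟨ solve 4 (λ x a b c → a :+ b :+ c :+ x := x :+ a :+ b :+ c) refl x _ _ _ ⟩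
    x + F x + F (F x) + F (F (F x))             ≡⟨ sym (Tr≡ x) ⟩
    Tr x                                        ∎

  Tr-0 : Tr 0# ≡ 0#
  Tr-0 = trans (cong Tr (sym (zeroˡ 0#))) (trans (Tr-* F-0 0#) (zeroˡ _))

  Tr-neg : ∀ x → Tr (- x) ≡ - Tr x
  Tr-neg x = +-cancelʳ (trans (sym (Tr-+ (- x) x)) (trans (cong Tr (-‿inverseˡ x)) (trans Tr-0 (sym (-‿inverseˡ (Tr x))))))

  Tr-minus : ∀ x y → Tr (x - y) ≡ Tr x - Tr y
  Tr-minus x y = trans (Tr-+ x (- y)) (cong (Tr x +_) (Tr-neg y))

  Tr-Fq : ∀ x → IsFq (Tr x)
  Tr-Fq x = begin
    F (Tr x)                                        ≡⟨ cong F (Tr≡ x) ⟩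
    F (x + F x + F (F x) + F (F (F x)))             ≡⟨ F-+ _ _ ⟩
    F (x + F x + F (F x)) + F (F (F (F x)))         ≡⟨ cong (_+ F (F (F (F x)))) (trans (F-+ _ _) (cong (_+ F (F (F x))) (F-+ _ _))) ⟩
    F x + F (F x) + F (F (F x)) + F (F (F (F x)))   ≡⟨ sym (Tr≡ (F x)) ⟩
    Tr (F x)                                        ≡⟨ Tr-F x ⟩
    Tr x                                            ∎

  -- As `F` iterated four times is the identity, its third iterate is the inverse of `F`.
  F³-fixed : ∀ {x} → F (F (F x)) ≡ x → IsFq x
  F³-fixed {x} e = trans (cong F (sym e)) (F^4 x)

  -- Sizes of F_q and W, additive Hilbert 90, surjectivity of the trace

  instance
    q≢0 : ℕ.NonZero q
    q≢0 = ℕ.>-nonZero (ℕ.<-trans (ℕ.s≤s ℕ.z≤n) 2≤q)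

  q^-mono-< : ∀ {m n} → m < n → q ℕ.^ m < q ℕ.^ n
  q^-mono-< = ℕ.^-monoʳ-< q 2≤q

  1<q^ : ∀ n → 1 < q ℕ.^ suc n
  1<q^ n = q^-mono-< {0} {suc n} (ℕ.s≤s ℕ.z≤n)

  private
    lin : ∀ x → 1# * x ^ 1 ≡ x
    lin x = trans (*-identityˡ _) (*-identityʳ x)

  Fq-roots : ∀ {xs} → Unique xs → (∀ {x} → x ∈ xs → IsFq x) → length xs ≤ q
  Fq-roots u fq = roots-monic (monic-+ {1} (- 1#) 2≤q (monic-^ q)) u λ {x} m → begin
    x ^ q + - 1# * x ^ 1    ≡⟨ cong₂ _+_ (sym (pow≡^ q x q)) (trans (sym (-‿distribˡ-* _ _)) (cong -_ (lin x))) ⟩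
    F x - x                 ≡⟨ x≡y⇒x-y≡0 (fq m) ⟩
    0#                      ∎

  Tr-roots : ∀ {xs} → Unique xs → (∀ {x} → x ∈ xs → Tr x ≡ 0#) → length xs ≤ q ℕ.^ 3
  Tr-roots u tr = roots-monic
    (monic-+ 1# (1<q^ 2) (monic-+ 1# (subst (_< q ℕ.^ 3) (ℕ.*-identityʳ q) (q^-mono-< {1} {3} (ℕ.s≤s (ℕ.s≤s ℕ.z≤n))))
      (monic-+ 1# (q^-mono-< {2} {3} ℕ.≤-refl) (monic-^ (q ℕ.^ 3))))) u λ {x} m → begin
    x ^ (q ℕ.^ 3) + 1# * x ^ (q ℕ.^ 2) + 1# * x ^ q + 1# * x ^ 1
      ≡⟨ cong₂ _+_ (cong₂ _+_ (cong₂ _+_ (F^3 x) (trans (*-identityˡ _) (F^2 x))) (trans (*-identityˡ _) (sym (pow≡^ q x q)))) (lin x) ⟩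
    F (F (F x)) + F (F x) + F x + x   ≡⟨ solve 4 (λ x a b c → c :+ b :+ a :+ x := x :+ a :+ b :+ c) refl x _ _ _ ⟩
    x + F x + F (F x) + F (F (F x))   ≡⟨ sym (Tr≡ x) ⟩
    Tr x                              ≡⟨ tr m ⟩
    0#                                ∎

  F²-roots : ∀ {xs} → Unique xs → (∀ {x} → x ∈ xs → F (F x) ≡ x) → length xs ≤ q ℕ.^ 2
  F²-roots u fix = roots-monic (monic-+ {1} (- 1#) (1<q^ 1) (monic-^ (q ℕ.^ 2))) u λ {x} m → begin
    x ^ (q ℕ.^ 2) + - 1# * x ^ 1    ≡⟨ cong₂ _+_ (F^2 x) (trans (sym (-‿distribˡ-* _ _)) (cong -_ (lin x))) ⟩
    F (F x) - x                     ≡⟨ x≡y⇒x-y≡0 (fix m) ⟩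
    0#                              ∎

  F²-neg-roots : ∀ {xs} → Unique xs → (∀ {x} → x ∈ xs → x + F (F x) ≡ 0#) → length xs ≤ q ℕ.^ 2
  F²-neg-roots u fix = roots-monic (monic-+ {1} 1# (1<q^ 1) (monic-^ (q ℕ.^ 2))) u λ {x} m → begin
    x ^ (q ℕ.^ 2) + 1# * x ^ 1      ≡⟨ cong₂ _+_ (F^2 x) (lin x) ⟩
    F (F x) + x                     ≡⟨ trans (+-comm _ _) (fix m) ⟩
    0#                              ∎

  -- A missed value `y` would leave at most `length ys - 1` fibres of at most `k` elements each, too
  -- few to exhaust `xs`.
  onto : ∀ {P Q : Carrier → Set} {xs ys} (f : Carrier → Carrier) k → Enumerates P xs → Enumerates Q ys →
    (∀ {x} → P x → Q (f x)) → (∀ y {zs} → Unique zs → (∀ {z} → z ∈ zs → f z ≡ y) → length zs ≤ k) →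
    length ys ℕ.* k ≤ length xs → 0 < k → ∀ {y} → Q y → Σ Carrier λ x → P x × f x ≡ y
  onto {xs = xs} {ys} f k ex ey into fibre size 0<k {y} Qy with any? (λ x → f x ≟ y) xs
  ... | yes a = let x , x∈ , e = find a in x , sound ex x∈ , e
  ... | no none = ⊥-elim (ℕ.<⇒≱ too-small size)
    where
    others : List Carrier
    others = filter (λ z → ¬? (z ≟ y)) ys
    y∷others : length others < length ys
    y∷others = filter-notAll (λ z → ¬? (z ≟ y)) ys (lose (Enumerates.complete ey Qy) (λ ne → ne refl))
    into-others : ∀ {x} → x ∈ xs → f x ∈ others
    into-others x∈ = ∈-filter⁺ (λ z → ¬? (z ≟ y)) (Enumerates.complete ey (into (sound ex x∈))) (λ e → none (lose x∈ e))
    too-small : length xs < length ys ℕ.* k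
    too-small = ℕ.≤-<-trans (length-fibres _≟_ f k fibre others (nodup ex) into-others)
      (ℕ.*-monoˡ-< k {{ℕ.>-nonZero 0<k}} y∷others)

  Fqs trace-zeros : List Carrier
  Fqs = filter IsFq? elems
  trace-zeros = filter (λ x → Tr x ≟ 0#) elems

  Fqs-enumerate : Enumerates IsFq Fqs
  Fqs-enumerate = filter-elems IsFq?

  trace-zeros-enumerate : Enumerates (λ x → Tr x ≡ 0#) trace-zeros
  trace-zeros-enumerate = filter-elems (λ x → Tr x ≟ 0#)

  -- The map of additive Hilbert 90, with kernel F_q and image the trace-zero subspace; thus
  -- `φ (s * y)` determines `y` up to `s⁻¹ F_q`.
  φ : Carrier → Carrier
  φ y = y - F y

  Tr-φ : ∀ y → Tr (φ y) ≡ 0#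
  Tr-φ y = trans (Tr-minus y (F y)) (x≡y⇒x-y≡0 (sym (Tr-F y)))

  private
    -- Subtracting one fixed element of a fibre moves the fibre injectively into the kernel.
    fibre-bound : ∀ {P : Carrier → Set} {n} (f : Carrier → Carrier) → (∀ x y → f (x - y) ≡ f x - f y) →
      (∀ {zs} → Unique zs → (∀ {z} → z ∈ zs → f z ≡ 0#) → length zs ≤ n) →
      ∀ y {zs} → Unique zs → (∀ {z} → z ∈ zs → f z ≡ y) → length zs ≤ n
    fibre-bound f f-minus kernel y {[]} u fib = ℕ.z≤n
    fibre-bound f f-minus kernel y {z₀ ∷ zs} u fib =
      ℕ.≤-trans (ℕ.≤-reflexive (sym (length-map (_- z₀) (z₀ ∷ zs)))) (kernel
        (map-Unique (_- z₀) u (λ _ _ → +-cancelʳ))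
        (λ m → let z , z∈ , e = ∈-map⁻ (_- z₀) m in
          trans (cong f e) (trans (f-minus z z₀) (x≡y⇒x-y≡0 (trans (fib z∈) (sym (fib (here refl))))))))

    φ-minus : ∀ x y → φ (x - y) ≡ φ x - φ y
    φ-minus x y = trans (cong (λ z → (x - y) - z) (F-minus x y))
      (solve 4 (λ x y a b → (x :- y) :- (a :- b) := (x :- a) :- (y :- b)) refl x y _ _)

  φ-fibres : ∀ y {zs} → Unique zs → (∀ {z} → z ∈ zs → φ z ≡ y) → length zs ≤ q
  φ-fibres = fibre-bound {λ _ → Carrier} φ φ-minus (λ u k → Fq-roots u (λ m → sym (x-y≡0⇒x≡y (k m))))

  Tr-fibres : ∀ y {zs} → Unique zs → (∀ {z} → z ∈ zs → Tr z ≡ y) → length zs ≤ q ℕ.^ 3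
  Tr-fibres = fibre-bound {λ _ → Carrier} Tr Tr-minus Tr-roots

  private
    q⁴≤|W|q : q ℕ.^ 4 ≤ length trace-zeros ℕ.* q
    q⁴≤|W|q = ℕ.≤-trans (ℕ.≤-reflexive (sym card≡)) (length-fibres _≟_ φ q φ-fibres trace-zeros unique
      (λ {y} _ → Enumerates.complete trace-zeros-enumerate (Tr-φ y)))

  -- The degree of the trace polynomial bounds from above; from below, `φ` maps all `q⁴` elements
  -- into the trace zeros with fibres of at most `q` elements. The same squeeze, with `Tr` in place
  -- of `φ`, gives `|Fqs|`.
  |trace-zeros| : length trace-zeros ≡ q ℕ.^ 3
  |trace-zeros| = ℕ.≤-antisym (Tr-roots (nodup trace-zeros-enumerate) (sound trace-zeros-enumerate))
    (ℕ.*-cancelʳ-≤ _ _ q (ℕ.≤-trans (ℕ.≤-reflexive (ℕ.*-comm (q ℕ.^ 3) q)) q⁴≤|W|q))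

  |Fqs| : length Fqs ≡ q
  |Fqs| = ℕ.≤-antisym (Fq-roots (nodup Fqs-enumerate) (sound Fqs-enumerate))
    (ℕ.*-cancelʳ-≤ q _ (q ℕ.^ 3) {{ℕ.m^n≢0 q 3}} (ℕ.≤-trans (ℕ.≤-reflexive (sym card≡))
      (length-fibres _≟_ Tr (q ℕ.^ 3) Tr-fibres Fqs unique (λ {y} _ → Enumerates.complete Fqs-enumerate (Tr-Fq y)))))

  hilbert90 : ∀ {x} → Tr x ≡ 0# → Σ Carrier λ y → φ y ≡ x
  hilbert90 tr = let y , _ , e = onto φ q elems-enumerate trace-zeros-enumerate (λ {y} _ → Tr-φ y) φ-fibres
                        (ℕ.≤-reflexive (trans (cong (ℕ._* q) |trace-zeros|) (trans (ℕ.*-comm _ q) (sym card≡))))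
                        (ℕ.<-trans (ℕ.s≤s ℕ.z≤n) 2≤q) tr
                 in y , e

  Tr-onto-Fq : ∀ {c} → IsFq c → Σ Carrier λ x → Tr x ≡ c
  Tr-onto-Fq c∈ = let x , _ , e = onto Tr (q ℕ.^ 3) elems-enumerate Fqs-enumerate (λ {y} _ → Tr-Fq y) Tr-fibres
                         (ℕ.≤-reflexive (trans (cong (ℕ._* q ℕ.^ 3) |Fqs|) (sym card≡)))
                         (ℕ.m^n>0 q 3) c∈
                  in x , e

  -- Nondegeneracy of the trace form, normalised to the value 1 so that it splits off the line
  -- through `a` as a direct summand.
  dual : ∀ {a} → a ≢ 0# → Σ Carrier λ c → Tr (c * a) ≡ 1#
  dual {a} a≢0 = let x , e = Tr-onto-Fq Fq-1 in
    x * a ⁻¹ , trans (cong Tr (trans (*-assoc _ _ _) (trans (cong (x *_) (*-inverseˡ a≢0)) (*-identityʳ x)))) e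

  -- F_q-subspaces of the field and kernels of trace functionals

  record IsFqSubspace (A : Carrier → Set) : Set where
    field
      has-0 : A 0#
      has-+ : ∀ {x y} → A x → A y → A (x + y)
      has-* : ∀ {c x} → IsFq c → A x → A (c * x)

    has-minus : ∀ {x y} → A x → A y → A (x - y)
    has-minus {x} {y} x∈ y∈ = has-+ x∈ (subst A (trans (sym (-‿distribˡ-* 1# y)) (cong -_ (*-identityˡ y))) (has-* (Fq-neg Fq-1) y∈))

  open IsFqSubspace public

  Kernel : (Carrier → Set) → Carrier → Carrier → Set
  Kernel A c x = A x × Tr (c * x) ≡ 0#

  Tr-*ʳ : ∀ {t} c x → IsFq t → Tr (c * (t * x)) ≡ t * Tr (c * x)
  Tr-*ʳ {t} c x t∈ = trans (cong Tr (solve 3 (λ c t x → c :* (t :* x) := t :* (c :* x)) refl c t x)) (Tr-* t∈ _)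

  Kernel-subspace : ∀ {A} c → IsFqSubspace A → IsFqSubspace (Kernel A c)
  Kernel-subspace c A .has-0 = has-0 A , trans (cong Tr (zeroʳ c)) Tr-0
  Kernel-subspace c A .has-+ (p , e) (p′ , e′) = has-+ A p p′ ,
    trans (cong Tr (distribˡ c _ _)) (trans (Tr-+ _ _) (trans (cong₂ _+_ e e′) (+-identityˡ 0#)))
  Kernel-subspace c A .has-* t∈ (p , e) = has-* A t∈ p , trans (Tr-*ʳ c _ t∈) (trans (cong (_ *_) e) (zeroʳ _))

  Kernel? : ∀ {A} c → Decidable A → Decidable (Kernel A c)
  Kernel? c A? x with A? x | Tr (c * x) ≟ 0#
  ... | yes a | yes b = yes (a , b)
  ... | no na | _ = no (λ p → na (proj₁ p))
  ... | _ | no nb = no (λ p → nb (proj₂ p))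

  -- Because the functional is 1 at `a`, `A` is the direct sum of its kernel and the line `F_q a`;
  -- the coordinates of `x` are `Tr (c * x)` and `x - Tr (c * x) * a`.
  kernel-count : ∀ {A c a xs ys} → IsFqSubspace A → A a → Tr (c * a) ≡ 1# →
    Enumerates A xs → Enumerates (Kernel A c) ys → length xs ≡ q ℕ.* length ys
  kernel-count {A} {c} {a} {xs} {ys} A-sub a∈ a-dual ex ey = trans
    (enum-≡ ex (enum-× Fqs-enumerate ey) split (λ (t , z) → z + t * a)
      (λ {x} x∈ → Tr-Fq _ , has-minus A-sub x∈ (has-* A-sub (Tr-Fq _) a∈) , kernel x)
      (λ (t∈ , z∈ , _) → has-+ A-sub z∈ (has-* A-sub t∈ a∈))
      (λ {x} {y} _ _ e → let e₁ , e₂ = ,-injective e in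
        +-cancelʳ {z = - (Tr (c * x) * a)} (trans e₂ (cong (λ t → y - t * a) (sym e₁))))
      join-injective)
    (trans (length-cartesianProduct Fqs ys) (cong (ℕ._* length ys) |Fqs|))
    where
    split : Carrier → Carrier × Carrier
    split x = Tr (c * x) , x - Tr (c * x) * a
    Tr-join : ∀ z {t} → IsFq t → Tr (c * (z + t * a)) ≡ Tr (c * z) + t
    Tr-join z {t} t∈ = trans (cong Tr (distribˡ c z _)) (trans (Tr-+ _ _)
      (cong (Tr (c * z) +_) (trans (Tr-*ʳ c a t∈) (trans (cong (t *_) a-dual) (*-identityʳ t)))))
    kernel : ∀ x → Tr (c * (x - Tr (c * x) * a)) ≡ 0#
    kernel x = begin
      Tr (c * (x - Tr (c * x) * a))     ≡⟨ cong (λ z → Tr (c * (x + z))) (-‿distribˡ-* _ a) ⟩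
      Tr (c * (x + - Tr (c * x) * a))   ≡⟨ Tr-join x (Fq-neg (Tr-Fq _)) ⟩
      Tr (c * x) + - Tr (c * x)         ≡⟨ -‿inverseʳ _ ⟩
      0#                                ∎
    join-injective : ∀ {u v : Carrier × Carrier} → IsFq (proj₁ u) × Kernel A c (proj₂ u) → IsFq (proj₁ v) × Kernel A c (proj₂ v) →
      proj₂ u + proj₁ u * a ≡ proj₂ v + proj₁ v * a → u ≡ v
    join-injective {t , z} {t′ , z′} (t∈ , _ , kz) (t′∈ , _ , kz′) e = cong₂ _,_ t≡t′
      (+-cancelʳ (trans e (cong (λ t → z′ + t * a) (sym t≡t′))))
      where
      t≡t′ : t ≡ t′
      t≡t′ = begin
        t                           ≡⟨ sym (+-identityˡ t) ⟩
        0# + t                      ≡⟨ cong (_+ t) (sym kz) ⟩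
        Tr (c * z) + t              ≡⟨ sym (Tr-join z t∈) ⟩
        Tr (c * (z + t * a))        ≡⟨ cong (λ w → Tr (c * w)) e ⟩
        Tr (c * (z′ + t′ * a))      ≡⟨ Tr-join z′ t′∈ ⟩
        Tr (c * z′) + t′            ≡⟨ cong (_+ t′) kz′ ⟩
        0# + t′                     ≡⟨ +-identityˡ t′ ⟩
        t′                          ∎

  kernel-count-power : ∀ {A c a m xs ys} → IsFqSubspace A → A a → Tr (c * a) ≡ 1# →
    Enumerates A xs → Enumerates (Kernel A c) ys → length xs ≡ q ℕ.^ suc m → length ys ≡ q ℕ.^ m
  kernel-count-power A-sub a∈ a-dual ex ey size = ℕ.*-cancelˡ-≡ _ _ q (trans (sym (kernel-count A-sub a∈ a-dual ex ey)) size)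

  W : Carrier → Set
  W x = Tr x ≡ 0#

  W-subspace : IsFqSubspace W
  W-subspace .has-0 = Tr-0
  W-subspace .has-+ a b = trans (Tr-+ _ _) (trans (cong₂ _+_ a b) (+-identityˡ 0#))
  W-subspace .has-* {c} c∈ a = trans (Tr-* c∈ _) (trans (cong (c *_) a) (zeroʳ c))

  -- W is its own image under y ↦ y - y^q, so a functional Tr(e ·) vanishing on W makes e fixed by x ↦ x^{q^3}.
  dual-in-W : ∀ {e} → ¬ IsFq e → Σ Carrier λ a → W a × Tr (e * a) ≡ 1#
  dual-in-W {e} e∉ = let y , tr = dual {e - F (F (F e))} (λ eq → e∉ (F³-fixed (sym (x-y≡0⇒x≡y eq)))) in
    φ y , Tr-φ y , (begin
      Tr (e * (y - F y))                    ≡⟨ cong Tr (solve 3 (λ e y a → e :* (y :- a) := e :* y :- e :* a) refl e y _) ⟩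
      Tr (e * y - e * F y)                  ≡⟨ Tr-minus _ _ ⟩
      Tr (e * y) - Tr (e * F y)             ≡⟨ cong (λ z → Tr (e * y) - Tr (z * F y)) (sym (F^4 e)) ⟩
      Tr (e * y) - Tr (F (F (F (F e))) * F y)   ≡⟨ cong (λ z → Tr (e * y) - Tr z) (sym (F-* _ y)) ⟩
      Tr (e * y) - Tr (F (F (F (F e)) * y)) ≡⟨ cong (λ z → Tr (e * y) - z) (Tr-F _) ⟩
      Tr (e * y) - Tr (F (F (F e)) * y)     ≡⟨ sym (Tr-minus _ _) ⟩
      Tr (e * y - F (F (F e)) * y)          ≡⟨ cong Tr (solve 3 (λ e y a → e :* y :- a :* y := y :* (e :- a)) refl e y _) ⟩
      Tr (y * (e - F (F (F e))))            ≡⟨ tr ⟩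
      1#                                    ∎)

  -- Dimensions of subspaces of V

  ==⇒≡ : ∀ {x y} → (x == y) ≡ true → x ≡ y
  ==⇒≡ {x} {y} e with x ≟ y
  ... | yes p = p

  ≡⇒== : ∀ {x y} → x ≡ y → (x == y) ≡ true
  ≡⇒== {x} {y} e with x ≟ y
  ... | yes _ = refl
  ... | no ne = ⊥-elim (ne e)

  ∧-intro : ∀ {a b} → a ≡ true → b ≡ true → a ∧ b ≡ true
  ∧-intro refl refl = refl

  ∧-left : ∀ {a b} → a ∧ b ≡ true → a ≡ true
  ∧-left = Bool.∧-conicalˡ _ _

  ∧-right : ∀ {a b} → a ∧ b ≡ true → b ≡ true
  ∧-right = Bool.∧-conicalʳ _ _

  Bool-ext : ∀ {a b} → (a ≡ true → b ≡ true) → (b ≡ true → a ≡ true) → a ≡ b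
  Bool-ext {true} f g = sym (f refl)
  Bool-ext {false} {false} f g = refl
  Bool-ext {false} {true} f g = g refl

  ⊕-identityʳ : ∀ v → v ⊕ 0v ≡ v
  ⊕-identityʳ (x , y) = cong₂ _,_ (+-identityʳ x) (+-identityʳ y)

  ⊕-identityˡ : ∀ v → 0v ⊕ v ≡ v
  ⊕-identityˡ (x , y) = cong₂ _,_ (+-identityˡ x) (+-identityˡ y)

  0·v≡0v : ∀ v → 0# · v ≡ 0v
  0·v≡0v (x , y) = cong₂ _,_ (zeroˡ x) (zeroˡ y)

  c·v≡0⇒c≡0 : ∀ {c v} → v ≢ 0v → c · v ≡ 0v → c ≡ 0#
  c·v≡0⇒c≡0 {c} {x , y} v≢0 e with c ≟ 0#
  ... | yes p = p
  ... | no c≢0 = ⊥-elim (v≢0 (cong₂ _,_ (x*y≡0⇒y≡0 c≢0 (cong proj₁ e)) (x*y≡0⇒y≡0 c≢0 (cong proj₂ e))))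

  _≟v_ : (v w : Vec2) → Dec (v ≡ w)
  _≟v_ = ≡-dec _≟_ _≟_

  ∈-allVecs : ∀ v → v ∈ allVecs
  ∈-allVecs (x , y) = ∈-cartesianProduct⁺ (FiniteField.complete K x) (FiniteField.complete K y)

  HasDim-cong : ∀ {U U′ d} → U ⊆ U′ → U′ ⊆ U → HasDim U d → HasDim U′ d
  HasDim-cong sub sup (b , b∈ , ind , span) = b , (λ i → sub _ (b∈ i)) , ind , (λ v v∈ → span v (sup v v∈))

  HasDim-1 : ∀ {U v} → v ≢ 0v → U ∋ v → (∀ w → U ∋ w → Σ Carrier λ c → IsFq c × c · v ≡ w) → HasDim U 1
  HasDim-1 {U} {v} v≢0 v∈ multiple = (λ _ → v) , (λ _ → v∈) ,
    (λ { c c∈ e Fin.zero → c·v≡0⇒c≡0 v≢0 (trans (sym (⊕-identityʳ _)) e) }) ,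
    (λ w w∈ → let c , c∈ , e = multiple w w∈ in (λ _ → c) , (λ _ → c∈) , trans (⊕-identityʳ _) e)

  -- A search through all vectors for a nonzero one decides between dimensions 0 and 1 and supplies
  -- the basis. Every distance statement about the code is reduced to this hypothesis on pairs of
  -- vectors.
  dim-≤1 : ∀ {U} → (∀ v w → v ≢ 0v → U ∋ v → U ∋ w → Σ Carrier λ c → IsFq c × c · v ≡ w) → DimAtMost U 1
  dim-≤1 {U} multiple with any? (λ v → ¬? (v ≟v 0v) ×-dec (U v Bool.≟ true)) allVecs
  ... | yes a = let v , _ , v≢0 , v∈ = find a in 1 , ℕ.≤-refl , HasDim-1 v≢0 v∈ (λ w → multiple v w v≢0 v∈)
  ... | no none = 0 , ℕ.z≤n , (λ ()) , (λ ()) , (λ _ _ _ ()) , (λ v v∈ → (λ ()) , (λ ()) , zero-only v v∈)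
    where
    zero-only : ∀ v → U ∋ v → 0v ≡ v
    zero-only v v∈ with v ≟v 0v
    ... | yes e = sym e
    ... | no v≢0 = ⊥-elim (none (lose (∈-allVecs v) (v≢0 , v∈)))

  -- The functional reads only the first coordinate, so cutting `U` down in this way leaves `U ∩ S`
  -- intact.
  KernelOn : Carrier → Subset → Subset
  KernelOn c U (x , y) = U (x , y) ∧ (Tr (c * x) == 0#)

  KernelOn-subspace : ∀ {U} c → IsSubspace U → IsSubspace (KernelOn c U)
  KernelOn-subspace {U} c U-sub = record
    { inV = λ x y m → inV x y (∧-left m)
    ; zero∈ = ∧-intro zero∈ (≡⇒== (trans (cong Tr (zeroʳ c)) Tr-0))
    ; +-closed = λ v w v∈ w∈ → ∧-intro (+-closed v w (∧-left v∈) (∧-left w∈))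
        (≡⇒== (trans (cong Tr (distribˡ c _ _)) (trans (Tr-+ _ _)
          (trans (cong₂ _+_ (==⇒≡ (∧-right v∈)) (==⇒≡ (∧-right w∈))) (+-identityˡ 0#)))))
    ; ·-closed = λ a v a∈ v∈ → ∧-intro (·-closed a v a∈ (∧-left v∈))
        (≡⇒== (trans (Tr-*ʳ c _ a∈) (trans (cong (a *_) (==⇒≡ (∧-right v∈))) (zeroʳ a))))
    }
    where open IsSubspace U-sub

  lincomb-closed : ∀ {U d} → IsSubspace U → (c : Fin d → Carrier) (b : Fin d → Vec2) →
    (∀ i → IsFq (c i)) → (∀ i → U ∋ b i) → U ∋ lincomb c b
  lincomb-closed {d = zero} U-sub c b c∈ b∈ = IsSubspace.zero∈ U-sub
  lincomb-closed {d = suc d} U-sub c b c∈ b∈ = IsSubspace.+-closed U-sub _ _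
    (IsSubspace.·-closed U-sub _ _ (c∈ Fin.zero) (b∈ Fin.zero))
    (lincomb-closed U-sub (λ i → c (Fin.suc i)) (λ i → b (Fin.suc i)) (λ i → c∈ (Fin.suc i)) (λ i → b∈ (Fin.suc i)))

  -- The functional has value 1 at `u`, so `u` spans a complement of the kernel: applying it to a
  -- linear combination reads off the coefficient of `u`.
  HasDim-suc : ∀ {U c u d} → IsSubspace U → U ∋ u → Tr (c * proj₁ u) ≡ 1# →
    HasDim (KernelOn c U) d → HasDim U (suc d)
  HasDim-suc {U} {c} {u} {d} U-sub u∈ u-dual (b , b∈ , ind , span) = b′ , b′∈ , ind′ , span′
    where
    open IsSubspace U-sub
    b′ : Fin (suc d) → Vec2
    b′ Fin.zero = u
    b′ (Fin.suc i) = b i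
    b′∈ : ∀ i → U ∋ b′ i
    b′∈ Fin.zero = u∈
    b′∈ (Fin.suc i) = ∧-left (b∈ i)
    functional : ∀ {t} v → IsFq t → Tr (c * (t * proj₁ u + proj₁ v)) ≡ t + Tr (c * proj₁ v)
    functional {t} v t∈ = begin
      Tr (c * (t * proj₁ u + proj₁ v))              ≡⟨ cong Tr (distribˡ c _ _) ⟩
      Tr (c * (t * proj₁ u) + c * proj₁ v)          ≡⟨ Tr-+ _ _ ⟩
      Tr (c * (t * proj₁ u)) + Tr (c * proj₁ v)     ≡⟨ cong (_+ _) (trans (Tr-*ʳ c _ t∈) (trans (cong (t *_) u-dual) (*-identityʳ t))) ⟩
      t + Tr (c * proj₁ v)                          ∎
    ind′ : ∀ (a : Fin (suc d) → Carrier) → (∀ i → IsFq (a i)) → lincomb a b′ ≡ 0v → ∀ i → a i ≡ 0#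
    ind′ a a∈ e = λ { Fin.zero → a₀≡0 ; (Fin.suc i) → ind (λ i → a (Fin.suc i)) (λ i → a∈ (Fin.suc i)) rest≡0 i }
      where
      rest : Vec2
      rest = lincomb (λ i → a (Fin.suc i)) b
      rest-kernel : Tr (c * proj₁ rest) ≡ 0#
      rest-kernel = ==⇒≡ (∧-right {a = U rest} (lincomb-closed (KernelOn-subspace c U-sub) (λ i → a (Fin.suc i)) b (λ i → a∈ (Fin.suc i)) b∈))
      a₀≡0 : a Fin.zero ≡ 0#
      a₀≡0 = begin
        a Fin.zero                            ≡⟨ sym (+-identityʳ _) ⟩
        a Fin.zero + 0#                       ≡⟨ cong (a Fin.zero +_) (sym rest-kernel) ⟩
        a Fin.zero + Tr (c * proj₁ rest)      ≡⟨ sym (functional rest (a∈ Fin.zero)) ⟩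
        Tr (c * (a Fin.zero * proj₁ u + proj₁ rest)) ≡⟨ cong (λ v → Tr (c * proj₁ v)) e ⟩
        Tr (c * 0#)                           ≡⟨ trans (cong Tr (zeroʳ c)) Tr-0 ⟩
        0#                                    ∎
      rest≡0 : rest ≡ 0v
      rest≡0 = begin
        rest                        ≡⟨ sym (⊕-identityˡ rest) ⟩
        0v ⊕ rest                   ≡⟨ cong (_⊕ rest) (sym (trans (cong (_· u) a₀≡0) (0·v≡0v u))) ⟩
        (a Fin.zero · u) ⊕ rest     ≡⟨ e ⟩
        0v                          ∎
    span′ : ∀ v → U ∋ v → Σ (Fin (suc d) → Carrier) λ a → (∀ i → IsFq (a i)) × lincomb a b′ ≡ v
    span′ v@(x , y) v∈ = let a , a∈ , e = span w w∈ in
      (λ { Fin.zero → t ; (Fin.suc i) → a i }) , (λ { Fin.zero → Tr-Fq _ ; (Fin.suc i) → a∈ i }) ,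
      trans (cong ((t · u) ⊕_) e) (cong₂ _,_ (cancel _ _) (cancel _ _))
      where
      t = Tr (c * x)
      w = ((- t) · u) ⊕ v
      cancel : ∀ a x → t * a + (- t * a + x) ≡ x
      cancel a x = solve 3 (λ t a x → t :* a :+ (:- t :* a :+ x) := x) refl t a x
      w∈ : KernelOn c U ∋ w
      w∈ = ∧-intro (+-closed _ _ (·-closed _ _ (Fq-neg (Tr-Fq _)) u∈) v∈)
        (≡⇒== (trans (functional v (Fq-neg (Tr-Fq _))) (-‿inverseˡ t)))

  -- Rank-nullity for the projection to the first coordinate, whose image `A` has `q ^ m` elements
  -- and whose kernel is `U ∩ S`. Each step takes a nonzero `a` in `A` and a functional with value 1
  -- at `a`; passing to kernels lowers both `A` and `U` by one dimension.
  HasDim-by-projection : ∀ m {U d A xs} → IsSubspace U → IsFqSubspace A → Decidable A → Enumerates A xs → length xs ≡ q ℕ.^ m →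
    (∀ {x y} → U ∋ (x , y) → A x) → (∀ {x} → A x → Σ Carrier λ y → U ∋ (x , y)) →
    HasDim (U ∩ S) d → HasDim U (m ℕ.+ d)
  HasDim-by-projection zero {U} {A = A} {xs} U-sub A-sub A? ex size proj lift dim =
    -- With `q ^ 0 = 1` elements, `A` is zero and `U` already lies in `S`.
    HasDim-cong (λ v v∈ → ∧-left v∈) (λ v v∈ → ∧-intro v∈ (≡⇒== (only-0 xs size (λ {x} → Enumerates.complete ex {x}) (proj v∈)))) dim
    where
    only-0 : ∀ xs → length xs ≡ 1 → (∀ {x} → A x → x ∈ xs) → ∀ {x} → A x → x ≡ 0#
    only-0 (z ∷ []) refl all x∈ with all x∈ | all (has-0 A-sub)
    ... | here e | here e′ = trans e (sym e′)
  HasDim-by-projection (suc m) {U} {d} {A} {xs} U-sub A-sub A? ex size proj lift dim =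
    HasDim-suc {u = a , y} U-sub u∈ a-dual (HasDim-by-projection m (KernelOn-subspace c U-sub) (Kernel-subspace c A-sub)
      (Kernel? c A?) kernel-enum (kernel-count-power {m = m} A-sub a∈ a-dual ex kernel-enum size)
      (λ v∈ → proj (∧-left v∈) , ==⇒≡ (∧-right v∈))
      (λ (x∈ , k) → let y , v∈ = lift x∈ in y , ∧-intro v∈ (≡⇒== k))
      (HasDim-cong to from dim))
    where
    nonzero : Σ Carrier λ x → x ∈ xs × x ≢ 0#
    nonzero = ∃-in (λ x → ¬? (x ≟ 0#)) xs λ h →
      ℕ.<⇒≱ (subst (1 <_) (sym size) (1<q^ m)) (length-⊆ {ys = 0# ∷ []} (nodup ex) λ {x} x∈ → here (decidable-stable (x ≟ 0#) (h x∈)))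
    a = proj₁ nonzero
    a∈ : A a
    a∈ = sound ex (proj₁ (proj₂ nonzero))
    c = proj₁ (dual (proj₂ (proj₂ nonzero)))
    a-dual : Tr (c * a) ≡ 1#
    a-dual = proj₂ (dual (proj₂ (proj₂ nonzero)))
    y = proj₁ (lift a∈)
    u∈ : U ∋ (a , y)
    u∈ = proj₂ (lift a∈)
    kernel-enum : Enumerates (Kernel A c) (filter (Kernel? c A?) elems)
    kernel-enum = filter-elems (Kernel? c A?)
    to : (U ∩ S) ⊆ (KernelOn c U ∩ S)
    to (x , y) v∈ = ∧-intro (∧-intro (∧-left {a = U (x , y)} v∈)
      (≡⇒== (trans (cong (λ x → Tr (c * x)) (==⇒≡ (∧-right {a = U (x , y)} v∈))) (trans (cong Tr (zeroʳ c)) Tr-0))))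
      (∧-right {a = U (x , y)} v∈)
    from : (KernelOn c U ∩ S) ⊆ (U ∩ S)
    from (x , y) v∈ = ∧-intro (∧-left {a = U (x , y)} (∧-left {a = KernelOn c U (x , y)} v∈))
      (∧-right {a = KernelOn c U (x , y)} v∈)

  -- The lifted Gabidulin code

  -- Nonvanishing of the Moore determinant, which characterises linear independence over F_q.
  Independent : Carrier → Carrier → Set
  Independent x y = x * F y - F x * y ≢ 0#

  cramer : ∀ {a b x y x′ y′} → x * y′ - y * x′ ≢ 0# → a * x + b * y ≡ 0# → a * x′ + b * y′ ≡ 0# → a ≡ 0# × b ≡ 0#
  cramer {a} {b} {x} {y} {x′} {y′} det e e′ = x*y≡0⇒y≡0 det eq-a , x*y≡0⇒y≡0 det eq-b
    where
    eq-a : (x * y′ - y * x′) * a ≡ 0#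
    eq-a = begin
      (x * y′ - y * x′) * a                       ≡⟨ solve 6 (λ a b x y x′ y′ → (x :* y′ :- y :* x′) :* a := (a :* x :+ b :* y) :* y′ :- (a :* x′ :+ b :* y′) :* y) refl a b x y x′ y′ ⟩
      (a * x + b * y) * y′ - (a * x′ + b * y′) * y  ≡⟨ cong₂ (λ u v → u * y′ - v * y) e e′ ⟩
      0# * y′ - 0# * y                            ≡⟨ trans (cong₂ _-_ (zeroˡ _) (zeroˡ _)) (-‿inverseʳ 0#) ⟩
      0#                                          ∎
    eq-b : (x * y′ - y * x′) * b ≡ 0#
    eq-b = begin
      (x * y′ - y * x′) * b                       ≡⟨ solve 6 (λ a b x y x′ y′ → (x :* y′ :- y :* x′) :* b := (a :* x′ :+ b :* y′) :* x :- (a :* x :+ b :* y) :* x′) refl a b x y x′ y′ ⟩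
      (a * x′ + b * y′) * x - (a * x + b * y) * x′  ≡⟨ cong₂ (λ u v → u * x - v * x′) e′ e ⟩
      0# * x - 0# * x′                            ≡⟨ trans (cong₂ _-_ (zeroˡ _) (zeroˡ _)) (-‿inverseʳ 0#) ⟩
      0#                                          ∎

  -- A vanishing Moore determinant says `x y^q = x^q y`, that is, `y * x ⁻¹` is fixed by `F`.
  multiple-or-independent : ∀ {x} y → x ≢ 0# → (Σ Carrier λ c → IsFq c × c * x ≡ y) ⊎ Independent x y
  multiple-or-independent {x} y x≢0 with (x * F y - F x * y) ≟ 0#
  ... | no ne = inj₂ ne
  ... | yes e = inj₁ (y * x ⁻¹ , fq , trans (*-assoc _ _ _) (trans (cong (y *_) (*-inverseˡ x≢0)) (*-identityʳ y)))
    where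
    fq : IsFq (y * x ⁻¹)
    fq = *-cancelˡ (*-≢0 x≢0 (F-≢0 x≢0)) (begin
      x * F x * F (y * x ⁻¹)        ≡⟨ cong (x * F x *_) (trans (F-* y _) (cong (F y *_) (F-⁻¹ x≢0))) ⟩
      x * F x * (F y * F x ⁻¹)      ≡⟨ solve 4 (λ x a b c → x :* a :* (b :* c) := x :* b :* (a :* c)) refl x (F x) (F y) (F x ⁻¹) ⟩
      x * F y * (F x * F x ⁻¹)      ≡⟨ cong₂ _*_ (x-y≡0⇒x≡y e) (trans (*-inverseʳ (F-≢0 x≢0)) (sym (*-inverseʳ x≢0))) ⟩
      F x * y * (x * x ⁻¹)          ≡⟨ solve 4 (λ x a b c → a :* b :* (x :* c) := x :* a :* (b :* c)) refl x (F x) y (x ⁻¹) ⟩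
      x * F x * (y * x ⁻¹)          ∎)

  Independent⇒≢0 : ∀ {x y} → Independent x y → x ≢ 0#
  Independent⇒≢0 {x} {y} ind refl = ind (trans (cong₂ (λ a b → a - b * y) (zeroˡ _) F-0) (trans (cong (λ z → 0# - z) (zeroˡ y)) (-‿inverseʳ 0#)))

  Independent-F : ∀ {x y} → Independent x y → Independent (F x) (F y)
  Independent-F {x} {y} ind e = F-≢0 ind (trans (F-minus _ _) (trans (cong₂ _-_ (F-* x (F y)) (F-* (F x) y)) e))

  gabidulin : Carrier → Carrier → Carrier → Carrier
  gabidulin a₀ a₁ x = a₀ * x + a₁ * F x

  gabidulin-+ : ∀ a₀ a₁ x y → gabidulin a₀ a₁ (x + y) ≡ gabidulin a₀ a₁ x + gabidulin a₀ a₁ y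
  gabidulin-+ a₀ a₁ x y = trans (cong (λ z → a₀ * (x + y) + a₁ * z) (F-+ x y))
    (solve 6 (λ a b x y u v → a :* (x :+ y) :+ b :* (u :+ v) := (a :* x :+ b :* u) :+ (a :* y :+ b :* v)) refl a₀ a₁ x y _ _)

  gabidulin-* : ∀ a₀ a₁ {c} x → IsFq c → gabidulin a₀ a₁ (c * x) ≡ c * gabidulin a₀ a₁ x
  gabidulin-* a₀ a₁ {c} x c∈ = trans (cong (λ z → a₀ * (c * x) + a₁ * z) (trans (F-* c x) (cong (_* F x) c∈)))
    (solve 5 (λ a b x c u → a :* (c :* x) :+ b :* (c :* u) := c :* (a :* x :+ b :* u)) refl a₀ a₁ x c _)

  gabidulin-0 : ∀ a₀ a₁ → gabidulin a₀ a₁ 0# ≡ 0#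
  gabidulin-0 a₀ a₁ = trans (cong₂ _+_ (zeroʳ a₀) (trans (cong (a₁ *_) F-0) (zeroʳ a₁))) (+-identityˡ 0#)

  module _ {a₀ a₁ x y} (m : Γ a₀ a₁ ∋ (x , y)) where
    Γ-W : Tr x ≡ 0#
    Γ-W = ==⇒≡ (∧-left m)
    Γ-value : y ≡ gabidulin a₀ a₁ x
    Γ-value = ==⇒≡ (∧-right {a = inW x} m)

  Γ-intro : ∀ {a₀ a₁ x y} → Tr x ≡ 0# → y ≡ gabidulin a₀ a₁ x → Γ a₀ a₁ ∋ (x , y)
  Γ-intro tr e = ∧-intro (≡⇒== tr) (≡⇒== e)

  Γ-subspace : ∀ a₀ a₁ → IsSubspace (Γ a₀ a₁)
  Γ-subspace a₀ a₁ = record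
    { inV = λ x y m → Γ-W m
    ; zero∈ = Γ-intro Tr-0 (sym (gabidulin-0 a₀ a₁))
    ; +-closed = λ (x , _) (x′ , _) v∈ w∈ → Γ-intro (has-+ W-subspace (Γ-W v∈) (Γ-W w∈))
        (trans (cong₂ _+_ (Γ-value v∈) (Γ-value w∈)) (sym (gabidulin-+ a₀ a₁ x x′)))
    ; ·-closed = λ c (x , _) c∈ v∈ → Γ-intro (has-* W-subspace c∈ (Γ-W v∈))
        (trans (cong (c *_) (Γ-value v∈)) (sym (gabidulin-* a₀ a₁ x c∈)))
    }

  HasDim-0 : ∀ {U} → (∀ v → U ∋ v → v ≡ 0v) → HasDim U 0
  HasDim-0 trivial = (λ ()) , (λ ()) , (λ _ _ _ ()) , (λ v v∈ → (λ ()) , (λ ()) , sym (trivial v v∈))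

  Γ-plane : ∀ a₀ a₁ → IsPlane (Γ a₀ a₁)
  Γ-plane a₀ a₁ = Γ-subspace a₀ a₁ , HasDim-by-projection 3 (Γ-subspace a₀ a₁) W-subspace
    (λ x → Tr x ≟ 0#) trace-zeros-enumerate |trace-zeros| (λ m → Γ-W m) (λ tr → _ , Γ-intro tr refl)
    (HasDim-0 λ (x , y) m →
      let x≡0 = ==⇒≡ (∧-right {a = Γ a₀ a₁ (x , y)} m) in
      cong₂ _,_ x≡0 (trans (Γ-value (∧-left m)) (trans (cong (gabidulin a₀ a₁) x≡0) (gabidulin-0 a₀ a₁))))

  -- On a graph the second coordinate depends linearly on the first, so dependence of first
  -- coordinates carries over to vectors.
  dim-≤1-graph : ∀ {U a₀ a₁} → U ⊆ Γ a₀ a₁ →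
    (∀ {x y x′ y′} → U ∋ (x , y) → U ∋ (x′ , y′) → ¬ Independent x x′) → DimAtMost U 1
  dim-≤1-graph {U} {a₀} {a₁} sub dep = dim-≤1 λ (x , y) (x′ , y′) v≢0 v∈ w∈ →
    multiple v≢0 v∈ w∈ (multiple-or-independent x′ (x≢0 v≢0 v∈))
    where
    x≢0 : ∀ {x y} → (x , y) ≢ 0v → U ∋ (x , y) → x ≢ 0#
    x≢0 v≢0 v∈ refl = v≢0 (cong (0# ,_) (trans (Γ-value (sub _ v∈)) (gabidulin-0 a₀ a₁)))
    multiple : ∀ {x y x′ y′} → (x , y) ≢ 0v → U ∋ (x , y) → U ∋ (x′ , y′) →
      (Σ Carrier λ c → IsFq c × c * x ≡ x′) ⊎ Independent x x′ → Σ Carrier λ c → IsFq c × c · (x , y) ≡ (x′ , y′)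
    multiple v≢0 v∈ w∈ (inj₂ ind) = ⊥-elim (dep v∈ w∈ ind)
    multiple {x} {y} {x′} {y′} v≢0 v∈ w∈ (inj₁ (c , c∈ , e)) = c , c∈ , cong₂ _,_ e (begin
      c * y                     ≡⟨ cong (c *_) (Γ-value (sub _ v∈)) ⟩
      c * gabidulin a₀ a₁ x     ≡⟨ sym (gabidulin-* a₀ a₁ x c∈) ⟩
      gabidulin a₀ a₁ (c * x)   ≡⟨ cong (gabidulin a₀ a₁) e ⟩
      gabidulin a₀ a₁ x′        ≡⟨ sym (Γ-value (sub _ w∈)) ⟩
      y′                        ∎)

  -- The rank distance of the Gabidulin code: the difference of two maps has the form
  -- `c₀ x + c₁ x^q`, and two independent zeros force both coefficients to vanish by Cramer's rule
  -- with the Moore determinant.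
  Γ∩Γ : ∀ {a₀ a₁ b₀ b₁} → (a₀ , a₁) ≢ (b₀ , b₁) → DimAtMost (Γ a₀ a₁ ∩ Γ b₀ b₁) 1
  Γ∩Γ {a₀} {a₁} {b₀} {b₁} ne = dim-≤1-graph (λ v m → ∧-left m) λ v∈ w∈ ind →
    let p , r = cramer ind (difference v∈) (difference w∈) in ne (cong₂ _,_ (x-y≡0⇒x≡y p) (x-y≡0⇒x≡y r))
    where
    difference : ∀ {x y} → (Γ a₀ a₁ ∩ Γ b₀ b₁) ∋ (x , y) → (a₀ - b₀) * x + (a₁ - b₁) * F x ≡ 0#
    difference {x} {y} m = trans
      (solve 6 (λ a b c d x u → (a :- b) :* x :+ (c :- d) :* u := (a :* x :+ c :* u) :- (b :* x :+ d :* u)) refl a₀ b₀ a₁ b₁ x (F x))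
      (x≡y⇒x-y≡0 (trans (sym (Γ-value (∧-left m))) (Γ-value (∧-right {a = Γ a₀ a₁ (x , y)} m))))

  ==-false : ∀ {x y} → x ≢ y → (x == y) ≡ false
  ==-false {x} {y} ne with x ≟ y
  ... | yes e = ⊥-elim (ne e)
  ... | no _ = refl

  not-==⇒≢ : ∀ {x y} → not (x == y) ≡ true → x ≢ y
  not-==⇒≢ {x} {y} e with x ≟ y
  ... | no ne = ne

  any-intro : ∀ {p : Carrier → Bool} x → p x ≡ true → any p elems ≡ true
  any-intro {p} x e = Equivalence.to Bool.T-≡ (Any.any⁺ p (lose (FiniteField.complete K x) (subst T (sym e) tt)))

  any-elim : ∀ {p : Carrier → Bool} → any p elems ≡ true → Σ Carrier λ x → p x ≡ true
  any-elim {p} e = let x , _ , t = find (Any.any⁻ p elems (subst T (sym e) tt)) in x , Equivalence.to Bool.T-≡ t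

  Removal : Carrier × Carrier → Carrier → Carrier → Set
  Removal (a₀ , a₁) r u = r ≢ 0# × Tr u ≢ 0# × a₀ ≡ - (r * F u) × a₁ ≡ r * u

  removed-intro : ∀ {c r u} → Removal c r u → removed c ≡ true
  removed-intro {_} {r} {u} (r≢0 , u∉ , e₀ , e₁) = any-intro r (any-intro u
    (∧-intro (cong not (==-false r≢0)) (∧-intro (cong not (==-false u∉)) (∧-intro (≡⇒== e₀) (≡⇒== e₁)))))

  removed-elim : ∀ {c} → removed c ≡ true → Σ Carrier λ r → Σ Carrier λ u → Removal c r u
  removed-elim {a₀ , a₁} e =
    let r , e′ = any-elim e
        u , m = any-elim e′
        m′ = ∧-right {a = not (r == 0#)} m
        m″ = ∧-right {a = not (inW u)} m′
    in r , u , not-==⇒≢ (∧-left m) , not-==⇒≢ (∧-left m′) , ==⇒≡ (∧-left m″) , ==⇒≡ (∧-right {a = a₀ == - (r * pow u q)} m″)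

  -- The slope of a new plane

  -- For `κ = a + a^{q²}` the sum `κ + κ^q` is `Tr a`, so any trace-zero `a` will do unless `κ`
  -- vanishes; that happens for at most `q²` of the `q³` trace zeros. For even `q` such a `κ` simply
  -- lies in F_q.
  anti-invariant : Σ Carrier λ κ → κ ≢ 0# × F κ ≡ - κ
  anti-invariant =
    let a , a∈ , ne = ∃-in (λ a → ¬? ((a + F (F a)) ≟ 0#)) trace-zeros all-zero
    in a + F (F a) , ne , x-y≡0⇒x≡y (begin
         F (a + F (F a)) - - (a + F (F a))     ≡⟨ cong (λ z → z - - (a + F (F a))) (F-+ _ _) ⟩
         F a + F (F (F a)) - - (a + F (F a))   ≡⟨ solve 4 (λ x a b c → a :+ c :- (:- (x :+ b)) := x :+ a :+ b :+ c) refl a _ _ _ ⟩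
         a + F a + F (F a) + F (F (F a))       ≡⟨ sym (Tr≡ a) ⟩
         Tr a                                  ≡⟨ sound trace-zeros-enumerate a∈ ⟩
         0#                                    ∎)
    where
    all-zero : ¬ (∀ {a} → a ∈ trace-zeros → ¬ (a + F (F a) ≢ 0#))
    all-zero h = ℕ.<⇒≱ (q^-mono-< {2} {3} ℕ.≤-refl)
      (ℕ.≤-trans (ℕ.≤-reflexive (sym |trace-zeros|)) (F²-neg-roots (nodup trace-zeros-enumerate) (λ {a} a∈ → decidable-stable ((a + F (F a)) ≟ 0#) (h a∈))))

  abstract
    κ : Carrier
    κ = proj₁ anti-invariant

    κ≢0 : κ ≢ 0#
    κ≢0 = proj₁ (proj₂ anti-invariant)

    F-κ : F κ ≡ - κ
    F-κ = proj₂ (proj₂ anti-invariant)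

  -- For e ∉ F_q, κ Δ(e) equals, up to F_q^×, the determinant a b^q - a^q b of any basis a, b of {1, e}^⊥.
  Δ : Carrier → Carrier
  Δ e = F (F (F e)) - F (F e)

  F-Δ : ∀ e → F (Δ e) ≡ e - F (F (F e))
  F-Δ e = trans (F-minus _ _) (cong (_- F (F (F e))) (F^4 e))

  Δ≢0 : ∀ {e} → ¬ IsFq e → Δ e ≢ 0#
  Δ≢0 e∉ d = e∉ (F-injective (F-injective (x-y≡0⇒x≡y d)))

  denominator : Carrier → Carrier
  denominator e = κ * Δ e * F (Δ e)

  slope : Carrier → Carrier
  slope e = F (F (F e)) * denominator e ⁻¹

  -- Bracketed in pairs to match `norm₂ (x * F x)`.
  norm : Carrier → Carrier
  norm x = x * F x * (F (F x) * F (F (F x)))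

  norm-Fq : ∀ x → IsFq (norm x)
  norm-Fq x = begin
    F (norm x) ≡⟨ trans (F-* _ _) (cong₂ _*_ (F-* _ _) (trans (F-* _ _) (cong (F (F (F x)) *_) (F^4 x)))) ⟩
    F x * F (F x) * (F (F (F x)) * x)
      ≡⟨ solve 4 (λ x a b c → a :* b :* (c :* x) := x :* a :* (b :* c)) refl x _ _ _ ⟩
    norm x ∎

  norm₂ : Carrier → Carrier
  norm₂ e = e * F (F e)

  module _ {e} (e∉ : ¬ IsFq e) where
    denominator≢0 : denominator e ≢ 0#
    denominator≢0 = *-≢0 (*-≢0 κ≢0 (Δ≢0 e∉)) (F-≢0 (Δ≢0 e∉))

    slope-denominator : denominator e * slope e ≡ F (F (F e))
    slope-denominator = trans (solve 3 (λ d x i → d :* (x :* i) := x :* (d :* i)) refl (denominator e) _ _)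
      (trans (cong (F (F (F e)) *_) (*-inverseʳ denominator≢0)) (*-identityʳ _))

    e≢0 : e ≢ 0#
    e≢0 refl = e∉ Fq-0

    slope≢0 : slope e ≢ 0#
    slope≢0 z = F-≢0 (F-≢0 (F-≢0 e≢0)) (trans (sym slope-denominator) (trans (cong (denominator e *_) z) (zeroʳ _)))

  private
    -- Both are anti-invariant under x ↦ x^q, so their quotients by κ lie in F_q.
    intercept gradient : Carrier → Carrier
    intercept e = (e * F (F e)) * (F e + F (F (F e))) - (F e * F (F (F e))) * (e + F (F e))
    gradient e = F e * F (F (F e)) - e * F (F e)

    F-gradient : ∀ e → F (gradient e) ≡ - gradient e
    F-gradient e = begin
      F (F e * F (F (F e)) - e * F (F e))   ≡⟨ trans (F-minus _ _) (cong₂ _-_ (trans (F-* _ _) (cong (F (F e) *_) (F^4 e))) (F-* _ _)) ⟩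
      F (F e) * e - F e * F (F (F e))       ≡⟨ solve 4 (λ x a b c → b :* x :- a :* c := :- (a :* c :- x :* b)) refl e _ _ _ ⟩
      - gradient e                                 ∎

    F-intercept : ∀ e → F (intercept e) ≡ - intercept e
    F-intercept e = begin
      F (intercept e) ≡⟨ F-minus _ _ ⟩
      F ((e * F (F e)) * (F e + F (F (F e)))) - F ((F e * F (F (F e))) * (e + F (F e)))
        ≡⟨ cong₂ _-_
             (trans (F-* _ _) (cong₂ _*_ (F-* _ _) (trans (F-+ _ _) (cong (F (F e) +_) (F^4 e)))))
             (trans (F-* _ _) (cong₂ _*_ (trans (F-* _ _) (cong (F (F e) *_) (F^4 e))) (F-+ _ _))) ⟩
      (F e * F (F (F e))) * (F (F e) + e) - (F (F e) * e) * (F e + F (F (F e)))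
        ≡⟨ solve 4 (λ x a b c → (a :* c) :* (b :+ x) :- (b :* x) :* (a :+ c) := :- ((x :* b) :* (a :+ c) :- (a :* c) :* (x :+ b))) refl e _ _ _ ⟩
      - intercept e   ∎

    anti-quotient : ∀ {x y} → y ≢ 0# → F x ≡ - x → F y ≡ - y → IsFq (x * y ⁻¹)
    anti-quotient {x} {y} y≢0 Fx Fy = *-cancelˡ y≢0 (begin
      y * F (x * y ⁻¹)              ≡⟨ cong (y *_) (trans (F-* _ _) (cong₂ _*_ Fx (F-⁻¹ y≢0))) ⟩
      y * (- x * F y ⁻¹)            ≡⟨ solve 3 (λ x y i → y :* ((:- x) :* i) := (:- y) :* i :* x) refl x y (F y ⁻¹) ⟩
      - y * F y ⁻¹ * x              ≡⟨ cong (λ z → z * F y ⁻¹ * x) (sym Fy) ⟩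
      F y * F y ⁻¹ * x              ≡⟨ cong (_* x) (trans (*-inverseʳ (F-≢0 y≢0)) (sym (*-inverseʳ y≢0))) ⟩
      y * y ⁻¹ * x                  ≡⟨ solve 3 (λ x y i → y :* i :* x := y :* (x :* i)) refl x y (y ⁻¹) ⟩
      y * (x * y ⁻¹)                ∎)

  record Slope (e : Carrier) : Set where
    field
      α β     : Carrier
      α∈      : IsFq α
      β∈      : IsFq β
      affine  : slope e ≡ α + β * F e
      special : β ≡ 0# → IsFq (norm₂ e)

  -- Write `e_i = e^{q^i}`. Extending the fraction by the two missing conjugates of `Δ e` turns the
  -- denominator into `κ` times a norm, which is anti-invariant. The numerator becomes
  -- `e_3 (e_1 - e_0)(e_2 - e_1)`, and this expands to `- (intercept e + gradient e * e_1)`. Since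
  -- `gradient e` is `F (norm₂ e) - norm₂ e`, its vanishing puts `e` on the quadric.
  slope-affine : ∀ {e} → ¬ IsFq e → Slope e
  slope-affine {e} e∉ = record
    { α = - (intercept e * κN ⁻¹) ; β = - (gradient e * κN ⁻¹)
    ; α∈ = Fq-neg (anti-quotient κN≢0 (F-intercept e) F-κN) ; β∈ = Fq-neg (anti-quotient κN≢0 (F-gradient e) F-κN)
    ; affine = *-cancelˡ (denominator≢0 e∉) (trans (slope-denominator e∉) (sym (begin
        denominator e * (- (intercept e * κN ⁻¹) + - (gradient e * κN ⁻¹) * F e)
          ≡⟨ solve 7 (λ e₀ e₁ e₂ e₃ k i d → k :* (e₃ :- e₂) :* d :* (:- (((e₀ :* e₂) :* (e₁ :+ e₃) :- (e₁ :* e₃) :* (e₀ :+ e₂)) :* i) :+ (:- ((e₁ :* e₃ :- e₀ :* e₂) :* i)) :* e₁)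
                       := k :* ((e₃ :- e₂) :* d :* ((e₁ :- e₀) :* (e₂ :- e₁))) :* i :* e₃) refl e (F e) (F (F e)) (F (F (F e))) κ (κN ⁻¹) (F (Δ e)) ⟩
        κ * (Δ e * F (Δ e) * ((F e - e) * (F (F e) - F e))) * κN ⁻¹ * F (F (F e))
          ≡⟨ cong (λ z → κ * (Δ e * F (Δ e) * z) * κN ⁻¹ * F (F (F e))) (sym (cong₂ _*_ F²Δ (trans (cong F F²Δ) (F-minus _ _)))) ⟩
        κN * κN ⁻¹ * F (F (F e))    ≡⟨ trans (cong (_* F (F (F e))) (*-inverseʳ κN≢0)) (*-identityˡ _) ⟩
        F (F (F e)) ∎)))
    ; special = λ β≡0 → special (gradient≡0 β≡0)
    }
    where
    κN : Carrier
    κN = κ * norm (Δ e)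
    κN≢0 : κN ≢ 0#
    κN≢0 = *-≢0 κ≢0 (*-≢0 (*-≢0 (Δ≢0 e∉) (F-≢0 (Δ≢0 e∉))) (*-≢0 (F-≢0 (F-≢0 (Δ≢0 e∉))) (F-≢0 (F-≢0 (F-≢0 (Δ≢0 e∉))))))
    F-κN : F κN ≡ - κN
    F-κN = trans (F-* κ _) (trans (cong₂ _*_ F-κ (norm-Fq (Δ e))) (sym (-‿distribˡ-* κ _)))
    F²Δ : F (F (Δ e)) ≡ F e - e
    F²Δ = trans (cong F (F-Δ e)) (trans (F-minus _ _) (cong (λ z → F e - z) (F^4 e)))
    gradient≡0 : - (gradient e * κN ⁻¹) ≡ 0# → gradient e ≡ 0#
    gradient≡0 z = x*y≡0⇒y≡0 (⁻¹-≢0 κN≢0) (trans (*-comm _ _) (trans (sym (-‿involutive _)) (trans (cong -_ z) -0#≈0#)))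
    special : gradient e ≡ 0# → IsFq (norm₂ e)
    special z = trans (F-* _ _) (x-y≡0⇒x≡y z)

  -- Replacing e by c₀ + c₁ e with c₀, c₁ ∈ F_q divides the slope's denominator by c₁²; hence equal slopes up to F_q force c₀ = 0.
  slope-injective : ∀ {e e′ σ} → ¬ IsFq e → ¬ IsFq e′ → IsFq σ → slope e′ ≡ σ * slope e →
    (Σ Carrier λ c → IsFq c × e′ ≡ c * e) ⊎ (IsFq (norm₂ e) × IsFq (norm₂ e′))
  slope-injective {e} {e′} {σ} e∉ e′∉ σ∈ eq = go (β′ ≟ 0#) (β ≟ 0#)
    where
    open Slope (slope-affine e∉)
    open Slope (slope-affine e′∉) renaming (α to α′; β to β′; α∈ to α′∈; β∈ to β′∈; affine to affine′; special to special′)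
    affines : α′ + β′ * F e′ ≡ σ * (α + β * F e)
    affines = trans (sym affine′) (trans eq (cong (σ *_) affine))
    σ≢0 : σ ≢ 0#
    σ≢0 z = slope≢0 e′∉ (trans eq (trans (cong (_* slope e) z) (zeroˡ _)))
    affine-in-e : β′ ≢ 0# → Σ Carrier λ c₀ → Σ Carrier λ c₁ → IsFq c₀ × IsFq c₁ × e′ ≡ c₀ + c₁ * e
    affine-in-e β′≢0 = c₀ , c₁ , c₀∈ , c₁∈ , F-injective (*-cancelˡ β′≢0 (begin
      β′ * F e′                             ≡⟨ solve 3 (λ a b e → b :* e := (a :+ b :* e) :- a) refl α′ β′ (F e′) ⟩
      (α′ + β′ * F e′) - α′                 ≡⟨ cong (_- α′) affines ⟩
      σ * (α + β * F e) - α′                ≡⟨ solve 5 (λ s a b e a′ → s :* (a :+ b :* e) :- a′ := (s :* a :- a′) :+ s :* b :* e) refl σ α β (F e) α′ ⟩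
      (σ * α - α′) + σ * β * F e            ≡⟨ sym (cong₂ (λ u v → u + v * F e) (⁻¹-cancelʳ _ β′≢0) (⁻¹-cancelʳ _ β′≢0)) ⟩
      β′ * c₀ + β′ * c₁ * F e               ≡⟨ solve 4 (λ b c d e → b :* c :+ b :* d :* e := b :* (c :+ d :* e)) refl β′ c₀ c₁ (F e) ⟩
      β′ * (c₀ + c₁ * F e)                  ≡⟨ cong (β′ *_) (sym (trans (F-+ _ _) (cong₂ _+_ c₀∈ (trans (F-* _ _) (cong (_* F e) c₁∈))))) ⟩
      β′ * F (c₀ + c₁ * e)                  ∎))
      where
      c₀ = β′ ⁻¹ * (σ * α - α′)
      c₁ = β′ ⁻¹ * (σ * β)
      c₀∈ : IsFq c₀
      c₀∈ = Fq-* (Fq-⁻¹ β′≢0 β′∈) (Fq-minus (Fq-* σ∈ α∈) α′∈)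
      c₁∈ : IsFq c₁
      c₁∈ = Fq-* (Fq-⁻¹ β′≢0 β′∈) (Fq-* σ∈ β∈)
    proportional : ∀ {c₀ c₁} → IsFq c₀ → IsFq c₁ → e′ ≡ c₀ + c₁ * e → e′ ≡ c₁ * e
    proportional {c₀} {c₁} c₀∈ c₁∈ e′≡ = trans e′≡ (trans (cong (_+ c₁ * e) c₀≡0) (+-identityˡ _))
      where
      F-affine : ∀ z → F (c₀ + c₁ * z) ≡ c₀ + c₁ * F z
      F-affine z = trans (F-+ _ _) (cong₂ _+_ c₀∈ (trans (F-* _ _) (cong (_* F z) c₁∈)))
      e′₂ : F (F e′) ≡ c₀ + c₁ * F (F e)
      e′₂ = trans (cong (λ z → F (F z)) e′≡) (trans (cong F (F-affine e)) (F-affine _))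
      e′₃ : F (F (F e′)) ≡ c₀ + c₁ * F (F (F e))
      e′₃ = trans (cong F e′₂) (F-affine _)
      Δ′ : Δ e′ ≡ c₁ * Δ e
      Δ′ = trans (cong₂ _-_ e′₃ e′₂) (solve 4 (λ a b x y → (a :+ b :* x) :- (a :+ b :* y) := b :* (x :- y)) refl c₀ c₁ _ _)
      denominator′ : denominator e′ ≡ c₁ * c₁ * denominator e
      denominator′ = trans (cong₂ (λ u v → κ * u * v) Δ′ (trans (cong F Δ′) (trans (F-* _ _) (cong (_* F (Δ e)) c₁∈))))
        (solve 4 (λ c k u v → k :* (c :* u) :* (c :* v) := c :* c :* (k :* u :* v)) refl c₁ κ _ _)
      -- Evaluating `denominator e′ * slope e′` in two ways gives `c₁² σ e_3 = c₀ + c₁ e_3` with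
      -- `e_3 = e^{q³}`, i.e. `t e_3 = c₀`. As `e_3` is not in F_q, `t` must vanish, and `c₀` with
      -- it.
      t = c₁ * c₁ * σ - c₁
      t∈ : IsFq t
      t∈ = Fq-minus (Fq-* (Fq-* c₁∈ c₁∈) σ∈) c₁∈
      t*e₃≡c₀ : t * F (F (F e)) ≡ c₀
      t*e₃≡c₀ = begin
        t * F (F (F e))                 ≡⟨ solve 3 (λ c s x → (c :* c :* s :- c) :* x := c :* c :* (s :* x) :- c :* x) refl c₁ σ _ ⟩
        c₁ * c₁ * (σ * F (F (F e))) - c₁ * F (F (F e))    ≡⟨ cong (λ z → c₁ * c₁ * (σ * z) - c₁ * F (F (F e))) (sym (slope-denominator e∉)) ⟩
        c₁ * c₁ * (σ * (denominator e * slope e)) - c₁ * F (F (F e))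
          ≡⟨ solve 5 (λ c s d l x → c :* c :* (s :* (d :* l)) :- c :* x := c :* c :* d :* (s :* l) :- c :* x) refl c₁ σ _ _ _ ⟩
        c₁ * c₁ * denominator e * (σ * slope e) - c₁ * F (F (F e))
          ≡⟨ cong₂ (λ u v → u * v - c₁ * F (F (F e))) (sym denominator′) (sym eq) ⟩
        denominator e′ * slope e′ - c₁ * F (F (F e))      ≡⟨ cong (_- c₁ * F (F (F e))) (trans (slope-denominator e′∉) e′₃) ⟩
        c₀ + c₁ * F (F (F e)) - c₁ * F (F (F e))          ≡⟨ solve 2 (λ c x → c :+ x :- x := c) refl c₀ _ ⟩
        c₀                                                ∎
      c₀≡0 : c₀ ≡ 0#
      c₀≡0 = c₀-zero (t ≟ 0#)
        where
        c₀-zero : Dec (t ≡ 0#) → c₀ ≡ 0#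
        c₀-zero (yes z) = trans (sym t*e₃≡c₀) (trans (cong (_* F (F (F e))) z) (zeroˡ _))
        c₀-zero (no t≢0) = ⊥-elim (e∉ (F-injective (F-injective (F-injective
          (subst IsFq (trans (cong (t ⁻¹ *_) (sym t*e₃≡c₀)) (⁻¹-cancelˡ _ t≢0)) (Fq-* (Fq-⁻¹ t≢0 t∈) c₀∈))))))
    go : Dec (β′ ≡ 0#) → Dec (β ≡ 0#) →
      (Σ Carrier λ c → IsFq c × e′ ≡ c * e) ⊎ (IsFq (norm₂ e) × IsFq (norm₂ e′))
    go (no β′≢0) _ = let c₀ , c₁ , c₀∈ , c₁∈ , e′≡ = affine-in-e β′≢0 in inj₁ (c₁ , c₁∈ , proportional c₀∈ c₁∈ e′≡)
    go (yes z′) (yes z) = inj₂ (special z , special′ z′)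
    go (yes z′) (no β≢0) = ⊥-elim (e∉ (F-injective (subst IsFq e₁≡
        (Fq-* (Fq-⁻¹ (*-≢0 σ≢0 β≢0) (Fq-* σ∈ β∈)) (Fq-minus α′∈ (Fq-* σ∈ α∈))))))
      where
      e₁≡ : (σ * β) ⁻¹ * (α′ - σ * α) ≡ F e
      e₁≡ = trans (cong ((σ * β) ⁻¹ *_) (begin
        α′ - σ * α                          ≡⟨ cong (_- σ * α) (sym (trans (cong (λ z → α′ + z * F e′) z′) (trans (cong (α′ +_) (zeroˡ _)) (+-identityʳ α′)))) ⟩
        α′ + β′ * F e′ - σ * α              ≡⟨ cong (_- σ * α) affines ⟩
        σ * (α + β * F e) - σ * α           ≡⟨ solve 4 (λ s a b e → s :* (a :+ b :* e) :- s :* a := s :* b :* e) refl σ α β (F e) ⟩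
        σ * β * F e                         ∎)) (⁻¹-cancelˡ _ (*-≢0 σ≢0 β≢0))

  -- The new planes

  plane : Carrier → Carrier → Subset
  plane s e (x , y) = inW x ∧ ((Tr (e * x) == 0#) ∧ (φ (s * y) == slope e * F x))

  module _ {s e x y} (m : plane s e ∋ (x , y)) where
    plane-W : Tr x ≡ 0#
    plane-W = ==⇒≡ (∧-left m)
    plane-Z : Tr (e * x) ≡ 0#
    plane-Z = ==⇒≡ (∧-left (∧-right {a = inW x} m))
    plane-φ : φ (s * y) ≡ slope e * F x
    plane-φ = ==⇒≡ (∧-right {a = Tr (e * x) == 0#} (∧-right {a = inW x} m))

  plane-intro : ∀ {s e x y} → Tr x ≡ 0# → Tr (e * x) ≡ 0# → φ (s * y) ≡ slope e * F x → plane s e ∋ (x , y)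
  plane-intro a b c = ∧-intro (≡⇒== a) (∧-intro (≡⇒== b) (≡⇒== c))

  φ-+ : ∀ x y → φ (x + y) ≡ φ x + φ y
  φ-+ x y = trans (cong (λ z → (x + y) - z) (F-+ x y))
    (solve 4 (λ x y a b → (x :+ y) :- (a :+ b) := (x :- a) :+ (y :- b)) refl x y _ _)

  φ-* : ∀ {c} x → IsFq c → φ (c * x) ≡ c * φ x
  φ-* {c} x c∈ = trans (cong (λ z → c * x - z) (trans (F-* c x) (cong (_* F x) c∈)))
    (solve 3 (λ c x a → c :* x :- c :* a := c :* (x :- a)) refl c x (F x))

  φ≡0⇒Fq : ∀ {x} → φ x ≡ 0# → IsFq x
  φ≡0⇒Fq z = sym (x-y≡0⇒x≡y z)

  Fq⇒φ≡0 : ∀ {x} → IsFq x → φ x ≡ 0#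
  Fq⇒φ≡0 x∈ = x≡y⇒x-y≡0 (sym x∈)

  plane-point : ∀ {s e y} → IsFq (s * y) → plane s e ∋ (0# , y)
  plane-point {s} {e} sy∈ = plane-intro Tr-0 (trans (cong Tr (zeroʳ e)) Tr-0)
    (trans (Fq⇒φ≡0 sy∈) (sym (trans (cong (slope e *_) F-0) (zeroʳ _))))

  plane-point⁻ : ∀ {s e y} → plane s e ∋ (0# , y) → IsFq (s * y)
  plane-point⁻ {s} {e} m = φ≡0⇒Fq (trans (plane-φ {s} {e} m) (trans (cong (slope e *_) F-0) (zeroʳ _)))

  plane-subspace : ∀ s e → IsSubspace (plane s e)
  plane-subspace s e = record
    { inV = λ x y m → plane-W {s} {e} m
    ; zero∈ = plane-point {s} {e} (subst IsFq (sym (zeroʳ s)) Fq-0)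
    ; +-closed = λ (x , y) (x′ , y′) v∈ w∈ →
        let tr , tr′ = has-+ (Kernel-subspace e W-subspace) (plane-W {s} {e} v∈ , plane-Z {s} {e} v∈) (plane-W {s} {e} w∈ , plane-Z {s} {e} w∈) in
        plane-intro {s} {e} tr tr′ (begin
          φ (s * (y + y′))                  ≡⟨ trans (cong φ (distribˡ s y y′)) (φ-+ _ _) ⟩
          φ (s * y) + φ (s * y′)            ≡⟨ cong₂ _+_ (plane-φ {s} {e} v∈) (plane-φ {s} {e} w∈) ⟩
          slope e * F x + slope e * F x′    ≡⟨ sym (trans (cong (slope e *_) (F-+ x x′)) (distribˡ _ _ _)) ⟩
          slope e * F (x + x′)              ∎)
    ; ·-closed = λ c (x , y) c∈ v∈ →
        let tr , tr′ = has-* (Kernel-subspace e W-subspace) c∈ (plane-W {s} {e} v∈ , plane-Z {s} {e} v∈) in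
        plane-intro {s} {e} tr tr′ (begin
          φ (s * (c * y))                   ≡⟨ trans (cong φ (solve 3 (λ s c y → s :* (c :* y) := c :* (s :* y)) refl s c y)) (φ-* _ c∈) ⟩
          c * φ (s * y)                     ≡⟨ cong (c *_) (plane-φ {s} {e} v∈) ⟩
          c * (slope e * F x)               ≡⟨ solve 3 (λ c l x → c :* (l :* x) := l :* (c :* x)) refl c _ _ ⟩
          slope e * (c * F x)               ≡⟨ cong (slope e *_) (sym (trans (F-* c x) (cong (_* F x) c∈))) ⟩
          slope e * F (c * x)               ∎)
    }

  module _ {s e} (s≢0 : s ≢ 0#) (e∉ : ¬ IsFq e) where

    plane-lift : ∀ {x} → Kernel W e x → Σ Carrier λ y → plane s e ∋ (x , y)
    plane-lift {x} (tr , tr′) = s ⁻¹ * proj₁ preimage ,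
      plane-intro {s} {e} tr tr′ (trans (cong φ (⁻¹-cancelʳ _ s≢0)) (proj₂ preimage))
      where
      open Slope (slope-affine e∉)
      preimage : Σ Carrier λ w → φ w ≡ slope e * F x
      preimage = hilbert90 (begin
        Tr (slope e * F x)                ≡⟨ cong (λ z → Tr (z * F x)) affine ⟩
        Tr ((α + β * F e) * F x)          ≡⟨ cong Tr (solve 4 (λ a b e x → (a :+ b :* e) :* x := a :* x :+ b :* (e :* x)) refl α β _ _) ⟩
        Tr (α * F x + β * (F e * F x))    ≡⟨ trans (Tr-+ _ _) (cong₂ _+_ (Tr-* α∈ _) (Tr-* β∈ _)) ⟩
        α * Tr (F x) + β * Tr (F e * F x) ≡⟨ cong₂ (λ u v → α * u + β * v) (trans (Tr-F x) tr)
                                               (trans (cong Tr (sym (F-* e x))) (trans (Tr-F _) tr′)) ⟩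
        α * 0# + β * 0#                   ≡⟨ trans (cong₂ _+_ (zeroʳ α) (zeroʳ β)) (+-identityˡ 0#) ⟩
        0#                                ∎)

    plane∩S : HasDim (plane s e ∩ S) 1
    plane∩S = HasDim-1 {v = 0# , s ⁻¹} (λ z → ⁻¹-≢0 s≢0 (cong proj₂ z))
      (∧-intro (plane-point {s} {e} (subst IsFq (sym (*-inverseʳ s≢0)) Fq-1)) (≡⇒== refl))
      λ (x , y) m → let x≡0 = ==⇒≡ (∧-right {a = plane s e (x , y)} m) in
        s * y , plane-point⁻ {s} {e} (subst (λ z → plane s e ∋ (z , y)) x≡0 (∧-left m)) ,
        cong₂ _,_ (trans (zeroʳ _) (sym x≡0))
          (trans (*-comm _ _) (⁻¹-cancelˡ y s≢0))

    plane-plane : IsPlane (plane s e)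
    plane-plane = plane-subspace s e , HasDim-by-projection 2 (plane-subspace s e) (Kernel-subspace e W-subspace)
      W-kernel? W-kernel
      (let a , a∈ , a-dual = dual-in-W e∉ in kernel-count-power {m = 2} W-subspace a∈ a-dual trace-zeros-enumerate W-kernel |trace-zeros|)
      (λ m → plane-W {s} {e} m , plane-Z {s} {e} m) plane-lift plane∩S
      where
      W-kernel? : Decidable (Kernel W e)
      W-kernel? = Kernel? e (λ x → Tr x ≟ 0#)
      W-kernel : Enumerates (Kernel W e) (filter W-kernel? elems)
      W-kernel = filter-elems W-kernel?

    -- Σᵢ xᵢ = Σᵢ eᵢ xᵢ = 0 with x₃ eliminated: a q-polynomial of q-degree 2 whose zeros include {1, e}^⊥.
    kernel-relation : ∀ {x} → Tr x ≡ 0# → Tr (e * x) ≡ 0# →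
      (e - F (F (F e))) * x + (F e - F (F (F e))) * F x + (F (F e) - F (F (F e))) * F (F x) ≡ 0#
    kernel-relation {x} tr tr′ = begin
      (e - F (F (F e))) * x + (F e - F (F (F e))) * F x + (F (F e) - F (F (F e))) * F (F x)
        ≡⟨ solve 8 (λ e₀ e₁ e₂ e₃ x₀ x₁ x₂ x₃ → (e₀ :- e₃) :* x₀ :+ (e₁ :- e₃) :* x₁ :+ (e₂ :- e₃) :* x₂
             := (e₀ :* x₀ :+ e₁ :* x₁ :+ e₂ :* x₂ :+ e₃ :* x₃) :- e₃ :* (x₀ :+ x₁ :+ x₂ :+ x₃))
             refl e (F e) (F (F e)) (F (F (F e))) x (F x) (F (F x)) (F (F (F x))) ⟩
      (e * x + F e * F x + F (F e) * F (F x) + F (F (F e)) * F (F (F x))) - F (F (F e)) * (x + F x + F (F x) + F (F (F x)))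
        ≡⟨ cong₂ (λ u v → u - F (F (F e)) * v) (trans (sym Tr-e*x) tr′) (trans (sym (Tr≡ x)) tr) ⟩
      0# - F (F (F e)) * 0#
        ≡⟨ trans (cong (λ z → 0# - z) (zeroʳ _)) (-‿inverseʳ 0#) ⟩
      0# ∎
      where
      FF* : F (F (e * x)) ≡ F (F e) * F (F x)
      FF* = trans (cong F (F-* e x)) (F-* _ _)
      Tr-e*x : Tr (e * x) ≡ e * x + F e * F x + F (F e) * F (F x) + F (F (F e)) * F (F (F x))
      Tr-e*x = trans (Tr≡ _) (cong₂ _+_ (cong₂ _+_ (cong (e * x +_) (F-* e x)) FF*) (trans (cong F FF*) (F-* _ _)))

    module _ {a₀ a₁ x y x′ y′} (v∈ : plane s e ∋ (x , y)) (w∈ : plane s e ∋ (x′ , y′))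
      (v∈Γ : Γ a₀ a₁ ∋ (x , y)) (w∈Γ : Γ a₀ a₁ ∋ (x′ , y′)) (ind : Independent x x′) where
      private
        A₀ A₁ e₁ e₂ e₃ D D₁ u : Carrier
        A₀ = s * a₀
        A₁ = s * a₁
        e₁ = F e
        e₂ = F (F e)
        e₃ = F (F (F e))
        D = Δ e
        D₁ = F (Δ e)
        u = κ * D * A₁

        reduced : ∀ {x y} → plane s e ∋ (x , y) → Γ a₀ a₁ ∋ (x , y) →
          (D * A₀ - F A₁ * D₁) * x + (D * (A₁ - F A₀ - slope e) - F A₁ * (e₁ - e₃)) * F x ≡ 0#
        reduced {x} {y} m mΓ = begin
          (D * A₀ - F A₁ * D₁) * x + (D * (A₁ - F A₀ - slope e) - F A₁ * (e₁ - e₃)) * F x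
            ≡⟨ cong (λ z → (D * A₀ - F A₁ * z) * x + (D * (A₁ - F A₀ - slope e) - F A₁ * (e₁ - e₃)) * F x) (F-Δ e) ⟩
          (D * A₀ - F A₁ * (e - e₃)) * x + (D * (A₁ - F A₀ - slope e) - F A₁ * (e₁ - e₃)) * F x
            ≡⟨ solve 12 (λ a b a′ b′ g e₀ e₁ e₂ e₃ x₀ x₁ x₂ →
                 ((e₃ :- e₂) :* a :- b′ :* (e₀ :- e₃)) :* x₀ :+ ((e₃ :- e₂) :* (b :- a′ :- g) :- b′ :* (e₁ :- e₃)) :* x₁
                 := (e₃ :- e₂) :* ((a :* x₀ :+ b :* x₁) :- (a′ :* x₁ :+ b′ :* x₂) :- g :* x₁)
                    :- b′ :* ((e₀ :- e₃) :* x₀ :+ (e₁ :- e₃) :* x₁ :+ (e₂ :- e₃) :* x₂))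
                 refl A₀ A₁ (F A₀) (F A₁) (slope e) e e₁ e₂ e₃ x (F x) (F (F x)) ⟩
          D * ((A₀ * x + A₁ * F x) - (F A₀ * F x + F A₁ * F (F x)) - slope e * F x)
            - F A₁ * ((e - e₃) * x + (e₁ - e₃) * F x + (e₂ - e₃) * F (F x))
            ≡⟨ cong₂ (λ z w → D * z - F A₁ * w) (x≡y⇒x-y≡0 (trans (sym φ-value) (plane-φ {s} {e} m)))
                 (kernel-relation (plane-W {s} {e} m) (plane-Z {s} {e} m)) ⟩
          D * 0# - F A₁ * 0#    ≡⟨ trans (cong₂ _-_ (zeroʳ _) (zeroʳ _)) (-‿inverseʳ 0#) ⟩
          0#                    ∎
          where
          s*y : s * y ≡ A₀ * x + A₁ * F x
          s*y = trans (cong (s *_) (Γ-value mΓ))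
            (solve 5 (λ s a b x u → s :* (a :* x :+ b :* u) := s :* a :* x :+ s :* b :* u) refl s a₀ a₁ x (F x))
          φ-value : φ (s * y) ≡ (A₀ * x + A₁ * F x) - (F A₀ * F x + F A₁ * F (F x))
          φ-value = trans (cong φ s*y) (cong (λ z → (A₀ * x + A₁ * F x) - z) (trans (F-+ _ _) (cong₂ _+_ (F-* _ _) (F-* _ _))))

        coefficients : D * A₀ - F A₁ * D₁ ≡ 0# × D * (A₁ - F A₀ - slope e) - F A₁ * (e₁ - e₃) ≡ 0#
        coefficients = cramer ind (reduced v∈ v∈Γ) (reduced w∈ w∈Γ)

        F-u : F u ≡ - (κ * D₁ * F A₁)
        F-u = trans (F-* _ _) (trans (cong (_* F A₁) (trans (F-* κ D) (cong (_* D₁) F-κ)))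
          (solve 3 (λ k d a → (:- k) :* d :* a := :- (k :* d :* a)) refl κ D₁ (F A₁)))

        κDA₀ : κ * D * A₀ ≡ - F u
        κDA₀ = begin
          κ * D * A₀          ≡⟨ *-assoc _ _ _ ⟩
          κ * (D * A₀)        ≡⟨ cong (κ *_) (x-y≡0⇒x≡y (proj₁ coefficients)) ⟩
          κ * (F A₁ * D₁)     ≡⟨ solve 3 (λ k d a → k :* (a :* d) := :- (:- (k :* d :* a))) refl κ D₁ (F A₁) ⟩
          - - (κ * D₁ * F A₁) ≡⟨ cong -_ (sym F-u) ⟩
          - F u               ∎

        FFu : F (F u) ≡ κ * D₁ * F A₀
        FFu = begin
          F (F u)             ≡⟨ sym (-‿involutive _) ⟩
          - - F (F u)         ≡⟨ cong -_ (trans (sym (F-neg (F u))) (trans (cong F (sym κDA₀)) (trans (F-* _ _) (cong (_* F A₀) (trans (F-* κ D) (cong (_* D₁) F-κ)))))) ⟩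
          - (- κ * D₁ * F A₀) ≡⟨ solve 3 (λ k d a → :- ((:- k) :* d :* a) := k :* d :* a) refl κ D₁ (F A₀) ⟩
          κ * D₁ * F A₀       ∎

        trace-relation : Tr (e * u) - e₃ * Tr u ≡ e₃
        trace-relation = x-y≡0⇒x≡y (begin
          Tr (e * u) - e₃ * Tr u - e₃
            ≡⟨ cong₂ (λ a b → a - e₃ * b - e₃) Tr-e*u (Tr≡ u) ⟩
          (e * u + e₁ * F u + e₂ * F (F u) + e₃ * F (F (F u))) - e₃ * (u + F u + F (F u) + F (F (F u))) - e₃
            ≡⟨ solve 8 (λ e₀ e₁ e₂ e₃ u₀ u₁ u₂ u₃ → (e₀ :* u₀ :+ e₁ :* u₁ :+ e₂ :* u₂ :+ e₃ :* u₃) :- e₃ :* (u₀ :+ u₁ :+ u₂ :+ u₃) :- e₃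
                 := (e₀ :- e₃) :* u₀ :- (e₃ :- e₂) :* u₂ :+ u₁ :* (e₁ :- e₃) :- e₃) refl e e₁ e₂ e₃ u (F u) (F (F u)) (F (F (F u))) ⟩
          (e - e₃) * u - D * F (F u) + F u * (e₁ - e₃) - e₃
            ≡⟨ cong₂ (λ a b → a * u - D * F (F u) + F u * (e₁ - e₃) - b) (sym (F-Δ e)) (sym (slope-denominator e∉)) ⟩
          D₁ * u - D * F (F u) + F u * (e₁ - e₃) - denominator e * slope e
            ≡⟨ cong₂ (λ a b → D₁ * u - D * a + b * (e₁ - e₃) - denominator e * slope e) FFu F-u ⟩
          D₁ * (κ * D * A₁) - D * (κ * D₁ * F A₀) + - (κ * D₁ * F A₁) * (e₁ - e₃) - κ * D * D₁ * slope e
            ≡⟨ solve 9 (λ k d d₁ a a′ b b₁ g c → d₁ :* (k :* d :* b) :- d :* (k :* d₁ :* a′) :+ (:- (k :* d₁ :* b₁)) :* c :- k :* d :* d₁ :* g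
                 := k :* d₁ :* (d :* (b :- a′ :- g) :- b₁ :* c)) refl κ D D₁ A₀ (F A₀) A₁ (F A₁) (slope e) (e₁ - e₃) ⟩
          κ * D₁ * (D * (A₁ - F A₀ - slope e) - F A₁ * (e₁ - e₃))
            ≡⟨ trans (cong (κ * D₁ *_) (proj₂ coefficients)) (zeroʳ _) ⟩
          0# ∎)
          where
          FF* : F (F (e * u)) ≡ e₂ * F (F u)
          FF* = trans (cong F (F-* e u)) (F-* _ _)
          Tr-e*u : Tr (e * u) ≡ e * u + e₁ * F u + e₂ * F (F u) + e₃ * F (F (F u))
          Tr-e*u = trans (Tr≡ _) (cong₂ _+_ (cong₂ _+_ (cong (e * u +_) (F-* e u)) FF*) (trans (cong F FF*) (F-* _ _)))

        Tr-u≢0 : Tr u ≢ 0#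
        Tr-u≢0 z = e∉ (F-injective (F-injective (F-injective (subst IsFq
          (trans (sym (trans (cong (λ w → Tr (e * u) - e₃ * w) z) (solve 2 (λ a b → a :- b :* con (ℤ.+ 0) := a) refl _ _))) trace-relation)
          (Tr-Fq (e * u))))))

      transversal⇒removed : removed (a₀ , a₁) ≡ true
      transversal⇒removed = removed-intro {_} {(κ * D * s) ⁻¹} {u}
        ( ⁻¹-≢0 κDs≢0 , Tr-u≢0
        , sym (trans (cong (λ z → - ((κ * D * s) ⁻¹ * z)) F-u≡) (trans (cong -_ (sym (-‿distribʳ-* _ _))) (trans (-‿involutive _) (trans (cong ((κ * D * s) ⁻¹ *_) (sym (*-assoc _ s a₀))) (⁻¹-cancelˡ a₀ κDs≢0)))))
        , sym (trans (cong ((κ * D * s) ⁻¹ *_) (sym (*-assoc _ s a₁))) (⁻¹-cancelˡ a₁ κDs≢0)))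
        where
        κDs≢0 : κ * D * s ≢ 0#
        κDs≢0 = *-≢0 (*-≢0 κ≢0 (Δ≢0 e∉)) s≢0
        F-u≡ : F u ≡ - (κ * D * (s * a₀))
        F-u≡ = trans (sym (-‿involutive _)) (cong -_ (sym κDA₀))

  plane∩Γ : ∀ {s e a₀ a₁} → s ≢ 0# → ¬ IsFq e → removed (a₀ , a₁) ≢ true → DimAtMost (Γ a₀ a₁ ∩ plane s e) 1
  plane∩Γ {s} {e} {a₀} {a₁} s≢0 e∉ kept = dim-≤1-graph (λ v m → ∧-left m) λ {x} {y} {x′} {y′} v∈ w∈ ind →
    kept (transversal⇒removed s≢0 e∉ (∧-right {a = Γ a₀ a₁ (x , y)} v∈) (∧-right {a = Γ a₀ a₁ (x′ , y′)} w∈)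
      (∧-left v∈) (∧-left w∈) ind)

  -- Holds between the chosen e: one per class modulo F_q^×, and at most one with e^{q²+1} ∈ F_q.
  Compatible : Carrier → Carrier → Set
  Compatible e e′ = (∀ {c} → IsFq c → e′ ≡ c * e → e ≡ e′) × (IsFq (norm₂ e) → IsFq (norm₂ e′) → e ≡ e′)

  module _ {s e s′ e′} (s≢0 : s ≢ 0#) (e∉ : ¬ IsFq e) (s′≢0 : s′ ≢ 0#) (e′∉ : ¬ IsFq e′)
    (compatible : Compatible e e′) (distinct : (s , e) ≢ (s′ , e′)) where
    private
      σ : Carrier
      σ = s′ * s ⁻¹

      σ*s : ∀ y → s′ * y ≡ σ * (s * y)
      σ*s y = sym (trans (solve 4 (λ s s′ i y → s′ :* i :* (s :* y) := s′ :* (i :* (s :* y))) refl s s′ (s ⁻¹) y) (cong (s′ *_) (⁻¹-cancelˡ y s≢0)))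

      U : Subset
      U = plane s e ∩ plane s′ e′

      left : ∀ {x y} → U ∋ (x , y) → plane s e ∋ (x , y)
      left = ∧-left

      right : ∀ {x y} → U ∋ (x , y) → plane s′ e′ ∋ (x , y)
      right {x} {y} = ∧-right {a = plane s e (x , y)}

      U-subspace : IsSubspace U
      U-subspace = record
        { inV = λ x y m → plane-W {s} {e} (left m)
        ; zero∈ = ∧-intro (IsSubspace.zero∈ (plane-subspace s e)) (IsSubspace.zero∈ (plane-subspace s′ e′))
        ; +-closed = λ v w v∈ w∈ → ∧-intro (IsSubspace.+-closed (plane-subspace s e) v w (left v∈) (left w∈))
            (IsSubspace.+-closed (plane-subspace s′ e′) v w (right v∈) (right w∈))
        ; ·-closed = λ c v c∈ v∈ → ∧-intro (IsSubspace.·-closed (plane-subspace s e) c v c∈ (left v∈))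
            (IsSubspace.·-closed (plane-subspace s′ e′) c v c∈ (right v∈)) }

      slopes-not-proportional : IsFq σ → slope e′ ≢ σ * slope e
      slopes-not-proportional σ∈ eq = distinct (cong₂ _,_ s≡s′ e≡e′)
        where
        same : (Σ Carrier λ c → IsFq c × e′ ≡ c * e) ⊎ (IsFq (norm₂ e) × IsFq (norm₂ e′)) → e ≡ e′
        same (inj₁ (c , c∈ , p)) = proj₁ compatible c∈ p
        same (inj₂ (n∈ , n′∈)) = proj₂ compatible n∈ n′∈
        e≡e′ : e ≡ e′
        e≡e′ = same (slope-injective e∉ e′∉ σ∈ eq)
        s≡s′ : s ≡ s′
        s≡s′ = begin
          s               ≡⟨ sym (*-identityˡ s) ⟩
          1# * s          ≡⟨ cong (_* s) (*-cancelˡ (slope≢0 e∉) (trans (*-identityʳ _) (trans (cong slope e≡e′) (trans eq (*-comm _ _))))) ⟩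
          s′ * s ⁻¹ * s   ≡⟨ trans (*-assoc _ _ _) (trans (cong (s′ *_) (*-inverseˡ s≢0)) (*-identityʳ s′)) ⟩
          s′              ∎

      σ∉Fq : ∀ {x y} → x ≢ 0# → U ∋ (x , y) → ¬ IsFq σ
      σ∉Fq {x} {y} x≢0 m σ∈ = slopes-not-proportional σ∈ (*-cancelˡ (F-≢0 x≢0) (begin
        F x * slope e′        ≡⟨ *-comm _ _ ⟩
        slope e′ * F x        ≡⟨ sym (plane-φ {s′} {e′} (right m)) ⟩
        φ (s′ * y)            ≡⟨ trans (cong φ (σ*s y)) (φ-* _ σ∈) ⟩
        σ * φ (s * y)         ≡⟨ cong (σ *_) (plane-φ {s} {e} (left m)) ⟩
        σ * (slope e * F x)   ≡⟨ solve 3 (λ a b x → a :* (b :* x) := x :* (a :* b)) refl σ _ _ ⟩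
        F x * (σ * slope e)   ∎))

      not-independent : ∀ {x y x′ y′} → U ∋ (x , y) → U ∋ (x′ , y′) → ¬ Independent x x′
      not-independent {x} {y} {x′} {y′} v∈ w∈ ind = slope≢0 e∉ (begin
        slope e                   ≡⟨ solve 2 (λ a t → a := :- (t :- a) :+ t) refl (slope e) τ ⟩
        - (τ - slope e) + τ       ≡⟨ cong₂ (λ a b → - a + b) (proj₁ zeros) τ≡0 ⟩
        - 0# + 0#                 ≡⟨ -‿inverseˡ 0# ⟩
        0#                        ∎)
        where
        λ≢0 : σ - F σ ≢ 0#
        λ≢0 z = σ∉Fq (Independent⇒≢0 ind) v∈ (φ≡0⇒Fq z)
        τ : Carrier
        τ = (σ - F σ) ⁻¹ * (slope e′ - F σ * slope e)
        linear : ∀ {x y} → U ∋ (x , y) → s * y ≡ τ * F x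
        linear {x} {y} m = *-cancelˡ λ≢0 (begin
          (σ - F σ) * (s * y)
            ≡⟨ solve 4 (λ a a₁ v v₁ → (a :- a₁) :* v := (a :* v :- a₁ :* v₁) :- a₁ :* (v :- v₁)) refl σ (F σ) (s * y) (F (s * y)) ⟩
          (σ * (s * y) - F σ * F (s * y)) - F σ * φ (s * y)
            ≡⟨ cong₂ (λ a b → a - F σ * b) (trans (cong (λ z → σ * (s * y) - z) (sym (F-* _ _))) (trans (cong φ (sym (σ*s y))) (plane-φ {s′} {e′} (right m)))) (plane-φ {s} {e} (left m)) ⟩
          slope e′ * F x - F σ * (slope e * F x)
            ≡⟨ solve 4 (λ a b c x → a :* x :- b :* (c :* x) := (a :- b :* c) :* x) refl _ _ _ _ ⟩
          (slope e′ - F σ * slope e) * F x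
            ≡⟨ cong (_* F x) (sym (⁻¹-cancelʳ _ λ≢0)) ⟩
          (σ - F σ) * τ * F x
            ≡⟨ *-assoc _ _ _ ⟩
          (σ - F σ) * (τ * F x) ∎)
        vanish : ∀ {x y} → U ∋ (x , y) → (τ - slope e) * F x + - F τ * F (F x) ≡ 0#
        vanish {x} {y} m = begin
          (τ - slope e) * F x + - F τ * F (F x)
            ≡⟨ solve 5 (λ t g t₁ x₁ x₂ → (t :- g) :* x₁ :+ (:- t₁) :* x₂ := (t :* x₁ :- t₁ :* x₂) :- g :* x₁) refl τ (slope e) (F τ) (F x) (F (F x)) ⟩
          (τ * F x - F τ * F (F x)) - slope e * F x
            ≡⟨ x≡y⇒x-y≡0 (trans (cong (λ z → τ * F x - z) (sym (F-* _ _))) (trans (cong φ (sym (linear m))) (plane-φ {s} {e} (left m)))) ⟩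
          0# ∎
        zeros : τ - slope e ≡ 0# × - F τ ≡ 0#
        zeros = cramer (Independent-F ind) (vanish v∈) (vanish w∈)
        τ≡0 : τ ≡ 0#
        τ≡0 = F-injective (trans (trans (sym (-‿involutive _)) (trans (cong -_ (proj₂ zeros)) -0#≈0#)) (sym F-0))

      -- A common point of S makes s′/s an element of F_q.
      S-or-transversal : ∀ {x y z} → x ≢ 0# → U ∋ (x , y) → U ∋ (0# , z) → z ≡ 0#
      S-or-transversal {x} {y} {z} x≢0 m mz with z ≟ 0#
      ... | yes p = p
      ... | no z≢0 = ⊥-elim (σ∉Fq x≢0 m (subst IsFq
              (*-cancelˡ (*-≢0 s≢0 z≢0) (trans (⁻¹-cancelʳ _ (*-≢0 s≢0 z≢0)) (trans (σ*s z) (*-comm _ _))))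
              (Fq-* (Fq-⁻¹ (*-≢0 s≢0 z≢0) (plane-point⁻ {s} {e} (left mz))) (plane-point⁻ {s′} {e′} (right mz)))))

      common-multiple : ∀ {x y x′ y′} → Dec (x ≡ 0#) → Dec (x′ ≡ 0#) → (x , y) ≢ 0v → U ∋ (x , y) → U ∋ (x′ , y′) →
        Σ Carrier λ c → IsFq c × c · (x , y) ≡ (x′ , y′)
      common-multiple {x} {y} {x′} {y′} (no x≢0) _ v≢0 v∈ w∈ = case (multiple-or-independent x′ x≢0)
        where
        case : (Σ Carrier λ c → IsFq c × c * x ≡ x′) ⊎ Independent x x′ → Σ Carrier λ c → IsFq c × c · (x , y) ≡ (x′ , y′)
        case (inj₂ ind) = ⊥-elim (not-independent v∈ w∈ ind)
        case (inj₁ (c , c∈ , e)) = c , c∈ , cong₂ _,_ e (x-y≡0⇒x≡y (trans (solve 3 (λ c y y′ → c :* y :- y′ := :- (:- c :* y :+ y′)) refl c y y′)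
          (trans (cong -_ (S-or-transversal x≢0 v∈ difference)) -0#≈0#)))
          where
          difference : U ∋ (0# , - c * y + y′)
          difference = subst (λ t → U ∋ (t , - c * y + y′))
            (trans (cong (_+ x′) (trans (sym (-‿distribˡ-* c x)) (cong -_ e))) (-‿inverseˡ x′))
            (IsSubspace.+-closed U-subspace _ _ (IsSubspace.·-closed U-subspace _ _ (Fq-neg c∈) v∈) w∈)
      common-multiple {y = y} (yes refl) (no x′≢0) v≢0 v∈ w∈ = ⊥-elim (v≢0 (cong (0# ,_) (S-or-transversal x′≢0 w∈ v∈)))
      common-multiple {y = y} {y′ = y′} (yes refl) (yes refl) v≢0 v∈ w∈ =
        (s * y) ⁻¹ * (s * y′) , Fq-* (Fq-⁻¹ sy≢0 (plane-point⁻ {s} {e} (left v∈))) (plane-point⁻ {s} {e} (left w∈)) ,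
        cong₂ _,_ (zeroʳ _) (*-cancelˡ s≢0 (trans
          (solve 4 (λ s y i z → s :* (i :* z :* y) := i :* ((s :* y) :* z)) refl s y ((s * y) ⁻¹) (s * y′))
          (⁻¹-cancelˡ _ sy≢0)))
        where
        sy≢0 : s * y ≢ 0#
        sy≢0 = *-≢0 s≢0 (λ z → v≢0 (cong (0# ,_) z))

    plane∩plane : DimAtMost (plane s e ∩ plane s′ e′) 1
    plane∩plane = dim-≤1 λ (x , y) (x′ , y′) v≢0 v∈ w∈ → common-multiple (x ≟ 0#) (x′ ≟ 0#) v≢0 v∈ w∈

  q-1 : ℕ
  q-1 = ℕ.pred q

  q≡1+[q-1] : q ≡ suc q-1
  q≡1+[q-1] = sym (ℕ.suc-pred q)

  q-1>0 : 0 < q-1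
  q-1>0 = ℕ.s<s⁻¹ (subst (1 <_) q≡1+[q-1] 2≤q)

  |units|+1 : suc (length units) ≡ q ℕ.^ 4
  |units|+1 = trans (sym card-units) card≡

  |units|≡ : length units ≡ (q ℕ.+ 1) ℕ.* (q-1 ℕ.* suc (q ℕ.^ 2))
  |units|≡ = ℕ.suc-injective (trans |units|+1 (subst (λ q → q ℕ.^ 4 ≡ suc ((q ℕ.+ 1) ℕ.* (q-1 ℕ.* suc (q ℕ.^ 2)))) (sym q≡1+[q-1]) (identity q-1)))
    where
    identity : ∀ n → suc n ℕ.^ 4 ≡ suc ((suc n ℕ.+ 1) ℕ.* (n ℕ.* suc (suc n ℕ.^ 2)))
    identity = ℕS.solve 1 (λ n → (ℕS.con 1 ℕS.:+ n) ℕS.:^ 4 ℕS.:= ℕS.con 1 ℕS.:+ ((ℕS.con 1 ℕS.:+ n ℕS.:+ ℕS.con 1) ℕS.:* (n ℕS.:* (ℕS.con 1 ℕS.:+ (ℕS.con 1 ℕS.:+ n) ℕS.:^ 2)))) refl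

  fq-units : List Carrier
  fq-units = filter (λ x → ¬? (x ≟ 0#)) Fqs

  fq-units-enumerate : Enumerates (λ x → IsFq x × x ≢ 0#) fq-units
  fq-units-enumerate = filter-enumerates (λ x → ¬? (x ≟ 0#)) Fqs-enumerate

  |fq-units| : length fq-units ≡ q-1
  |fq-units| = ℕ.suc-injective (trans (sym (length-nonzero Fqs-enumerate Fq-0)) (trans |Fqs| q≡1+[q-1]))

  -- Each removed map is r (u x^q - u^q x) for a unique pair (r, u) with Tr u = 1.
  trace-ones : List Carrier
  trace-ones = filter (λ x → Tr x ≟ 1#) elems

  |trace-ones| : length trace-ones ≡ q ℕ.^ 3
  |trace-ones| = trans (enum-≡ (filter-elems (λ x → Tr x ≟ 1#)) trace-zeros-enumerate (_- a) (_+ a)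
      (λ e → trans (Tr-minus _ _) (x≡y⇒x-y≡0 (trans e (sym a-trace))))
      (λ e → trans (Tr-+ _ _) (trans (cong₂ _+_ e a-trace) (+-identityˡ 1#)))
      (λ _ _ → +-cancelʳ) (λ _ _ → +-cancelʳ)) |trace-zeros|
    where
    a = proj₁ (Tr-onto-Fq Fq-1)
    a-trace : Tr a ≡ 1#
    a-trace = proj₂ (Tr-onto-Fq Fq-1)

  removed-map : Carrier × Carrier → Carrier × Carrier
  removed-map (r , u) = - (r * F u) , r * u

  pairs : List (Carrier × Carrier)
  pairs = cartesianProduct elems elems

  removed-enumerate : Enumerates (T ∘ removed) (map removed-map (cartesianProduct units trace-ones))
  removed-enumerate = enum-image removed-map (enum-× units-enumerate (filter-elems (λ x → Tr x ≟ 1#)))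
    (λ (r≢0 , tr) → subst T (sym (removed-intro (r≢0 , (λ z → 1≢0 (trans (sym tr) z)) , refl , refl))) tt)
    injective (λ {c} t → onto-removed (removed-elim {c} (Equivalence.to Bool.T-≡ t)))
    where
    injective : ∀ {p p′} → proj₁ p ≢ 0# × Tr (proj₂ p) ≡ 1# → proj₁ p′ ≢ 0# × Tr (proj₂ p′) ≡ 1# →
      removed-map p ≡ removed-map p′ → p ≡ p′
    injective {r , u} {r′ , u′} (r≢0 , tr) (r′≢0 , tr′) e = cong₂ _,_ r≡r′ u≡u′
      where
      t : Carrier
      t = r′ ⁻¹ * r
      rt : r ≡ r′ * t
      rt = sym (⁻¹-cancelʳ r r′≢0)
      u′≡tu : u′ ≡ t * u
      u′≡tu = *-cancelˡ r′≢0 (trans (sym (cong proj₂ e)) (trans (cong (_* u) rt) (*-assoc _ _ _)))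
      u≢0 : u ≢ 0#
      u≢0 refl = 1≢0 (trans (sym tr) Tr-0)
      rFu : r * F u ≡ r′ * F u′
      rFu = trans (sym (-‿involutive _)) (trans (cong -_ (cong proj₁ e)) (-‿involutive _))
      t∈ : IsFq t
      t∈ = *-cancelˡ (*-≢0 r′≢0 (F-≢0 u≢0)) (begin
        r′ * F u * F t      ≡⟨ solve 3 (λ r a b → r :* a :* b := r :* (b :* a)) refl r′ (F u) (F t) ⟩
        r′ * (F t * F u)    ≡⟨ cong (r′ *_) (trans (sym (F-* t u)) (cong F (sym u′≡tu))) ⟩
        r′ * F u′           ≡⟨ trans (sym rFu) (cong (_* F u) rt) ⟩
        r′ * t * F u        ≡⟨ solve 3 (λ r a b → r :* a :* b := r :* b :* a) refl r′ t (F u) ⟩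
        r′ * F u * t        ∎)
      t≡1 : t ≡ 1#
      t≡1 = begin
        t           ≡⟨ sym (*-identityʳ t) ⟩
        t * 1#      ≡⟨ cong (t *_) (sym tr) ⟩
        t * Tr u    ≡⟨ trans (sym (Tr-* t∈ u)) (cong Tr (sym u′≡tu)) ⟩
        Tr u′       ≡⟨ tr′ ⟩
        1#          ∎
      r≡r′ : r ≡ r′
      r≡r′ = trans rt (trans (cong (r′ *_) t≡1) (*-identityʳ r′))
      u≡u′ : u ≡ u′
      u≡u′ = sym (trans u′≡tu (trans (cong (_* u) t≡1) (*-identityˡ u)))
    onto-removed : ∀ {c} → (Σ Carrier λ r → Σ Carrier λ u → Removal c r u) →
      Σ (Carrier × Carrier) λ p → (proj₁ p ≢ 0# × Tr (proj₂ p) ≡ 1#) × removed-map p ≡ c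
    onto-removed {a₀ , a₁} (r , u , r≢0 , t≢0 , e₀ , e₁) =
      (r * t , t ⁻¹ * u) , (*-≢0 r≢0 t≢0 , trans (Tr-* t⁻¹∈ u) (*-inverseˡ t≢0)) ,
      cong₂ _,_
        (trans (cong -_ (trans (cong (r * t *_) (trans (F-* _ u) (cong (_* F u) t⁻¹∈))) (cancel (F u)))) (sym e₀))
        (trans (cancel u) (sym e₁))
      where
      t : Carrier
      t = Tr u
      t⁻¹∈ : IsFq (t ⁻¹)
      t⁻¹∈ = Fq-⁻¹ t≢0 (Tr-Fq u)
      cancel : ∀ z → r * t * (t ⁻¹ * z) ≡ r * z
      cancel z = trans (*-assoc _ _ _) (cong (r *_) (⁻¹-cancelʳ z t≢0))

  kept : List (Carrier × Carrier)
  kept = filterᵇ (λ c → not (removed c)) pairs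

  |kept| : length units ℕ.* q ℕ.^ 3 ℕ.+ length kept ≡ q ℕ.^ 8
  |kept| = begin
    length units ℕ.* q ℕ.^ 3 ℕ.+ length kept
      ≡⟨ cong (λ m → length units ℕ.* m ℕ.+ length kept) (sym |trace-ones|) ⟩
    length units ℕ.* length trace-ones ℕ.+ length kept
      ≡⟨ cong (ℕ._+ length kept) (sym (trans (length-map removed-map (cartesianProduct units trace-ones)) (length-cartesianProduct units trace-ones))) ⟩
    length (map removed-map (cartesianProduct units trace-ones)) ℕ.+ length kept
      ≡⟨ cong (ℕ._+ length kept) (enum-unique removed-enumerate removed-in-pairs) ⟩
    length (filterᵇ removed pairs) ℕ.+ length kept
      ≡⟨ sym (length-filter-split (T? ∘ removed) (T? ∘ not ∘ removed) exclusive exhaustive pairs) ⟩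
    length pairs
      ≡⟨ trans (length-cartesianProduct elems elems) (cong₂ ℕ._*_ card≡ card≡) ⟩
    q ℕ.^ 4 ℕ.* q ℕ.^ 4
      ≡⟨ sym (ℕ.^-distribˡ-+-* q 4 4) ⟩
    q ℕ.^ 8 ∎
    where
    removed-in-pairs : Enumerates (T ∘ removed) (filterᵇ removed pairs)
    removed-in-pairs .nodup = Unique.filter⁺ (T? ∘ removed) (Unique.cartesianProduct⁺ unique unique)
    removed-in-pairs .sound m = proj₂ (∈-filter⁻ (T? ∘ removed) {xs = pairs} m)
    removed-in-pairs .complete {c} t = ∈-filter⁺ (T? ∘ removed) (∈-allVecs c) t
    exclusive : ∀ {c} → T (removed c) → ¬ T (not (removed c))
    exclusive {c} t t′ with removed c
    exclusive t () | true
    exclusive () t′ | false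
    exhaustive : ∀ {c} → ¬ T (removed c) → T (not (removed c))
    exhaustive {c} nt with removed c
    ... | true = nt tt
    ... | false = tt

  -- Representatives modulo F_q^×

  special-units : List Carrier
  special-units = filter (λ e → IsFq? (norm₂ e)) units

  special-units-enumerate : Enumerates (λ e → e ≢ 0# × IsFq (norm₂ e)) special-units
  special-units-enumerate = filter-enumerates (λ e → IsFq? (norm₂ e)) units-enumerate

  norm₂≢0 : ∀ {x} → x ≢ 0# → norm₂ x ≢ 0#
  norm₂≢0 x≢0 = *-≢0 x≢0 (F-≢0 (F-≢0 x≢0))

  norm₂-qth : ∀ x → norm₂ (x * F x) ≡ norm x
  norm₂-qth x = cong (x * F x *_) (trans (cong F (F-* _ _)) (F-* _ _))

  |special-units| : length special-units ≡ q-1 ℕ.* suc (q ℕ.^ 2)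
  |special-units| = ℕ.≤-antisym upper lower
    where
    upper : length special-units ≤ q-1 ℕ.* suc (q ℕ.^ 2)
    upper = ℕ.≤-trans (roots-monic (monic-+ {0} (- 1#) (ℕ.>-nonZero⁻¹ _) (monic-^ (suc (q ℕ.^ 2) ℕ.* q-1))) (nodup special-units-enumerate) root)
      (ℕ.≤-reflexive (ℕ.*-comm (suc (q ℕ.^ 2)) q-1))
      where
      instance
        q-1≢0 : ℕ.NonZero q-1
        q-1≢0 = ℕ.>-nonZero q-1>0
        degree≢0 : ℕ.NonZero (suc (q ℕ.^ 2) ℕ.* q-1)
        degree≢0 = ℕ.m*n≢0 (suc (q ℕ.^ 2)) q-1
      root : ∀ {e} → e ∈ special-units → e ^ (suc (q ℕ.^ 2) ℕ.* q-1) + - 1# * 1# ≡ 0#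
      root {e} m = trans (cong₂ _+_ power (*-identityʳ _)) (-‿inverseʳ 1#)
        where
        n∈ : IsFq (norm₂ e)
        n∈ = proj₂ (sound special-units-enumerate m)
        power : e ^ (suc (q ℕ.^ 2) ℕ.* q-1) ≡ 1#
        power = *-cancelˡ (norm₂≢0 (proj₁ (sound special-units-enumerate m))) (begin
          norm₂ e * e ^ (suc (q ℕ.^ 2) ℕ.* q-1)   ≡⟨ cong (norm₂ e *_) (sym (^-assocʳ e (suc (q ℕ.^ 2)) q-1)) ⟩
          norm₂ e * (e * e ^ (q ℕ.^ 2)) ^ q-1     ≡⟨ cong (λ z → norm₂ e * (e * z) ^ q-1) (F^2 e) ⟩
          norm₂ e ^ suc q-1                       ≡⟨ cong (norm₂ e ^_) (sym q≡1+[q-1]) ⟩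
          norm₂ e ^ q                           ≡⟨ sym (pow≡^ q (norm₂ e) q) ⟩
          F (norm₂ e)                           ≡⟨ n∈ ⟩
          norm₂ e                               ≡⟨ sym (*-identityʳ _) ⟩
          norm₂ e * 1#                          ∎)
    -- x ↦ x^{q+1} maps the units to special units, with fibres of size at most q + 1.
    lower : q-1 ℕ.* suc (q ℕ.^ 2) ≤ length special-units
    lower = ℕ.*-cancelʳ-≤ _ _ (suc q) (ℕ.≤-trans
      (ℕ.≤-reflexive (trans (ℕ.*-comm _ (suc q)) (trans (cong (ℕ._* (q-1 ℕ.* suc (q ℕ.^ 2))) (ℕ.+-comm 1 q)) (sym |units|≡))))
      (length-fibres _≟_ (λ x → x * F x) (suc q) fibres special-units (nodup units-enumerate) into))
      where
      into : ∀ {x} → x ∈ units → x * F x ∈ special-units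
      into {x} m = Enumerates.complete special-units-enumerate
        (*-≢0 x≢0 (F-≢0 x≢0) , subst IsFq (sym (norm₂-qth x)) (norm-Fq x))
        where x≢0 = sound units-enumerate m
      fibres : ∀ y {zs} → Unique zs → (∀ {z} → z ∈ zs → z * F z ≡ y) → length zs ≤ suc q
      fibres y u fib = roots-monic (monic-+ {0} (- y) (ℕ.s≤s ℕ.z≤n) (monic-^ (suc q))) u λ {z} m →
        trans (cong₂ _+_ (trans (cong (z *_) (sym (pow≡^ q z q))) (fib m)) (*-identityʳ _)) (-‿inverseʳ y)

  Generic : Carrier → Set
  Generic e = ¬ IsFq (norm₂ e)

  Generic? : Decidable Generic
  Generic? e = ¬? (IsFq? (norm₂ e))

  Generic⇒∉Fq : ∀ {e} → Generic e → ¬ IsFq e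
  Generic⇒∉Fq g e∈ = g (Fq-* e∈ (cong (λ z → F (F z)) e∈))

  generics : List Carrier
  generics = filter Generic? elems

  |generics| : length generics ≡ q-1 ℕ.* (q ℕ.^ 3 ℕ.+ q)
  |generics| = ℕ.+-cancelˡ-≡ (suc (q-1 ℕ.* suc (q ℕ.^ 2))) _ _ (begin
    suc (q-1 ℕ.* suc (q ℕ.^ 2)) ℕ.+ length generics
      ≡⟨ cong (λ m → suc m ℕ.+ length generics) (sym |special-units|) ⟩
    suc (length special-units) ℕ.+ length generics
      ≡⟨ cong (λ m → suc m ℕ.+ length generics) (enum-unique special-units-enumerate nonzero-specials) ⟩
    suc (length (filter (λ x → ¬? (x ≟ 0#)) specials)) ℕ.+ length generics
      ≡⟨ cong (ℕ._+ length generics) (sym (length-nonzero specials-enumerate (subst IsFq (sym (zeroˡ _)) Fq-0))) ⟩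
    length specials ℕ.+ length generics
      ≡⟨ sym (length-filter-split (λ e → IsFq? (norm₂ e)) Generic? (λ p np → np p) (λ np → np) elems) ⟩
    card K
      ≡⟨ card≡ ⟩
    q ℕ.^ 4
      ≡⟨ subst (λ q → q ℕ.^ 4 ≡ suc (q-1 ℕ.* suc (q ℕ.^ 2)) ℕ.+ q-1 ℕ.* (q ℕ.^ 3 ℕ.+ q)) (sym q≡1+[q-1]) (identity q-1) ⟩
    suc (q-1 ℕ.* suc (q ℕ.^ 2)) ℕ.+ q-1 ℕ.* (q ℕ.^ 3 ℕ.+ q) ∎)
    where
    specials : List Carrier
    specials = filter (λ e → IsFq? (norm₂ e)) elems
    specials-enumerate : Enumerates (λ e → IsFq (norm₂ e)) specials
    specials-enumerate = filter-elems (λ e → IsFq? (norm₂ e))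
    nonzero-specials : Enumerates (λ e → e ≢ 0# × IsFq (norm₂ e)) (filter (λ x → ¬? (x ≟ 0#)) specials)
    nonzero-specials = enum-cong (λ (a , b) → b , a) (λ (a , b) → b , a) (filter-enumerates (λ x → ¬? (x ≟ 0#)) specials-enumerate)
    identity : ∀ n → suc n ℕ.^ 4 ≡ suc (n ℕ.* suc (suc n ℕ.^ 2)) ℕ.+ n ℕ.* (suc n ℕ.^ 3 ℕ.+ suc n)
    identity = ℕS.solve 1 (λ n → (ℕS.con 1 ℕS.:+ n) ℕS.:^ 4 ℕS.:= ℕS.con 1 ℕS.:+ n ℕS.:* (ℕS.con 1 ℕS.:+ (ℕS.con 1 ℕS.:+ n) ℕS.:^ 2) ℕS.:+ n ℕS.:* ((ℕS.con 1 ℕS.:+ n) ℕS.:^ 3 ℕS.:+ (ℕS.con 1 ℕS.:+ n))) refl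

  Associate : Carrier → Carrier → Set
  Associate e e′ = Any (λ c → e′ ≡ c * e) fq-units

  associate? : ∀ e e′ → Dec (Associate e e′)
  associate? e e′ = any? (λ c → e′ ≟ (c * e)) fq-units

  associate : ∀ {e e′ c} → IsFq c → c ≢ 0# → e′ ≡ c * e → Associate e e′
  associate c∈ c≢0 e = lose (Enumerates.complete fq-units-enumerate (c∈ , c≢0)) e

  associate⁻ : ∀ {e e′} → Associate e e′ → Σ Carrier λ c → IsFq c × c ≢ 0# × e′ ≡ c * e
  associate⁻ a = let c , m , e = find a ; c∈ , c≢0 = sound fq-units-enumerate m in c , c∈ , c≢0 , e

  associate-sym : ∀ {e e′} → Associate e e′ → Associate e′ e
  associate-sym {e} {e′} a = let c , c∈ , c≢0 , p = associate⁻ a in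
    associate (Fq-⁻¹ c≢0 c∈) (⁻¹-≢0 c≢0) (sym (trans (cong (c ⁻¹ *_) p) (⁻¹-cancelˡ e c≢0)))

  associate-trans : ∀ {e e′ e″} → Associate e e′ → Associate e′ e″ → Associate e e″
  associate-trans a b =
    let c , c∈ , c≢0 , p = associate⁻ a
        d , d∈ , d≢0 , r = associate⁻ b
    in associate (Fq-* d∈ c∈) (*-≢0 d≢0 c≢0) (trans r (trans (cong (d *_) p) (sym (*-assoc _ _ _))))

  norm₂-scale : ∀ {e e′ c} → IsFq c → e′ ≡ c * e → IsFq (norm₂ e) → IsFq (norm₂ e′)
  norm₂-scale {e} {e′} {c} c∈ refl n∈ = subst IsFq (sym scale) (Fq-* (Fq-* c∈ c∈) n∈)
    where
    scale : norm₂ (c * e) ≡ c * c * norm₂ e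
    scale = trans (cong (c * e *_) (trans (cong F (trans (F-* c e) (cong (_* F e) c∈))) (trans (F-* c _) (cong (_* F (F e)) c∈))))
      (solve 3 (λ c e f → c :* e :* (c :* f) := c :* c :* (e :* f)) refl c e _)

  generic-reps : List Carrier
  generic-reps = deduplicate associate? generics

  rep-Generic : ∀ {e} → e ∈ generic-reps → Generic e
  rep-Generic m = proj₂ (∈-filter⁻ Generic? {xs = elems} (∈-deduplicate⁻ associate? generics m))

  reps-associate : ∀ {e e′} → e ∈ generic-reps → e′ ∈ generic-reps → Associate e e′ → e ≡ e′
  reps-associate {e} {e′} m m′ a = case (AllPairs-lookup (deduplicate-AllPairs associate? generics) m m′)
    where
    case : e ≡ e′ ⊎ (¬ Associate e e′ ⊎ ¬ Associate e′ e) → e ≡ e′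
    case (inj₁ p) = p
    case (inj₂ (inj₁ na)) = ⊥-elim (na a)
    case (inj₂ (inj₂ na)) = ⊥-elim (na (associate-sym a))

  generic-reps-unique : Unique generic-reps
  generic-reps-unique = AllPairs.map (λ na → λ { refl → na (associate Fq-1 1≢0 (sym (*-identityˡ _))) })
    (deduplicate-AllPairs associate? generics)

  |generic-reps| : length generic-reps ≡ q ℕ.^ 3 ℕ.+ q
  |generic-reps| = ℕ.*-cancelˡ-≡ _ _ q-1 {{ℕ.>-nonZero q-1>0}} (begin
    q-1 ℕ.* length generic-reps
      ≡⟨ cong (ℕ._* length generic-reps) (sym |fq-units|) ⟩
    length fq-units ℕ.* length generic-reps
      ≡⟨ sym (trans (length-map scale (cartesianProduct fq-units generic-reps)) (length-cartesianProduct fq-units generic-reps)) ⟩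
    length (map scale (cartesianProduct fq-units generic-reps))
      ≡⟨ enum-unique multiples (filter-elems Generic?) ⟩
    length generics
      ≡⟨ |generics| ⟩
    q-1 ℕ.* (q ℕ.^ 3 ℕ.+ q) ∎)
    where
    scale : Carrier × Carrier → Carrier
    scale (c , e) = c * e
    multiples : Enumerates Generic (map scale (cartesianProduct fq-units generic-reps))
    multiples = enum-image scale (enum-× fq-units-enumerate (enum-∈ generic-reps-unique))
      (λ ((c∈ , c≢0) , m) n∈ → rep-Generic m (norm₂-scale (Fq-⁻¹ c≢0 c∈) (sym (⁻¹-cancelˡ _ c≢0)) n∈))
      injective onto-generic
      where
      injective : ∀ {p p′} → (IsFq (proj₁ p) × proj₁ p ≢ 0#) × proj₂ p ∈ generic-reps →
        (IsFq (proj₁ p′) × proj₁ p′ ≢ 0#) × proj₂ p′ ∈ generic-reps → scale p ≡ scale p′ → p ≡ p′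
      injective {c , e} {c′ , e′} ((c∈ , c≢0) , m) ((c′∈ , c′≢0) , m′) eq = cong₂ _,_
        (*-cancelˡ (e≢0 (Generic⇒∉Fq (rep-Generic m))) (trans (*-comm _ _) (trans eq (trans (cong (c′ *_) (sym e≡e′)) (*-comm _ _)))))
        e≡e′
        where
        e≡e′ : e ≡ e′
        e≡e′ = reps-associate m m′ (associate (Fq-* (Fq-⁻¹ c′≢0 c′∈) c∈) (*-≢0 (⁻¹-≢0 c′≢0) c≢0)
          (sym (trans (*-assoc _ _ _) (trans (cong (c′ ⁻¹ *_) eq) (⁻¹-cancelˡ e′ c′≢0)))))
      onto-generic : ∀ {e} → Generic e →
        Σ (Carrier × Carrier) λ p → ((IsFq (proj₁ p) × proj₁ p ≢ 0#) × proj₂ p ∈ generic-reps) × scale p ≡ e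
      onto-generic {e} g =
        let r , m , a = find (Any.deduplicate⁺ associate? (λ a b → associate-trans a b)
              (lose {P = λ r → Associate r e} (∈-filter⁺ Generic? (FiniteField.complete K e) g) (associate Fq-1 1≢0 (sym (*-identityˡ e)))))
            c , c∈ , c≢0 , p = associate⁻ a
        in (c , r) , ((c∈ , c≢0) , m) , sym p

  special-rep : Σ Carrier λ e → ¬ IsFq e × IsFq (norm₂ e)
  special-rep =
    let b , _ , b₂≢b = ∃-in (λ b → ¬? (F (F b) ≟ b)) elems all-fixed
        b≢0 = λ b≡0 → b₂≢b (trans (cong (λ z → F (F z)) b≡0) (trans (cong F F-0) (trans F-0 (sym b≡0))))
    in b * F b ,
       (λ e∈ → b₂≢b (*-cancelˡ (F-≢0 b≢0) (trans (sym (F-* b (F b))) (trans e∈ (*-comm b (F b)))))) ,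
       subst IsFq (sym (norm₂-qth b)) (norm-Fq b)
    where
    all-fixed : ¬ (∀ {b} → b ∈ elems → ¬ (F (F b) ≢ b))
    all-fixed h = ℕ.<⇒≱ (q^-mono-< {2} {4} (ℕ.n≤1+n 3)) (subst (_≤ q ℕ.^ 2) card≡ (F²-roots unique (λ {b} m → decidable-stable (F (F b) ≟ b) (h m))))

  e₀ : Carrier
  e₀ = proj₁ special-rep

  e₀∉Fq : ¬ IsFq e₀
  e₀∉Fq = proj₁ (proj₂ special-rep)

  e₀-special : IsFq (norm₂ e₀)
  e₀-special = proj₂ (proj₂ special-rep)

  admissible : List Carrier
  admissible = e₀ ∷ generic-reps

  |admissible| : length admissible ≡ q ℕ.^ 3 ℕ.+ q ℕ.+ 1
  |admissible| = trans (cong suc |generic-reps|) (ℕ.+-comm 1 _)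

  admissible-unique : Unique admissible
  admissible-unique = All.tabulate (λ m e → rep-Generic m (subst (λ e → IsFq (norm₂ e)) e e₀-special)) ∷ generic-reps-unique

  admissible∉Fq : ∀ {e} → e ∈ admissible → ¬ IsFq e
  admissible∉Fq (here refl) = e₀∉Fq
  admissible∉Fq (there m) = Generic⇒∉Fq (rep-Generic m)

  admissible-compatible : ∀ {e e′} → e ∈ admissible → e′ ∈ admissible → Compatible e e′
  admissible-compatible (here refl) (here refl) = (λ _ _ → refl) , (λ _ _ → refl)
  admissible-compatible (here refl) (there m) =
    (λ c∈ p → ⊥-elim (rep-Generic m (norm₂-scale c∈ p e₀-special))) , (λ _ n∈ → ⊥-elim (rep-Generic m n∈))
  admissible-compatible {e} (there m) (here refl) =
    (λ {c} c∈ p → ⊥-elim (rep-Generic m (norm₂-scale (Fq-⁻¹ (c≢0 p) c∈)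
       (sym (trans (cong (c ⁻¹ *_) p) (⁻¹-cancelˡ e (c≢0 p)))) e₀-special))) ,
    (λ n∈ _ → ⊥-elim (rep-Generic m n∈))
    where
    c≢0 : ∀ {c} → e₀ ≡ c * e → c ≢ 0#
    c≢0 p c≡0 = e≢0 e₀∉Fq (trans p (trans (cong (_* e) c≡0) (zeroˡ e)))
  admissible-compatible {e} {e′} (there m) (there m′) =
    (λ {c} c∈ p → reps-associate m m′ (associate c∈ (λ c≡0 → e≢0 (Generic⇒∉Fq (rep-Generic m′)) (trans p (trans (cong (_* e) c≡0) (zeroˡ e)))) p)) ,
    (λ n∈ _ → ⊥-elim (rep-Generic m n∈))

  -- The augmented code

  parameters : List (Carrier × Carrier)
  parameters = cartesianProduct units admissible

  parameters-enumerate : Enumerates (λ c → proj₁ c ≢ 0# × proj₂ c ∈ admissible) parameters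
  parameters-enumerate = enum-× units-enumerate (enum-∈ admissible-unique)

  plane′ : Carrier × Carrier → Subset
  plane′ (s , e) = plane s e

  new-planes : List Subset
  new-planes = map plane′ parameters

  |new-planes| : length new-planes ≡ (q ℕ.^ 4 ℕ.∸ 1) ℕ.* (q ℕ.^ 3 ℕ.+ q ℕ.+ 1)
  |new-planes| = trans (length-map plane′ parameters) (trans (length-cartesianProduct units admissible)
    (cong₂ ℕ._*_ (cong ℕ.pred |units|+1) |admissible|))

  Γ′ : Carrier × Carrier → Subset
  Γ′ (a₀ , a₁) = Γ a₀ a₁

  kept-not-removed : ∀ {c} → c ∈ kept → removed c ≢ true
  kept-not-removed {c} m e = subst (T ∘ not) e (proj₂ (∈-filter⁻ (T? ∘ not ∘ removed) {xs = pairs} m))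

  code-planes : All IsPlane (L₀ ++ new-planes)
  code-planes = All.++⁺ (All.map⁺ {xs = kept} (All.tabulate λ {(a₀ , a₁)} _ → Γ-plane a₀ a₁))
    (All.map⁺ {xs = parameters} (All.tabulate λ m → let s≢0 , e∈ = sound parameters-enumerate m in plane-plane s≢0 (admissible∉Fq e∈)))

  code-distance : AllPairs (λ U U′ → DimAtMost (U ∩ U′) 1) (L₀ ++ new-planes)
  code-distance = AllPairs.++⁺
    (AllPairs.map⁺ {xs = kept} (Unique⇒AllPairs (Unique.filter⁺ (T? ∘ not ∘ removed) (Unique.cartesianProduct⁺ unique unique)) λ _ _ → Γ∩Γ))
    (AllPairs.map⁺ {xs = parameters} (Unique⇒AllPairs (nodup parameters-enumerate) λ m m′ ne →
      let s≢0 , e∈ = sound parameters-enumerate m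
          s′≢0 , e′∈ = sound parameters-enumerate m′
      in plane∩plane s≢0 (admissible∉Fq e∈) s′≢0 (admissible∉Fq e′∈) (admissible-compatible e∈ e′∈) ne))
    (All.map⁺ {xs = kept} (All.tabulate λ m → All.map⁺ {xs = parameters} (All.tabulate λ m′ →
      let s≢0 , e∈ = sound parameters-enumerate m′ in plane∩Γ s≢0 (admissible∉Fq e∈) (kept-not-removed m))))

  module _ {P : Subset} (P-point : IsPoint P) (P⊆S : P ⊆ S) where
    private
      b : Vec2
      b = proj₁ (proj₂ P-point) Fin.zero
      b∈ : P ∋ b
      b∈ = proj₁ (proj₂ (proj₂ P-point)) Fin.zero
      p : Carrier
      p = proj₂ b
      b≡ : b ≡ (0# , p)
      b≡ = cong (_, p) (==⇒≡ (P⊆S b b∈))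
      p≢0 : p ≢ 0#
      p≢0 p≡0 = 1≢0 (proj₁ (proj₂ (proj₂ (proj₂ P-point))) (λ _ → 1#) (λ _ → Fq-1)
        (trans (⊕-identityʳ _) (trans (cong (1# ·_) (trans b≡ (cong (0# ,_) p≡0))) (cong₂ _,_ (zeroʳ 1#) (zeroʳ 1#)))) Fin.zero)

      through⇒ : ∀ {s e} → T (P ⊆ᵇ plane s e) → IsFq (s * p)
      through⇒ {s} {e} t = plane-point⁻ {s} {e} (subst (plane s e ∋_) b≡ (at b (All.lookup (All.all⁺ (λ v → not (P v) ∨ plane s e v) allVecs t) (∈-allVecs b)) b∈))
        where
        at : ∀ v → T (not (P v) ∨ plane s e v) → P v ≡ true → plane s e v ≡ true
        at v t v∈ with P v | plane s e v
        at v t refl | true | true = refl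
      through⇐ : ∀ {s e} → IsFq (s * p) → T (P ⊆ᵇ plane s e)
      through⇐ {s} {e} sp∈ = All.all⁻ (λ v → not (P v) ∨ plane s e v) {allVecs} (All.tabulate λ {v} _ → at v λ v∈ →
        let c , c∈ , eq = proj₂ (proj₂ (proj₂ (proj₂ P-point))) v v∈ in
        subst (plane s e ∋_) eq (lincomb-closed (plane-subspace s e) c (proj₁ (proj₂ P-point)) c∈ λ { Fin.zero → subst (plane s e ∋_) (sym b≡) (plane-point {s} {e} sp∈) }))
        where
        at : ∀ v → (P v ≡ true → plane s e v ≡ true) → T (not (P v) ∨ plane s e v)
        at v sub with P v | plane s e v
        ... | false | _ = tt
        ... | true | true = tt
        ... | true | false with () ← sub refl

    count-through : countThrough P new-planes ≡ (q ℕ.∸ 1) ℕ.* (q ℕ.^ 3 ℕ.+ q ℕ.+ 1)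
    count-through = begin
      length (filterᵇ (P ⊆ᵇ_) (map plane′ parameters))
        ≡⟨ length-filter-map (λ U → T? (P ⊆ᵇ U)) plane′ parameters ⟩
      length (filter (λ c → T? (P ⊆ᵇ plane′ c)) parameters)
        ≡⟨ enum-≡ (filter-enumerates (λ c → T? (P ⊆ᵇ plane′ c)) parameters-enumerate)
                  (enum-× fq-units-enumerate (enum-∈ admissible-unique))
                  (λ (s , e) → s * p , e) (λ (t , e) → t * p ⁻¹ , e)
                  (λ {(s , e)} ((s≢0 , e∈) , t) → (through⇒ {s} {e} t , *-≢0 s≢0 p≢0) , e∈)
                  (λ {(t , e)} ((t∈ , t≢0) , e∈) → (*-≢0 t≢0 (⁻¹-≢0 p≢0) , e∈) ,
                    through⇐ {t * p ⁻¹} {e} (subst IsFq (sym (trans (*-assoc _ _ _) (trans (cong (t *_) (*-inverseˡ p≢0)) (*-identityʳ t)))) t∈))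
                  (λ _ _ → cancel p≢0) (λ _ _ → cancel (⁻¹-≢0 p≢0)) ⟩
      length (cartesianProduct fq-units admissible)
        ≡⟨ trans (length-cartesianProduct fq-units admissible) (cong₂ ℕ._*_ |fq-units| |admissible|) ⟩
      q-1 ℕ.* (q ℕ.^ 3 ℕ.+ q ℕ.+ 1) ∎
      where
      cancel : ∀ {z} → z ≢ 0# → {x y : Carrier × Carrier} → (proj₁ x * z , proj₂ x) ≡ (proj₁ y * z , proj₂ y) → x ≡ y
      cancel {z} z≢0 e = let e₁ , e₂ = ,-injective e in
        cong₂ _,_ (*-cancelˡ z≢0 (trans (*-comm _ _) (trans e₁ (*-comm _ _)))) e₂

  |code| : length (L₀ ++ new-planes) ≡ q ℕ.^ 8 ℕ.+ q ℕ.^ 5 ℕ.+ q ℕ.^ 4 ℕ.∸ q ℕ.∸ 1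
  |code| = begin
    length (L₀ ++ new-planes)
      ≡⟨ trans (length-++ L₀) (cong₂ ℕ._+_ (length-map Γ′ kept) (trans (length-map plane′ parameters) (trans (length-cartesianProduct units admissible) (cong (length units ℕ.*_) |admissible|)))) ⟩
    k ℕ.+ u ℕ.* (q ℕ.^ 3 ℕ.+ q ℕ.+ 1)
      ≡⟨ sym (ℕ.m+n∸n≡m _ (q ℕ.+ 1)) ⟩
    k ℕ.+ u ℕ.* (q ℕ.^ 3 ℕ.+ q ℕ.+ 1) ℕ.+ (q ℕ.+ 1) ℕ.∸ (q ℕ.+ 1)
      ≡⟨ cong (ℕ._∸ (q ℕ.+ 1)) (rearrange k u (q ℕ.^ 3) q) ⟩
    (u ℕ.* q ℕ.^ 3 ℕ.+ k) ℕ.+ q ℕ.* suc u ℕ.+ suc u ℕ.∸ (q ℕ.+ 1)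
      ≡⟨ cong₂ (λ a b → a ℕ.+ q ℕ.* b ℕ.+ b ℕ.∸ (q ℕ.+ 1)) |kept| |units|+1 ⟩
    q ℕ.^ 8 ℕ.+ q ℕ.^ 5 ℕ.+ q ℕ.^ 4 ℕ.∸ (q ℕ.+ 1)
      ≡⟨ sym (ℕ.∸-+-assoc _ q 1) ⟩
    q ℕ.^ 8 ℕ.+ q ℕ.^ 5 ℕ.+ q ℕ.^ 4 ℕ.∸ q ℕ.∸ 1 ∎
    where
    k u : ℕ
    k = length kept
    u = length units
    rearrange : ∀ k u c q → k ℕ.+ u ℕ.* (c ℕ.+ q ℕ.+ 1) ℕ.+ (q ℕ.+ 1) ≡ (u ℕ.* c ℕ.+ k) ℕ.+ q ℕ.* suc u ℕ.+ suc u
    rearrange = ℕS.solve 4 (λ k u c q → k ℕS.:+ u ℕS.:* (c ℕS.:+ q ℕS.:+ ℕS.con 1) ℕS.:+ (q ℕS.:+ ℕS.con 1)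
      ℕS.:= (u ℕS.:* c ℕS.:+ k) ℕS.:+ q ℕS.:* (ℕS.con 1 ℕS.:+ u) ℕS.:+ (ℕS.con 1 ℕS.:+ u)) refl

  removed-scale : ∀ {r a₀ a₁} → r ≢ 0# → removed (r * a₀ , r * a₁) ≡ true → removed (a₀ , a₁) ≡ true
  removed-scale {r} {a₀} {a₁} r≢0 e =
    let t , u , t≢0 , u∉ , e₀ , e₁ = removed-elim {r * a₀ , r * a₁} e in
    removed-intro {a₀ , a₁} {r ⁻¹ * t} {u}
      ( *-≢0 (⁻¹-≢0 r≢0) t≢0 , u∉
      , trans (sym (⁻¹-cancelˡ a₀ r≢0)) (trans (cong (r ⁻¹ *_) e₀) (solve 3 (λ i t v → i :* :- (t :* v) := :- (i :* t :* v)) refl (r ⁻¹) t (F u)))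
      , trans (sym (⁻¹-cancelˡ a₁ r≢0)) (trans (cong (r ⁻¹ *_) e₁) (sym (*-assoc _ _ _))))

  code-invariant : SigmaInvariant (L₀ ++ new-planes)
  code-invariant r r≢0 = All.++⁺
    (All.map⁺ {xs = kept} (All.tabulate λ {(a₀ , a₁)} m → lose (∈-++⁺ˡ (∈-map⁺ Γ′ (scaled-kept m))) (Γ-image a₀ a₁)))
    (All.map⁺ {xs = parameters} (All.tabulate λ {(s , e)} m → lose (∈-++⁺ʳ L₀ (∈-map⁺ plane′ (scaled-parameter m))) (plane-image s e)))
    where
    scaled-kept : ∀ {a₀ a₁} → (a₀ , a₁) ∈ kept → (r * a₀ , r * a₁) ∈ kept
    scaled-kept {a₀} {a₁} m = ∈-filter⁺ (T? ∘ not ∘ removed) (∈-allVecs _)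
      (not-true (λ e → kept-not-removed m (removed-scale r≢0 e)))
      where
      not-true : ∀ {b} → b ≢ true → T (not b)
      not-true {true} ne = ne refl
      not-true {false} _ = tt
    Γ-image : ∀ a₀ a₁ → ImageEq r (Γ a₀ a₁) (Γ (r * a₀) (r * a₁))
    Γ-image a₀ a₁ x y = Bool-ext
      (λ m → Γ-intro (Γ-W m) (*-cancelˡ r≢0 (trans (Γ-value m) (factor a₀ a₁ x))))
      (λ m → Γ-intro (Γ-W m) (trans (cong (r *_) (Γ-value m)) (sym (factor a₀ a₁ x))))
      where
      factor : ∀ a₀ a₁ x → gabidulin (r * a₀) (r * a₁) x ≡ r * gabidulin a₀ a₁ x
      factor a₀ a₁ x = solve 5 (λ r a b x u → r :* a :* x :+ r :* b :* u := r :* (a :* x :+ b :* u)) refl r a₀ a₁ x (F x)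
    scaled-parameter : ∀ {s e} → (s , e) ∈ parameters → (s * r ⁻¹ , e) ∈ parameters
    scaled-parameter m = let s≢0 , e∈ = sound parameters-enumerate m in
      Enumerates.complete parameters-enumerate (*-≢0 s≢0 (⁻¹-≢0 r≢0) , e∈)
    plane-image : ∀ s e → ImageEq r (plane s e) (plane (s * r ⁻¹) e)
    plane-image s e x y = cong (λ z → inW x ∧ ((Tr (e * x) == 0#) ∧ (φ z == slope e * F x)))
      (trans (*-assoc _ _ _) (cong (s *_) (⁻¹-cancelˡ y r≢0)))

  conclusion : Conclusion
  conclusion = new-planes , |new-planes| ,
    All.map⁺ {xs = parameters} (All.tabulate λ m → let s≢0 , e∈ = sound parameters-enumerate m in
      plane-plane s≢0 (admissible∉Fq e∈) , plane∩S s≢0 (admissible∉Fq e∈)) ,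
    (λ P P-point P⊆S → count-through P-point P⊆S) ,
    (code-planes , code-distance) , |code| , code-invariant

open import Data.Nat using (_≥_; _^_)

theorem5p4 : (p k : ℕ) → Prime p → k ≥ 1 → (K : FiniteField) → card K ≡ (p ^ k) ^ 4 →
    Setting.Conclusion (p ^ k) K
theorem5p4 p k p-prime k≥1 K card≡ = Construction.conclusion (p ^ k) 2≤p^k K card≡ pow-+
  where
  open FieldTheory K using (pow≡^; ^-primePower-+)
  2≤p : 2 ≤ p
  2≤p = ℕ.nonTrivial⇒n>1 p {{prime⇒nonTrivial p-prime}}
  2≤p^k : 2 ≤ p ^ k
  2≤p^k = ℕ.≤-trans 2≤p (subst (_≤ p ^ k) (ℕ.^-identityʳ p) (ℕ.^-monoʳ-≤ p {{ℕ.>-nonZero (ℕ.<-trans z<s 2≤p)}} k≥1))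
  pow-+ : ∀ x y → Setting.pow (p ^ k) K (FiniteField._+_ K x y) (p ^ k) ≡ FiniteField._+_ K (Setting.pow (p ^ k) K x (p ^ k)) (Setting.pow (p ^ k) K y (p ^ k))
  pow-+ x y = trans (pow≡^ (p ^ k) _ (p ^ k)) (trans (^-primePower-+ {m = k ℕ.* 4} p-prime (trans card≡ (ℕ.^-*-assoc p k 4)) k x y)
    (sym (cong₂ (FiniteField._+_ K) (pow≡^ (p ^ k) x (p ^ k)) (pow≡^ (p ^ k) y (p ^ k)))))
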